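{- Fix $k\in\mathbb{Z}_{\geq 1}$ and a set of patterns $B\subseteq\mathcal S$. Then the feasible region $P^{\mathrm{Av}(B)}_k$ is a closed subset of $[0,1]^{\mathcal S_k}$ and $$P^{\mathrm{Av}(B)}_k\subseteq P(\mathcal{O}v(k,\mathrm{Av}(B)))\subseteq P_k .$$ Moreover, if $\mathrm{Av}(B)$ is closed under the operation $\oplus$ or closed under the operation $\ominus$, then $P^{\mathrm{Av}(B)}_k$ is convex and $\dim(P^{\mathrm{Av}(B)}_k)\leq |\mathrm{Av}_k(B)|-|\mathrm{Av}_{k-1}(B)|$. In particular, for every single pattern $\tau\in\mathcal S$, $P^{\mathrm{Av}(\tau)}_k$ is convex.
   Context: For $n\ge1$, $\mathcal S_n$ is the set of permutations of $[n]=\{1,\dots,n\}$ in one-line notation, $\mathcal S=\bigcup_{n\ge1}\mathcal S_n$; by convention $\mathcal S_0$ and $\mathrm{Av}_0(B)$ consist of the empty permutation. For distinct reals $x_1,\dots,x_m$, $\mathrm{std}(x_1,\dots,x_m)$ is the unique $\pi\in\mathcal S_m$ with $\pi(i)<\pi(j)\iff x_i<x_j$. For $\sigma\in\mathcal S_n$ and $I=\{i_1<\dots<i_m\}\subseteq[n]$, $\mathrm{pat}_I(\sigma)=\mathrm{std}(\sigma(i_1),\dots,\sigma(i_m))$. A permutation $\sigma$ contains $\pi$ if $\mathrm{pat}_I(\sigma)=\pi$ for some $I$, and avoids $\pi$ otherwise. For $B\subseteq\mathcal S$, $\mathrm{Av}_n(B)$ is the set of permutations of size $n$ avoiding every element of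 $B$, and $\mathrm{Av}(B)=\bigcup_{n\ge1}\mathrm{Av}_n(B)$; $\mathrm{Av}(\tau)=\mathrm{Av}(\{\tau\})$. For $\pi\in\mathcal S_k$, $\sigma\in\mathcal S_n$, $\mathrm{c\text{ - }occ}(\pi,\sigma)$ is the number of intervals $I=\{i,i+1,\dots,i+k-1\}\subseteq[n]$ with $\mathrm{pat}_I(\sigma)=\pi$, and $\widetilde{\mathrm{c\text{ - }occ}}(\pi,\sigma)=\mathrm{c\text{ - }occ}(\pi,\sigma)/n$. Feasible region: $P^{\mathrm{Av}(B)}_k$ is the set of $\vec v\in[0,1]^{\mathcal S_k}$ for which there is a sequence $(\sigma^m)_{m\ge1}$ in $\mathrm{Av}(B)$ with $|\sigma^m|\to\infty$ and $\widetilde{\mathrm{c\text{ - }occ}}(\pi,\sigma^m)\to\vec v_\pi$ for all $\pi\in\mathcal S_k$; $P_k$ denotes this set when $B=\emptyset$ (all permutations allowed). Graphs are directed multigraphs (loops and parallel edges allowed); $\mathrm{st}(e),\mathrm{ar}(e)$ denote start and arrival vertex of edge $e$. A walk is a sequence of edges $(e_1,\dots,e_m)$ with $\mathrm{ar}(e_i)=\mathrm{st}(e_{i+1})$; it is a cycle if $\mathrm{st}(e_1)=\mathrm{ar}(e_m)$, and a simple cycle if moreover its edges are distinct and the vertices $\mathrm{st}(e_1),\dots,\mathrm{st}(e_m)$ are distinct. For a nonempty cycle $\mathcal C$ of $G=(V,E)$, $\vec e_{\mathcal C}\in\mathbb R^E$ has $e$-coordinate equal to (number of occurrences of $e$ in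 $\mathcal C$)$/|\mathcal C|$. The cycle polytope is $P(G)=\mathrm{conv}\{\vec e_{\mathcal C}:\mathcal C\text{ a simple cycle of }G\}$. Overlap graph: $\mathcal{O}v(k,\mathrm{Av}(B))$ has vertex set $\mathrm{Av}_{k-1}(B)$ and, for each $\pi\in\mathrm{Av}_k(B)$, one edge labelled $\pi$ from $\mathrm{pat}_{\{1,\dots,k-1\}}(\pi)$ to $\mathrm{pat}_{\{2,\dots,k\}}(\pi)$. Since its edges are in bijection with $\mathrm{Av}_k(B)$, its cycle polytope lies in $\mathbb R^{\mathrm{Av}_k(B)}$, which is identified with the subspace of $\mathbb R^{\mathcal S_k}$ of vectors vanishing outside $\mathrm{Av}_k(B)$. Direct sum: for $\tau\in\mathcal S_m,\sigma\in\mathcal S_n$, $\tau\oplus\sigma=\tau(1)\cdots\tau(m)(\sigma(1)+m)\cdots(\sigma(n)+m)$; skew sum $\tau\ominus\sigma=(\tau(1)+n)\cdots(\tau(m)+n)\sigma(1)\cdots\sigma(n)$. $\mathrm{Av}(B)$ is closed under $\oplus$ if $\tau,\sigma\in\mathrm{Av}(B)$ implies $\tau\oplus\sigma\in\mathrm{Av}(B)$ (similarly for $\ominus$). The dimension of a convex set is the dimension of its affine hull. -}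

module Defs where

open import Level using (0ℓ)
open import Algebra.Bundles using (CommutativeRing)
open import Algebra.Core using (Op₁)
import Algebra.Definitions.RawMonoid as RawMonoidDefs
open import Data.Fin.Base as Fin using (Fin; zero; suc; toℕ; fromℕ<; inject₁; cast; _↑ˡ_; _↑ʳ_)
import Data.Fin.Properties as Finₚ
open import Data.Integer.Base using (ℤ; -1ℤ) renaming (+_ to fromℕ)
open import Data.Irrelevant using ([_])
open import Data.List.Base using (filter; length; map)
open import Data.List.NonEmpty.Base using (List⁺; head; last; toList)
open import Data.List.Relation.Unary.Linked using (Linked)
import Data.List.Relation.Unary.Unique.Propositional as ListUnique
open import Data.Nat.Base as ℕ using (ℕ; zero; suc; pred; _∸_)
import Data.Nat.Properties as ℕₚ
open import Data.Product.Base using (Σ; ∃; _×_; _,_; proj₂)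
open import Data.Refinement using (Refinement-syntax; _,_; value; value-injective) renaming (_≟_ to ≟-refinement)
open import Data.Unit.Base using (⊤; tt)
open import Data.Vec.Base as Vec using (Vec; []; _∷_; lookup; tabulate; count; allFin; _++_)
import Data.Vec.Properties as Vecₚ
import Data.Vec.Relation.Unary.All as All
import Data.Vec.Relation.Unary.AllPairs.Properties as AllPairsₚ
open import Data.Vec.Relation.Unary.Unique.Propositional using (Unique)
open import Data.Vec.Relation.Unary.Unique.Propositional.Properties using (tabulate⁺; map⁺; lookup-injective)
open import Function.Base using (_∘_)
open import Function.Bundles using (_↔_; _⇔_; Equivalence; mk⇔)
open import Relation.Binary.Core using (Rel)
open import Relation.Binary.Definitions using (DecidableEquality; tri<; tri≈; tri>)
open import Relation.Binary.PropositionalEquality using (_≡_; _≢_; refl; sym; trans; cong; subst; subst₂)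
open import Relation.Binary.Structures using (IsTotalOrder)
open import Relation.Nullary using (¬_; yes; no; contradiction)
open import Relation.Unary using (Pred; Decidable; _∈_; Empty)

module _ {A : Set} {P Q : Pred A 0ℓ} (P? : Decidable P) (Q? : Decidable Q)
         (P⇒Q : ∀ {x} → P x → Q x) where

  count-mono : ∀ {n} (xs : Vec A n) → count P? xs ℕ.≤ count Q? xs
  count-mono [] = ℕ.z≤n
  count-mono (x ∷ xs) with P? x | Q? x
  ... | yes _ | yes _ = ℕ.s≤s (count-mono xs)
  ... | yes p | no ¬q = contradiction (P⇒Q p) ¬q
  ... | no _  | yes _ = ℕₚ.m≤n⇒m≤1+n (count-mono xs)
  ... | no _  | no _  = count-mono xs

  count-mono-< : ∀ {n} (xs : Vec A n) i → ¬ P (lookup xs i) → Q (lookup xs i) →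
                 count P? xs ℕ.< count Q? xs
  count-mono-< (x ∷ xs) zero ¬p q with P? x | Q? x
  ... | yes p | _     = contradiction p ¬p
  ... | no _  | no ¬q = contradiction q ¬q
  ... | no _  | yes _ = ℕ.s≤s (count-mono xs)
  count-mono-< (x ∷ xs) (suc i) ¬p q with P? x | Q? x
  ... | yes _ | yes _ = ℕ.s≤s (count-mono-< xs i ¬p q)
  ... | yes p | no ¬q = contradiction (P⇒Q p) ¬q
  ... | no _  | yes _ = ℕₚ.m≤n⇒m≤1+n (count-mono-< xs i ¬p q)
  ... | no _  | no _  = count-mono-< xs i ¬p q

-- One-line notation, with positions and values in Fin n (that is, shifted
-- to {0,…,n-1}).  The distinctness proof is irrelevant, so two permutations
-- are propositionally equal as soon as their one-line notations are.

S : ℕ → Set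
S n = [ w ∈ Vec (Fin n) n ∣ Unique w ]

infix 4 _≟ˢ_
_≟ˢ_ : ∀ {n} → DecidableEquality (S n)
_≟ˢ_ = ≟-refinement (Vecₚ.≡-dec Finₚ._≟_)

infixl 9 _⟨_⟩
_⟨_⟩ : ∀ {n} → S n → Fin n → Fin n
σ ⟨ i ⟩ = lookup (value σ) i

-- The union of the S n over n ≥ 1: a pair (n , σ) is a permutation of size
-- suc n.

𝒮 : Set
𝒮 = Σ ℕ (S ∘ suc)

size : 𝒮 → ℕ
size (n , _) = suc n

rank : ∀ {m n} → (Fin m → Fin n) → Fin m → ℕ
rank x i = count (λ j → x j Finₚ.<? x i) (allFin _)

lookup-allFin : ∀ {m} (P : Pred (Fin m) 0ℓ) i → P i → P (lookup (allFin m) i)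
lookup-allFin P i = subst P (sym (Vecₚ.lookup-allFin i))

rank-< : ∀ {m n} (x : Fin m → Fin n) {i j} → x i Fin.< x j → rank x i ℕ.< rank x j
rank-< x {i} {j} i<j =
  count-mono-< (λ k → x k Finₚ.<? x i) (λ k → x k Finₚ.<? x j)
    (λ k<i → ℕₚ.<-trans k<i i<j) (allFin _) i
    (lookup-allFin (λ k → ¬ x k Fin.< x i) i (ℕₚ.<-irrefl refl))
    (lookup-allFin (λ k → x k Fin.< x j) i i<j)

rank-bound : ∀ {m n} (x : Fin m → Fin n) i → rank x i ℕ.< m
rank-bound {m} x i = ℕₚ.<-≤-trans
  (count-mono-< {Q = λ _ → ⊤} (λ k → x k Finₚ.<? x i) (λ _ → yes tt) (λ _ → tt)
    (allFin m) i (lookup-allFin (λ k → ¬ x k Fin.< x i) i (ℕₚ.<-irrefl refl)) tt)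
  (Vecₚ.count≤n {P = λ _ → ⊤} (λ _ → yes tt) (allFin m))

rank-injective : ∀ {m n} (x : Fin m → Fin n) → (∀ {i j} → x i ≡ x j → i ≡ j) →
                 ∀ {i j} → rank x i ≡ rank x j → i ≡ j
rank-injective x inj {i} {j} eq with Finₚ.<-cmp (x i) (x j)
... | tri< i<j _ _ = contradiction eq (ℕₚ.<⇒≢ (rank-< x i<j))
... | tri≈ _ e _   = inj e
... | tri> _ _ j<i = contradiction (sym eq) (ℕₚ.<⇒≢ (rank-< x j<i))

rank-word : ∀ {m n} → (Fin m → Fin n) → Vec (Fin m) m
rank-word x = tabulate (λ i → fromℕ< (rank-bound x i))

rank-unique : ∀ {m n} (x : Fin m → Fin n) → (∀ {i j} → x i ≡ x j → i ≡ j) →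
              Unique (rank-word x)
rank-unique x inj =
  tabulate⁺ (λ e → rank-injective x inj (Finₚ.fromℕ<-injective _ _ _ _ e))

-- std x sends i to the number of entries smaller than x i; std-spec is the
-- property characterising it.

std : ∀ {m n} (x : Fin m → Fin n) → .(∀ {i j} → x i ≡ x j → i ≡ j) → S m
std x inj = rank-word x , [ rank-unique x inj ]

toℕ-std : ∀ {m n} (x : Fin m → Fin n) .(inj : ∀ {i j} → x i ≡ x j → i ≡ j) i →
          toℕ (std x inj ⟨ i ⟩) ≡ rank x i
toℕ-std x inj i = trans (cong toℕ (Vecₚ.lookup∘tabulate _ i)) (Finₚ.toℕ-fromℕ< _)

std-spec : ∀ {m n} (x : Fin m → Fin n) .(inj : ∀ {i j} → x i ≡ x j → i ≡ j) i j →
           std x inj ⟨ i ⟩ Fin.< std x inj ⟨ j ⟩ ⇔ x i Fin.< x j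
std-spec x inj i j = mk⇔
  (λ lt → reflect (subst₂ ℕ._<_ (toℕ-std x inj i) (toℕ-std x inj j) lt))
  (λ lt → subst₂ ℕ._<_ (sym (toℕ-std x inj i)) (sym (toℕ-std x inj j)) (rank-< x lt))
  where
  reflect : rank x i ℕ.< rank x j → x i Fin.< x j
  reflect lt with Finₚ.<-cmp (x i) (x j)
  ... | tri< i<j _ _ = i<j
  ... | tri≈ _ e _   = contradiction
          (cong (λ v → count (λ k → x k Finₚ.<? v) (allFin _)) e) (ℕₚ.<⇒≢ lt)
  ... | tri> _ _ j<i = contradiction lt (ℕₚ.<-asym (rank-< x j<i))

std-cong : ∀ {m n p} (x : Fin m → Fin n) (y : Fin m → Fin p)
           .(xi : ∀ {i j} → x i ≡ x j → i ≡ j) .(yi : ∀ {i j} → y i ≡ y j → i ≡ j) →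
           (∀ i j → x i Fin.< x j ⇔ y i Fin.< y j) → std x xi ≡ std y yi
std-cong x y xi yi same = value-injective (Vecₚ.tabulate-cong λ i →
  Finₚ.fromℕ<-cong _ _ (ℕₚ.≤-antisym
    (count-mono _ _ (λ {k} → Equivalence.to (same k i)) (allFin _))
    (count-mono _ _ (λ {k} → Equivalence.from (same k i)) (allFin _))) _ _)

-- A set of positions I = {i₁ < … < iₘ} ⊆ [n], as its increasing enumeration.

record Positions (m n : ℕ) : Set where
  field
    at         : Fin m → Fin n
    increasing : ∀ {i j} → i Fin.< j → at i Fin.< at j

  at-injective : ∀ {i j} → at i ≡ at j → i ≡ j
  at-injective {i} {j} e with Finₚ.<-cmp i j
  ... | tri< i<j _ _ = contradiction (cong toℕ e) (ℕₚ.<⇒≢ (increasing i<j))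
  ... | tri≈ _ i≡j _ = i≡j
  ... | tri> _ _ j<i = contradiction (sym (cong toℕ e)) (ℕₚ.<⇒≢ (increasing j<i))

open Positions public

restrict-injective : ∀ {m n} (I : Positions m n) {w : Vec (Fin n) n} → Unique w →
                     ∀ {i j} → lookup w (at I i) ≡ lookup w (at I j) → i ≡ j
restrict-injective I u e = at-injective I (lookup-injective u _ _ e)

pat : ∀ {m n} → Positions m n → S n → S m
pat I (w , [ u ]) = std (λ i → lookup w (at I i)) (restrict-injective I u)

Contains : ∀ {m n} → S n → S m → Set
Contains σ π = ∃ λ I → pat I σ ≡ π

_∘ᵖ_ : ∀ {l m n} → Positions m n → Positions l m → Positions l n
I ∘ᵖ J = record { at = at I ∘ at J ; increasing = increasing I ∘ increasing J }

pat-∘ : ∀ {l m n} (I : Positions m n) (J : Positions l m) (σ : S n) →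
        pat (I ∘ᵖ J) σ ≡ pat J (pat I σ)
pat-∘ I J (w , [ u ]) = std-cong _ _
  (restrict-injective (I ∘ᵖ J) u)
  (restrict-injective J (rank-unique (λ k → lookup w (at I k)) (restrict-injective I u)))
  λ i j →
  let e = std-spec (λ k → lookup w (at I k)) (restrict-injective I u) (at J i) (at J j)
  in mk⇔ (Equivalence.from e) (Equivalence.to e)

Avoids : Pred 𝒮 0ℓ → ∀ {n} → Pred (S n) 0ℓ
Avoids B σ = ∀ τ → τ ∈ B → ¬ Contains σ (proj₂ τ)

-- Avₙ(B) as a type; the avoidance proof is irrelevant, so each permutation
-- gives at most one inhabitant.

Avₙ : Pred 𝒮 0ℓ → ℕ → Set
Avₙ B n = [ σ ∈ S n ∣ Avoids B σ ]

Av : Pred 𝒮 0ℓ → Pred 𝒮 0ℓ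
Av B (_ , σ) = Avoids B σ

avoids-pat : ∀ B {m n} (I : Positions m n) (σ : S n) → Avoids B σ → Avoids B (pat I σ)
avoids-pat B I σ av τ τ∈B (J , e) = av τ τ∈B (I ∘ᵖ J , trans (pat-∘ I J σ) e)

window-bound : ∀ {k n} (i : Fin (suc n ∸ k)) (j : Fin k) → toℕ i ℕ.+ toℕ j ℕ.< n
window-bound {k} {n} i j = ℕₚ.<-≤-trans
  (ℕₚ.+-monoʳ-< (toℕ i) (Finₚ.toℕ<n j))
  (ℕ.s≤s⁻¹ (ℕₚ.m≤o∸n⇒m+n≤o (suc (toℕ i)) k≤1+n (Finₚ.toℕ<n i)))
  where
  k≤1+n : k ℕ.≤ suc n
  k≤1+n with k ℕₚ.≤? suc n
  ... | yes p = p
  ... | no ¬p = contradiction (Finₚ.toℕ<n i)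
                  (subst (λ z → ¬ toℕ i ℕ.< z)
                    (sym (ℕₚ.m≤n⇒m∸n≡0 (ℕₚ.<⇒≤ (ℕₚ.≰⇒> ¬p)))) ℕₚ.n≮0)

-- The intervals of k ≥ 1 consecutive positions of [n]: there are n - k + 1 of
-- them if k ≤ n and none otherwise, and window i starts at position i.

window : ∀ {k n} → Fin (suc n ∸ k) → Positions k n
window i = record
  { at = λ j → fromℕ< (window-bound i j)
  ; increasing = λ {j} {j′} j<j′ → subst₂ ℕ._<_
      (sym (Finₚ.toℕ-fromℕ< (window-bound i j))) (sym (Finₚ.toℕ-fromℕ< (window-bound i j′)))
      (ℕₚ.+-monoʳ-< (toℕ i) j<j′)
  }

c-occ : ∀ {k n} → S k → S n → ℕ
c-occ {k} {n} π σ = count (λ i → pat (window i) σ ≟ˢ π) (allFin (suc n ∸ k))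

++-unique : ∀ {A : Set} {m n} {xs : Vec A m} {ys : Vec A n} → Unique xs → Unique ys →
            (∀ i j → lookup xs i ≢ lookup ys j) → Unique (xs ++ ys)
++-unique {xs = xs} {ys} ux uy disj = AllPairsₚ.++⁺ ux uy
  (all xs λ i → all ys λ j → disj i j)
  where
  all : ∀ {A : Set} {n} {P : Pred A 0ℓ} (zs : Vec A n) → (∀ i → P (lookup zs i)) → All.All P zs
  all []       f = All.[]
  all (z ∷ zs) f = f zero All.∷ all zs (f ∘ suc)

↑-disjoint : ∀ {m n} (i : Fin m) (j : Fin n) → i ↑ˡ n ≢ m ↑ʳ j
↑-disjoint {m} {n} i j e = ℕₚ.<⇒≢
  (ℕₚ.<-≤-trans (Finₚ.toℕ<n i) (ℕₚ.m≤m+n m (toℕ j)))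
  (trans (sym (Finₚ.toℕ-↑ˡ i n)) (trans (cong toℕ e) (Finₚ.toℕ-↑ʳ m j)))

cast-injective : ∀ {m n} .(e : m ≡ n) {i j : Fin m} → cast e i ≡ cast e j → i ≡ j
cast-injective e {i} {j} p = Finₚ.toℕ-injective
  (trans (sym (Finₚ.toℕ-cast e i)) (trans (cong toℕ p) (Finₚ.toℕ-cast e j)))

infixl 6 _⊕_ _⊖_

_⊕_ : ∀ {m n} → S m → S n → S (m ℕ.+ n)
_⊕_ {m} {n} (v , [ u ]) (w , [ u′ ]) =
  Vec.map (_↑ˡ n) v ++ Vec.map (m ↑ʳ_) w ,
  [ ++-unique (map⁺ (Finₚ.↑ˡ-injective n _ _) u) (map⁺ (Finₚ.↑ʳ-injective m _ _) u′)
      (λ i j e → ↑-disjoint (lookup v i) (lookup w j)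
        (trans (sym (Vecₚ.lookup-map i _ v)) (trans e (Vecₚ.lookup-map j _ w)))) ]

-- The values live in Fin (n + m) before the cast to Fin (m + n).

_⊖_ : ∀ {m n} → S m → S n → S (m ℕ.+ n)
_⊖_ {m} {n} (v , [ u ]) (w , [ u′ ]) =
  Vec.map (cast n+m ∘ (n ↑ʳ_)) v ++ Vec.map (cast n+m ∘ (_↑ˡ m)) w ,
  [ ++-unique (map⁺ (Finₚ.↑ʳ-injective n _ _ ∘ cast-injective n+m) u)
      (map⁺ (Finₚ.↑ˡ-injective m _ _ ∘ cast-injective n+m) u′)
      (λ i j e → ↑-disjoint (lookup w j) (lookup v i) (sym (cast-injective n+m
        (trans (sym (Vecₚ.lookup-map i _ v)) (trans e (Vecₚ.lookup-map j _ w)))))) ]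
  where
  n+m : n ℕ.+ m ≡ m ℕ.+ n
  n+m = ℕₚ.+-comm n m

_Closed-under_ : Pred 𝒮 0ℓ → (∀ {m n} → S m → S n → S (m ℕ.+ n)) → Set
C Closed-under _∙_ = ∀ {m n} {τ : S (suc m)} {σ : S (suc n)} →
  (m , τ) ∈ C → (n , σ) ∈ C → (m ℕ.+ suc n , τ ∙ σ) ∈ C

record Graph : Set₁ where
  field
    V E   : Set
    st ar : E → V
    _≟ᴱ_  : DecidableEquality E

record IsSimpleCycle (G : Graph) (C : List⁺ (Graph.E G)) : Set where
  open Graph G
  field
    walk              : Linked (λ e f → ar e ≡ st f) (toList C)
    closed            : st (head C) ≡ ar (last C)
    edges-distinct    : ListUnique.Unique (toList C)
    vertices-distinct : ListUnique.Unique (map st (toList C))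

-- The positions {1,…,k-1} and {2,…,k} in [k].

beginning ending : ∀ k → Positions (pred k) k
beginning zero    = record { at = λ () ; increasing = λ {} }
beginning (suc k) = record
  { at = inject₁
  ; increasing = λ {i} {j} → subst₂ ℕ._<_ (sym (Finₚ.toℕ-inject₁ i)) (sym (Finₚ.toℕ-inject₁ j)) }
ending zero    = record { at = λ () ; increasing = λ {} }
ending (suc k) = record { at = suc ; increasing = ℕ.s≤s }

OverlapGraph : ℕ → Pred 𝒮 0ℓ → Graph
OverlapGraph k B = record
  { V    = Avₙ B (pred k)
  ; E    = Avₙ B k
  ; st   = restrict (beginning k)
  ; ar   = restrict (ending k)
  ; _≟ᴱ_ = ≟-refinement _≟ˢ_
  }
  where
  restrict : Positions (pred k) k → Avₙ B k → Avₙ B (pred k)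
  restrict I (π , [ av ]) = pat I π , [ avoids-pat B I π av ]

_HasCardinality_ : Set → ℕ → Set
A HasCardinality n = Fin n ↔ A

-- Up to isomorphism ℝ is the only complete ordered field.  The library has no
-- construction of it, so it is taken as a structure with these axioms.  The
-- value of 0# ⁻¹ is unspecified.

record CompleteOrderedField : Set₁ where
  field
    commutativeRing : CommutativeRing 0ℓ 0ℓ
  open CommutativeRing commutativeRing public hiding (refl; sym; trans)
  infix 4 _≤_
  infix 8 _⁻¹
  field
    0≉1          : ¬ 0# ≈ 1#
    _⁻¹          : Op₁ Carrier
    ⁻¹-inverseʳ  : ∀ x → ¬ x ≈ 0# → x * x ⁻¹ ≈ 1#
    _≤_          : Rel Carrier 0ℓ
    isTotalOrder : IsTotalOrder _≈_ _≤_
    +-monoˡ-≤    : ∀ z {x y} → x ≤ y → x + z ≤ y + z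
    *-nonNeg     : ∀ {x y} → 0# ≤ x → 0# ≤ y → 0# ≤ x * y

  _IsUpperBoundOf_ : Carrier → Pred Carrier 0ℓ → Set
  b IsUpperBoundOf P = ∀ x → x ∈ P → x ≤ b

  field
    supremum : ∀ (P : Pred Carrier 0ℓ) → ∃ P → ∃ (_IsUpperBoundOf P) →
               ∃ λ s → s IsUpperBoundOf P × (∀ b → b IsUpperBoundOf P → s ≤ b)

module OverReals (ℝ-field : CompleteOrderedField) where

  open CompleteOrderedField ℝ-field renaming (Carrier to ℝ)
  open RawMonoidDefs +-rawMonoid using (sum) renaming (_×_ to _·_)

  infix 4 _<_
  _<_ : Rel ℝ 0ℓ
  x < y = x ≤ y × ¬ x ≈ y

  _÷_ : ℕ → ℕ → ℝ
  a ÷ b = (a · 1#) * (b · 1#) ⁻¹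

  ∣_-_∣<_ : ℝ → ℝ → ℝ → Set
  ∣ x - y ∣< ε = x < y + ε × y < x + ε

  infix 4 _⟶_
  _⟶_ : (ℕ → ℝ) → ℝ → Set
  f ⟶ l = ∀ ε → 0# < ε → ∃ λ N → ∀ m → N ℕ.≤ m → ∣ f m - l ∣< ε

  infix 9 ℝ^_
  ℝ^_ : Set → Set
  ℝ^ A = A → ℝ

  module _ {A : Set} where

    infix 4 _≋_
    _≋_ : Rel (ℝ^ A) 0ℓ
    v ≋ w = ∀ a → v a ≈ w a

    UnitCube : Pred (ℝ^ A) 0ℓ
    UnitCube v = ∀ a → 0# ≤ v a × v a ≤ 1#

    -- X contains all its adherent points, for the sup distance.

    Closed : Pred (ℝ^ A) 0ℓ → Set
    Closed X = ∀ v → (∀ ε → 0# < ε → ∃ λ w → w ∈ X × (∀ a → ∣ w a - v a ∣< ε)) → v ∈ X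

    Convex : Pred (ℝ^ A) 0ℓ → Set
    Convex X = ∀ {u v} → u ∈ X → v ∈ X → ∀ t → 0# ≤ t → t ≤ 1# →
               (λ a → (1# - t) * u a + t * v a) ∈ X

    lin : ∀ {n} → (Fin n → ℝ) → (Fin n → ℝ^ A) → ℝ^ A
    lin c p a = sum (λ i → c i * p i a)

    AffineHull : Pred (ℝ^ A) 0ℓ → Pred (ℝ^ A) 0ℓ
    AffineHull X v = ∃ λ n → Σ (Fin n → ℝ) λ c → Σ (Fin n → ℝ^ A) λ p →
      (∀ i → p i ∈ X) × sum c ≈ 1# × v ≋ lin c p

    ConvexHull : Pred (ℝ^ A) 0ℓ → Pred (ℝ^ A) 0ℓ
    ConvexHull X v = ∃ λ n → Σ (Fin n → ℝ) λ c → Σ (Fin n → ℝ^ A) λ p →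
      (∀ i → p i ∈ X) × (∀ i → 0# ≤ c i) × sum c ≈ 1# × v ≋ lin c p

    LinearlyIndependent : ∀ {n} → (Fin n → ℝ^ A) → Set
    LinearlyIndependent b = ∀ c → lin c b ≋ (λ _ → 0#) → ∀ i → c i ≈ 0#

    -- A nonempty affine subspace L has dimension n when L = p + span(b₁,…,bₙ)
    -- with b₁,…,bₙ linearly independent; the empty one has dimension -1.

    data AffineDimension (L : Pred (ℝ^ A) 0ℓ) : ℤ → Set where
      empty : Empty L → AffineDimension L -1ℤ
      flat  : ∀ {n} (p : ℝ^ A) (b : Fin n → ℝ^ A) → LinearlyIndependent b →
              (∀ v → v ∈ L ⇔ ∃ λ c → v ≋ (λ a → p a + lin c b a)) →
              AffineDimension L (fromℕ n)

    Dimension : Pred (ℝ^ A) 0ℓ → ℤ → Set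
    Dimension X = AffineDimension (AffineHull X)

  module _ (G : Graph) where
    open Graph G

    cycleVector : List⁺ E → ℝ^ E
    cycleVector C e = length (filter (e ≟ᴱ_) (toList C)) ÷ length (toList C)

    CyclePolytope : Pred (ℝ^ E) 0ℓ
    CyclePolytope = ConvexHull λ v → ∃ λ C → IsSimpleCycle G C × v ≋ cycleVector C

  -- P(Ov(k,Av(B))) inside ℝ^(S k), identifying the vectors indexed by Avₖ(B)
  -- with those that vanish outside Avₖ(B).

  OverlapPolytope : ∀ k → Pred 𝒮 0ℓ → Pred (ℝ^ S k) 0ℓ
  OverlapPolytope k B v =
    (∀ π → ¬ Avoids B π → v π ≈ 0#) × (v ∘ value) ∈ CyclePolytope (OverlapGraph k B)

  c-occ~ : ∀ {k} → S k → 𝒮 → ℝ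
  c-occ~ π (n , σ) = c-occ π σ ÷ suc n

  FeasibleRegion : ∀ k → Pred 𝒮 0ℓ → Pred (ℝ^ S k) 0ℓ
  FeasibleRegion k B v = v ∈ UnitCube × ∃ λ (σ : ℕ → 𝒮) →
    (∀ m → σ m ∈ Av B) ×
    (∀ N → ∃ λ M → ∀ m → M ℕ.≤ m → N ℕ.≤ size (σ m)) ×
    (∀ π → (λ m → c-occ~ π (σ m)) ⟶ v π)

-- The windows of a permutation σ in Av(B) form a walk in the overlap graph, so the frequencies of
-- its consecutive patterns satisfy flow conservation up to O(1/|σ|).  Points of the feasible region
-- are therefore nonnegative circulations of total weight 1, and these are convex combinations of
-- simple cycles: as long as the support is nonempty it contains a simple cycle, and subtracting the
-- largest possible multiple of it makes the support smaller.  Conversely every walk in the overlap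
-- graph is the window sequence of some permutation (prepend one entry per edge, choosing its value
-- to fit the next pattern), and going round a cycle many times realises its vector.
--
-- If Av(B) is closed under ⊕ or ⊖, then concatenating suitable numbers of copies of two long
-- permutations realises any convex combination, because only the few windows across block boundaries
-- are lost.  Moreover u ⊕ w contains a walk from u to w, so the overlap graph is connected; hence
-- total weight together with conservation at all vertices but one are |Avₖ₋₁(B)| independent linear
-- constraints, orthogonal to all differences of feasible points.
--
-- Av(τ) is closed under ⊖ if τ starts lower than it ends, and under ⊕ otherwise: an occurrence of τ
-- that straddles the two blocks has its first entry in one and its last entry in the other.

module Submission where

open import Level using (0ℓ)
open import Algebra.Bundles using (CommutativeRing)
import Algebra.Properties.AbelianGroup
import Algebra.Properties.CommutativeMonoid.Sum
import Algebra.Properties.Monoid.Mult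
import Algebra.Properties.Monoid.Mult.TCOptimised
import Algebra.Properties.Ring
import Algebra.Properties.Semiring.Mult
import Algebra.Properties.Semiring.Mult.TCOptimised
import Algebra.Properties.Semiring.Sum
import Algebra.Solver.Ring
import Algebra.Solver.Ring.AlmostCommutativeRing as ACR
open import Axiom.ExcludedMiddle using (ExcludedMiddle)
open import Data.Fin.Base as Fin
  using (Fin; zero; suc; toℕ; punchIn; punchOut; splitAt; _↑ˡ_; _↑ʳ_; fromℕ<; inject₁)
import Data.Fin.Properties as Finₚ
open import Data.Integer.Base as ℤ using (ℤ; +_; -[1+_])
import Data.Integer.Properties as ℤₚ
open import Data.Irrelevant using ([_])
open import Data.List.Base as List using (List; []; _∷_; _++_; length; filter; map)
import Data.List.Membership.Propositional as LMem
import Data.List.Membership.Propositional.Properties as LMemₚ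
open import Data.List.NonEmpty.Base using (List⁺; _∷_; last; toList)
import Data.List.Properties as Listₚ
open import Data.List.Relation.Unary.All as LAll using (All; []; _∷_)
import Data.List.Relation.Unary.All.Properties as LAllₚ
open import Data.List.Relation.Unary.AllPairs using ([]; _∷_)
open import Data.List.Relation.Unary.Any as LAny using (here; there)
open import Data.List.Relation.Unary.Linked using (Linked; [-]; _∷_)
import Data.List.Relation.Unary.Unique.Propositional as LUnique
import Data.List.Relation.Unary.Unique.Propositional.Properties as LUniqueₚ
open import Data.Maybe.Base as Maybe using (Maybe)
open import Data.Nat.Base as ℕ using (ℕ; zero; suc; pred; NonZero)
import Data.Nat.Properties as ℕₚ
open import Data.Product.Base using (∃; Σ; _×_; _,_; proj₁; proj₂)
open import Data.Refinement using (_,_; value; value-injective)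
open import Data.Sum.Base using (_⊎_; inj₁; inj₂; [_,_]′)
open import Data.Vec.Base as Vec using (Vec; []; _∷_; tabulate; count; lookup)
import Data.Vec.Properties as Vecₚ
import Data.Vec.Relation.Unary.All as VAll
import Data.Vec.Relation.Unary.All.Properties as VAllₚ
import Data.Vec.Relation.Unary.AllPairs as VAllPairs
open import Data.Vec.Relation.Unary.Unique.Propositional.Properties using (map⁺; lookup-injective)
open import Function.Base using (_∘_; id)
open import Function.Bundles using (_⇔_; Equivalence; Inverse; mk⇔; mk↔ₛ′)
import Relation.Binary.Reasoning.Setoid
open import Relation.Binary.PropositionalEquality
  using (_≡_; _≢_; refl; sym; trans; cong; cong₂; subst; subst₂; module ≡-Reasoning)
open import Relation.Binary.Structures using (IsEquivalence; IsTotalOrder)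
open import Relation.Nullary using (¬_; Dec; yes; no; contradiction; dec⇒maybe; recompute)
open import Relation.Unary using (Pred; Decidable; _∈_; _⊆_; ∅; ｛_｝)
open import Defs

-- Complete ordered fields

-- The feasible region is handled through `Approximable`: one permutation for each precision, with
-- the error bound multiplied by the size. The analysis then consists of polynomial inequalities
-- between counts, closed by ring identities (`certify`), and equations between reals come from
-- `near⇒≈`. The inclusion of the overlap polytope in P_k rests on convexity of P_k, because a
-- closed walk realises only a single cycle; this is the case `B` = `∅` of the convexity statement.
-- The dimension bound is obtained by counting: independent directions and independent constraints,
-- being mutually orthogonal, together form an independent family in the space of edge weights. An
-- empty region has dimension -1, so there the bound is read off the graph itself. The parameter `k`
-- of the modules stands for the pattern length minus one. The graph of `k` = 0 has the empty
-- permutation as its only vertex and is treated apart, since block sums of empty permutations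
-- contain no edge.

module IntegerCoefficients (R : CommutativeRing 0ℓ 0ℓ) where
  open CommutativeRing R renaming (refl to ≈-refl; sym to ≈-sym; trans to ≈-trans)
  open Algebra.Properties.Monoid.Mult.TCOptimised +-monoid using (1+×; ×-homo-+) renaming (_×_ to _×ₜ_)
  open Algebra.Properties.Semiring.Mult.TCOptimised semiring using (×1-homo-*)
  open Algebra.Properties.Ring ring using (-‿distribˡ-*; -‿distribʳ-*; -‿involutive; -0#≈0#)
  open Algebra.Properties.AbelianGroup +-abelianGroup using (⁻¹-∙-comm)
  open Relation.Binary.Reasoning.Setoid setoid

  -- Integer coefficients let the ring solver cancel constants although equality in `R` is
  -- undecided. With the optimised multiple, `⟦ + 1 ⟧` is `1#` definitionally, so `con (+ 1)` in a
  -- solver equation matches `1#` as written.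
  ⟦_⟧ : ℤ → Carrier
  ⟦ + n ⟧      = n ×ₜ 1#
  ⟦ -[1+ n ] ⟧ = - (suc n ×ₜ 1#)

  ⟦⟧-⊖ : ∀ m n → ⟦ m ℤ.⊖ n ⟧ ≈ m ×ₜ 1# + - (n ×ₜ 1#)
  ⟦⟧-⊖ m zero = begin
    m ×ₜ 1#          ≈⟨ +-identityʳ _ ⟨
    m ×ₜ 1# + 0#     ≈⟨ +-congˡ -0#≈0# ⟨
    m ×ₜ 1# + - 0#   ∎
  ⟦⟧-⊖ zero (suc n) = ≈-sym (+-identityˡ _)
  ⟦⟧-⊖ (suc m) (suc n) = begin
    ⟦ suc m ℤ.⊖ suc n ⟧                    ≡⟨ cong ⟦_⟧ (ℤₚ.[1+m]⊖[1+n]≡m⊖n m n) ⟩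
    ⟦ m ℤ.⊖ n ⟧                            ≈⟨ ⟦⟧-⊖ m n ⟩
    m ×ₜ 1# + - (n ×ₜ 1#)                    ≈⟨ +-congʳ (+-identityˡ _) ⟨
    (0# + m ×ₜ 1#) + - (n ×ₜ 1#)             ≈⟨ +-congʳ (+-congʳ (-‿inverseʳ 1#)) ⟨
    (1# + - 1# + m ×ₜ 1#) + - (n ×ₜ 1#)      ≈⟨ +-congʳ (+-assoc _ _ _) ⟩
    (1# + (- 1# + m ×ₜ 1#)) + - (n ×ₜ 1#)    ≈⟨ +-congʳ (+-congˡ (+-comm _ _)) ⟩
    (1# + (m ×ₜ 1# + - 1#)) + - (n ×ₜ 1#)    ≈⟨ +-congʳ (+-assoc _ _ _) ⟨
    (1# + m ×ₜ 1# + - 1#) + - (n ×ₜ 1#)      ≈⟨ +-assoc _ _ _ ⟩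
    1# + m ×ₜ 1# + (- 1# + - (n ×ₜ 1#))      ≈⟨ +-congˡ (⁻¹-∙-comm _ _) ⟩
    1# + m ×ₜ 1# + - (1# + n ×ₜ 1#)          ≈⟨ +-cong (1+× m 1#) (-‿cong (1+× n 1#)) ⟨
    suc m ×ₜ 1# + - (suc n ×ₜ 1#)            ∎

  -‿homo : ∀ i → ⟦ ℤ.- i ⟧ ≈ - ⟦ i ⟧
  -‿homo (+ zero)  = ≈-sym -0#≈0#
  -‿homo (+ suc n) = ≈-refl
  -‿homo -[1+ n ]  = ≈-sym (-‿involutive _)

  +-homo : ∀ i j → ⟦ i ℤ.+ j ⟧ ≈ ⟦ i ⟧ + ⟦ j ⟧
  +-homo (+ m) (+ n) = ×-homo-+ 1# m n
  +-homo (+ m) -[1+ n ] = ⟦⟧-⊖ m (suc n)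
  +-homo -[1+ m ] (+ n) = ≈-trans (⟦⟧-⊖ n (suc m)) (+-comm _ _)
  +-homo -[1+ m ] -[1+ n ] = begin
    - (suc (suc (m ℕ.+ n)) ×ₜ 1#)          ≡⟨ cong (λ l → - (suc l ×ₜ 1#)) (sym (ℕₚ.+-suc m n)) ⟩
    - ((suc m ℕ.+ suc n) ×ₜ 1#)            ≈⟨ -‿cong (×-homo-+ 1# (suc m) (suc n)) ⟩
    - (suc m ×ₜ 1# + suc n ×ₜ 1#)           ≈⟨ ⁻¹-∙-comm _ _ ⟨
    - (suc m ×ₜ 1#) + - (suc n ×ₜ 1#)       ∎

  *-homoʳ : ∀ m j → ⟦ + m ℤ.* j ⟧ ≈ m ×ₜ 1# * ⟦ j ⟧
  *-homoʳ m (+ n) = begin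
    ⟦ + m ℤ.* + n ⟧        ≡⟨ cong ⟦_⟧ (ℤₚ.pos-* m n) ⟨
    (m ℕ.* n) ×ₜ 1#         ≈⟨ ×1-homo-* m n ⟩
    m ×ₜ 1# * (n ×ₜ 1#)      ∎
  *-homoʳ m -[1+ n ] = begin
    ⟦ + m ℤ.* ℤ.- + suc n ⟧     ≡⟨ cong ⟦_⟧ (ℤₚ.neg-distribʳ-* (+ m) (+ suc n)) ⟨
    ⟦ ℤ.- (+ m ℤ.* + suc n) ⟧   ≈⟨ -‿homo (+ m ℤ.* + suc n) ⟩
    - ⟦ + m ℤ.* + suc n ⟧       ≈⟨ -‿cong (*-homoʳ m (+ suc n)) ⟩
    - (m ×ₜ 1# * (suc n ×ₜ 1#))   ≈⟨ -‿distribʳ-* _ _ ⟩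
    m ×ₜ 1# * - (suc n ×ₜ 1#)     ∎

  *-homo : ∀ i j → ⟦ i ℤ.* j ⟧ ≈ ⟦ i ⟧ * ⟦ j ⟧
  *-homo (+ m) j = *-homoʳ m j
  *-homo -[1+ m ] j = begin
    ⟦ ℤ.- + suc m ℤ.* j ⟧     ≡⟨ cong ⟦_⟧ (ℤₚ.neg-distribˡ-* (+ suc m) j) ⟨
    ⟦ ℤ.- (+ suc m ℤ.* j) ⟧   ≈⟨ -‿homo (+ suc m ℤ.* j) ⟩
    - ⟦ + suc m ℤ.* j ⟧       ≈⟨ -‿cong (*-homoʳ (suc m) j) ⟩
    - (suc m ×ₜ 1# * ⟦ j ⟧)    ≈⟨ -‿distribˡ-* _ _ ⟩
    - (suc m ×ₜ 1#) * ⟦ j ⟧    ∎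

  almostRing : ACR.AlmostCommutativeRing 0ℓ 0ℓ
  almostRing = ACR.fromCommutativeRing R

  morphism : ℤ.+-*-rawRing ACR.-Raw-AlmostCommutative⟶ almostRing
  morphism = record
    { ⟦_⟧ = ⟦_⟧ ; +-homo = +-homo ; *-homo = *-homo ; -‿homo = -‿homo
    ; 0-homo = ≈-refl ; 1-homo = ≈-refl }

  ⟦⟧-≟ : ∀ i j → Maybe (⟦ i ⟧ ≈ ⟦ j ⟧)
  ⟦⟧-≟ i j = Maybe.map (λ i≡j → reflexive (cong ⟦_⟧ i≡j)) (dec⇒maybe (i ℤₚ.≟ j))

  open Algebra.Solver.Ring ℤ.+-*-rawRing almostRing morphism ⟦⟧-≟ public
    using (solve; _:+_; _:*_; _:-_; :-_; _:=_; con)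

module Reals (ℝ-field : CompleteOrderedField) where
  open CompleteOrderedField ℝ-field renaming (Carrier to ℝ) hiding (zero) public
  open OverReals ℝ-field public
  open IsTotalOrder isTotalOrder public
    using (total; antisym)
    renaming (refl to ≤-refl; trans to ≤-trans; reflexive to ≤-reflexive; ≤-respˡ-≈ to ≤-respˡ; ≤-respʳ-≈ to ≤-respʳ)
  module ≈ = IsEquivalence isEquivalence
  open IntegerCoefficients commutativeRing public
    using (solve; _:+_; _:*_; _:-_; :-_; _:=_; con)
  open Algebra.Properties.CommutativeMonoid.Sum +-commutativeMonoid public
    using (sum; sum-cong-≋; ∑-distrib-+; ∑-comm; sum-replicate-zero)
  open Algebra.Properties.Semiring.Sum semiring public using (*-distribˡ-sum; *-distribʳ-sum)
  open Algebra.Properties.Monoid.Mult +-monoid public using () renaming (_×_ to _·_)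
  private
    module Mult = Algebra.Properties.Monoid.Mult +-monoid
    module SMult = Algebra.Properties.Semiring.Mult semiring
  open Relation.Binary.Reasoning.Setoid setoid

  y-x≥0 : ∀ {x y} → x ≤ y → 0# ≤ y - x
  y-x≥0 {x} x≤y = ≤-respˡ (-‿inverseʳ x) (+-monoˡ-≤ (- x) x≤y)

  -- The form in which most estimates below are proved: `d` is a sum of products of nonnegative
  -- terms read off the hypotheses, and the equation is left to the ring solver.
  certify : ∀ {x y} d → 0# ≤ d → y - x ≈ d → x ≤ y
  certify {x} {y} d 0≤d eq =
    ≤-respˡ (+-identityˡ x)
      (≤-respʳ (solve 2 (λ x y → (y :- x) :+ x := y) ≈.refl x y)
        (+-monoˡ-≤ x (≤-respʳ (≈.sym eq) 0≤d)))

  +-nonNeg : ∀ {x y} → 0# ≤ x → 0# ≤ y → 0# ≤ x + y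
  +-nonNeg {x} {y} 0≤x 0≤y =
    ≤-trans 0≤y (≤-respˡ (+-identityˡ y) (+-monoˡ-≤ y 0≤x))

  +-mono-≤ : ∀ {w x y z} → w ≤ x → y ≤ z → w + y ≤ x + z
  +-mono-≤ {w} {x} {y} {z} w≤x y≤z = certify _ (+-nonNeg (y-x≥0 w≤x) (y-x≥0 y≤z))
    (solve 4 (λ w x y z → x :+ z :- (w :+ y) := (x :- w) :+ (z :- y)) ≈.refl w x y z)

  *-monoˡ-≤ : ∀ {x y} z → 0# ≤ z → x ≤ y → z * x ≤ z * y
  *-monoˡ-≤ {x} {y} z 0≤z x≤y = certify _ (*-nonNeg 0≤z (y-x≥0 x≤y))
    (solve 3 (λ x y z → z :* y :- z :* x := z :* (y :- x)) ≈.refl x y z)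

  x*x≥0 : ∀ x → 0# ≤ x * x
  x*x≥0 x with total 0# x
  ... | inj₁ 0≤x = *-nonNeg 0≤x 0≤x
  ... | inj₂ x≤0 = ≤-respʳ (solve 1 (λ x → (con (+ 0) :- x) :* (con (+ 0) :- x) := x :* x) ≈.refl x)
                     (*-nonNeg (y-x≥0 x≤0) (y-x≥0 x≤0))

  0≤1 : 0# ≤ 1#
  0≤1 = ≤-respʳ (*-identityˡ 1#) (x*x≥0 1#)

  <⇒≱ : ∀ {x y} → x < y → ¬ y ≤ x
  <⇒≱ (x≤y , x≉y) y≤x = x≉y (antisym x≤y y≤x)

  ≰⇒> : ∀ {x y} → ¬ x ≤ y → y < x
  ≰⇒> {x} {y} x≰y with total x y
  ... | inj₁ x≤y = contradiction x≤y x≰y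
  ... | inj₂ y≤x = y≤x , λ y≈x → x≰y (≤-reflexive (≈.sym y≈x))

  <-≤-trans : ∀ {x y z} → x < y → y ≤ z → x < z
  <-≤-trans x<y@(x≤y , _) y≤z = ≤-trans x≤y y≤z , λ x≈z → <⇒≱ x<y (≤-respʳ (≈.sym x≈z) y≤z)

  ≤-<-trans : ∀ {x y z} → x ≤ y → y < z → x < z
  ≤-<-trans x≤y y<z@(y≤z , _) = ≤-trans x≤y y≤z , λ x≈z → <⇒≱ y<z (≤-respˡ x≈z x≤y)

  pos⇒≉0 : ∀ {x} → 0# < x → ¬ x ≈ 0#
  pos⇒≉0 (_ , 0≉x) x≈0 = 0≉x (≈.sym x≈0)

  +-pos : ∀ {x y} → 0# < x → 0# ≤ y → 0# < x + y
  +-pos {x} {y} 0<x 0≤y = <-≤-trans 0<x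
    (certify y 0≤y (solve 2 (λ x y → x :+ y :- x := y) ≈.refl x y))

  x*y≈0⇒y≈0 : ∀ {x y} → ¬ x ≈ 0# → x * y ≈ 0# → y ≈ 0#
  x*y≈0⇒y≈0 {x} {y} x≉0 xy≈0 = begin
    y                ≈⟨ *-identityˡ y ⟨
    1# * y           ≈⟨ *-congʳ (⁻¹-inverseʳ x x≉0) ⟨
    x * x ⁻¹ * y     ≈⟨ solve 3 (λ x i y → x :* i :* y := i :* (x :* y)) ≈.refl x (x ⁻¹) y ⟩
    x ⁻¹ * (x * y)   ≈⟨ *-congˡ xy≈0 ⟩
    x ⁻¹ * 0#        ≈⟨ zeroʳ _ ⟩
    0#               ∎

  *-pos : ∀ {x y} → 0# < x → 0# < y → 0# < x * y
  *-pos 0<x 0<y = *-nonNeg (proj₁ 0<x) (proj₁ 0<y) ,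
    λ 0≈xy → pos⇒≉0 0<y (x*y≈0⇒y≈0 (pos⇒≉0 0<x) (≈.sym 0≈xy))

  *-cancelˡ-≤ : ∀ {x y z} → 0# < z → z * x ≤ z * y → x ≤ y
  *-cancelˡ-≤ {x} {y} {z} 0<z zx≤zy with total x y
  ... | inj₁ x≤y = x≤y
  ... | inj₂ y≤x = ≤-reflexive (≈.sym (y≈x))
    where
    zx≈zy : z * (y - x) ≈ 0#
    zx≈zy = begin
      z * (y - x)     ≈⟨ solve 3 (λ x y z → z :* (y :- x) := z :* y :- z :* x) ≈.refl x y z ⟩
      z * y - z * x   ≈⟨ +-congʳ (antisym (*-monoˡ-≤ z (proj₁ 0<z) y≤x) zx≤zy) ⟩
      z * x - z * x   ≈⟨ -‿inverseʳ _ ⟩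
      0#              ∎
    y≈x : y ≈ x
    y≈x = begin
      y            ≈⟨ solve 2 (λ x y → y := y :- x :+ x) ≈.refl x y ⟩
      y - x + x    ≈⟨ +-congʳ (x*y≈0⇒y≈0 (pos⇒≉0 0<z) zx≈zy) ⟩
      0# + x       ≈⟨ +-identityˡ x ⟩
      x            ∎

  ⁻¹-pos : ∀ {x} → 0# < x → 0# < x ⁻¹
  ⁻¹-pos {x} 0<x = ≰⇒> λ x⁻¹≤0 → 0≉1 (antisym 0≤1
    (≤-respˡ (⁻¹-inverseʳ x (pos⇒≉0 0<x)) (≤-respʳ (zeroʳ x) (*-monoˡ-≤ x (proj₁ 0<x) x⁻¹≤0))))

  ι : ℕ → ℝ
  ι n = n · 1#

  ι-+ : ∀ m n → ι (m ℕ.+ n) ≈ ι m + ι n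
  ι-+ = Mult.×-homo-+ 1#

  ι-* : ∀ m n → ι (m ℕ.* n) ≈ ι m * ι n
  ι-* = SMult.×1-homo-*

  ι-nonNeg : ∀ n → 0# ≤ ι n
  ι-nonNeg zero    = ≤-refl
  ι-nonNeg (suc n) = +-nonNeg 0≤1 (ι-nonNeg n)

  ι-pos : ∀ n → 0# < ι (suc n)
  ι-pos n = +-pos (0≤1 , 0≉1) (ι-nonNeg n)

  ι-mono : ∀ {m n} → m ℕ.≤ n → ι m ≤ ι n
  ι-mono {m} {n} m≤n = ≤-respʳ
    (≈.trans (≈.sym (ι-+ m (n ℕ.∸ m))) (≈.reflexive (cong ι (ℕₚ.m+[n∸m]≡n m≤n))))
    (≤-respˡ (+-identityʳ _) (+-mono-≤ ≤-refl (ι-nonNeg (n ℕ.∸ m))))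

  module _ (em : ExcludedMiddle 0ℓ) where

    -- If x bounded every natural number, their supremum s would satisfy s ≤ s - 1.
    archimedean : ∀ x → ∃ λ n → x ≤ ι n
    archimedean x with em {∃ λ n → x ≤ ι n}
    ... | yes p = p
    ... | no ¬p = contradiction (antisym 0≤1 1≤0) 0≉1
      where
      Nat : Pred ℝ 0ℓ
      Nat y = ∃ λ n → y ≈ ι n
      sup = supremum Nat (0# , 0 , ≈.refl)
        (x , λ y (n , y≈n) → ≤-respˡ (≈.sym y≈n) (proj₁ (≰⇒> λ x≤n → ¬p (n , x≤n))))
      s = proj₁ sup
      s≤s-1 : s ≤ s - 1#
      s≤s-1 = proj₂ (proj₂ sup) (s - 1#) λ y (n , y≈n) → certify _
        (y-x≥0 (proj₁ (proj₂ sup) (ι (suc n)) (suc n , ≈.refl)))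
        (≈.trans (+-congˡ (-‿cong y≈n))
          (solve 2 (λ s n → s :- con (+ 1) :- n := s :- (con (+ 1) :+ n)) ≈.refl s (ι n)))
      1≤0 : 1# ≤ 0#
      1≤0 = certify _ (y-x≥0 s≤s-1) (solve 1 (λ s → con (+ 0) :- con (+ 1) := (s :- con (+ 1)) :- s) ≈.refl s)

-- Finite sets and linear algebra

module Finiteness (em : ExcludedMiddle 0ℓ) where

  enumerate : ∀ n (P : Fin n → Set) → ∃ λ m → Σ (Fin m → Fin n) λ e →
    (∀ i → P (e i)) × (∀ {i j} → e i ≡ e j → i ≡ j) × (∀ x → P x → ∃ λ i → e i ≡ x)
  enumerate zero P = 0 , (λ ()) , (λ ()) , (λ {}) , λ ()
  enumerate (suc n) P with enumerate n (P ∘ suc) | em {P zero}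
  ... | m , e , e∈P , inj , onto | no ¬P0 =
    m , suc ∘ e , e∈P , (λ eq → inj (Finₚ.suc-injective eq)) ,
    λ { zero P0 → contradiction P0 ¬P0
      ; (suc x) Px → let i , eq = onto x Px in i , cong suc eq }
  ... | m , e , e∈P , inj , onto | yes P0 = suc m , e⁺ , e⁺∈P , inj⁺ , onto⁺
    where
    e⁺ : Fin (suc m) → Fin (suc n)
    e⁺ zero    = zero
    e⁺ (suc i) = suc (e i)
    e⁺∈P : ∀ i → P (e⁺ i)
    e⁺∈P zero    = P0
    e⁺∈P (suc i) = e∈P i
    inj⁺ : ∀ {i j} → e⁺ i ≡ e⁺ j → i ≡ j
    inj⁺ {zero}  {zero}  _  = refl
    inj⁺ {suc i} {suc j} eq = cong suc (inj (Finₚ.suc-injective eq))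
    onto⁺ : ∀ x → P x → ∃ λ i → e⁺ i ≡ x
    onto⁺ zero    _  = zero , refl
    onto⁺ (suc x) Px = let i , eq = onto x Px in suc i , cong suc eq

  -- The cardinality is that of the image, which excluded middle enumerates. Nothing about `A` is
  -- decided beforehand, as `Avₙ B n` with an arbitrary `B` requires.
  ↣Fin⇒finite : ∀ {A : Set} {n} (f : A → Fin n) → (∀ {x y} → f x ≡ f y → x ≡ y) →
                ∃ (A HasCardinality_)
  ↣Fin⇒finite {A} {n} f f-inj with enumerate n (λ i → ∃ λ a → f a ≡ i)
  ... | m , e , e∈P , e-inj , onto = m , mk↔ₛ′ to from to∘from from∘to
    where
    to : Fin m → A
    to i = proj₁ (e∈P i)
    from : A → Fin m
    from a = proj₁ (onto (f a) (a , refl))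
    f-to : ∀ i → f (to i) ≡ e i
    f-to i = proj₂ (e∈P i)
    e-from : ∀ a → e (from a) ≡ f a
    e-from a = proj₂ (onto (f a) (a , refl))
    to∘from : ∀ a → to (from a) ≡ a
    to∘from a = f-inj (trans (f-to (from a)) (e-from a))
    from∘to : ∀ i → from (to i) ≡ i
    from∘to i = e-inj (trans (e-from (to i)) (f-to i))

  Vec→Fin : ∀ {m n} → Vec (Fin m) n → Fin (m ℕ.^ n)
  Vec→Fin []       = zero
  Vec→Fin (x ∷ xs) = Fin.combine x (Vec→Fin xs)

  Vec→Fin-injective : ∀ {m n} {xs ys : Vec (Fin m) n} → Vec→Fin xs ≡ Vec→Fin ys → xs ≡ ys
  Vec→Fin-injective {xs = []}     {[]}     _  = refl
  Vec→Fin-injective {xs = x ∷ xs} {y ∷ ys} eq =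
    let x≡y , xs≡ys = Finₚ.combine-injective x (Vec→Fin xs) y (Vec→Fin ys) eq
    in cong₂ _∷_ x≡y (Vec→Fin-injective xs≡ys)

  S-finite : ∀ n → ∃ (S n HasCardinality_)
  S-finite n = ↣Fin⇒finite (Vec→Fin ∘ value) (value-injective ∘ Vec→Fin-injective)

  Avₙ-finite : ∀ B n → ∃ (Avₙ B n HasCardinality_)
  Avₙ-finite B n = ↣Fin⇒finite (Vec→Fin ∘ value ∘ value)
    (λ eq → value-injective (value-injective (Vec→Fin-injective eq)))

  bounded-Fin : ∀ {n} (f : Fin n → ℕ) → ∃ λ N → ∀ i → f i ℕ.≤ N
  bounded-Fin {zero}  f = 0 , λ ()
  bounded-Fin {suc n} f =
    let N , f≤N = bounded-Fin (f ∘ suc)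
    in f zero ℕ.⊔ N , λ { zero → ℕₚ.m≤m⊔n _ _ ; (suc i) → ℕₚ.≤-trans (f≤N i) (ℕₚ.m≤n⊔m _ _) }

  bounded : ∀ {A : Set} → ∃ (A HasCardinality_) → (f : A → ℕ) → ∃ λ N → ∀ a → f a ℕ.≤ N
  bounded (_ , A↔) f =
    let N , f≤N = bounded-Fin (f ∘ Inverse.to A↔)
    in N , λ a → subst (λ b → f b ℕ.≤ N) (Inverse.strictlyInverseˡ A↔ a) (f≤N (Inverse.from A↔ a))

module LinearAlgebra (em : ExcludedMiddle 0ℓ) (ℝ-field : CompleteOrderedField) where
  open Reals ℝ-field
  open Relation.Binary.Reasoning.Setoid setoid

  ind : Set → ℝ
  ind P with em {P}
  ... | yes _ = 1#
  ... | no _  = 0#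

  ind-true : ∀ {P} → P → ind P ≈ 1#
  ind-true {P} p with em {P}
  ... | yes _ = ≈.refl
  ... | no ¬p = contradiction p ¬p

  ind-false : ∀ {P} → ¬ P → ind P ≈ 0#
  ind-false {P} ¬p with em {P}
  ... | yes p = contradiction p ¬p
  ... | no _  = ≈.refl

  ind-≥0 : ∀ P → 0# ≤ ind P
  ind-≥0 P with em {P}
  ... | yes _ = 0≤1
  ... | no _  = ≤-refl

  ind-≤1 : ∀ P → ind P ≤ 1#
  ind-≤1 P with em {P}
  ... | yes _ = ≤-refl
  ... | no _  = 0≤1

  ind-cong : ∀ {P Q} → P ⇔ Q → ind P ≈ ind Q
  ind-cong {P} {Q} P⇔Q with em {P}
  ... | yes p = ≈.sym (ind-true (Equivalence.to P⇔Q p))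
  ... | no ¬p = ≈.sym (ind-false (¬p ∘ Equivalence.from P⇔Q))

  sum-zero : ∀ {n} {f : Fin n → ℝ} → (∀ i → f i ≈ 0#) → sum f ≈ 0#
  sum-zero {n} f≈0 = ≈.trans (sum-cong-≋ f≈0) (sum-replicate-zero n)

  sum-neg : ∀ {n} (f : Fin n → ℝ) → sum (λ i → - f i) ≈ - sum f
  sum-neg {zero}  f = solve 0 (con (+ 0) := :- con (+ 0)) ≈.refl
  sum-neg {suc n} f = ≈.trans (+-congˡ (sum-neg (f ∘ suc)))
    (solve 2 (λ x y → :- x :+ :- y := :- (x :+ y)) ≈.refl _ _)

  sum-diff : ∀ {n} (f g : Fin n → ℝ) → sum (λ i → f i - g i) ≈ sum f - sum g
  sum-diff f g = ≈.trans (∑-distrib-+ f (-_ ∘ g)) (+-congˡ (sum-neg g))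

  sum-nonNeg : ∀ {n} {f : Fin n → ℝ} → (∀ i → 0# ≤ f i) → 0# ≤ sum f
  sum-nonNeg {zero}  f≥0 = ≤-refl
  sum-nonNeg {suc n} f≥0 = +-nonNeg (f≥0 zero) (sum-nonNeg (f≥0 ∘ suc))

  term≤sum : ∀ {n} {f : Fin n → ℝ} → (∀ i → 0# ≤ f i) → ∀ i → f i ≤ sum f
  term≤sum f≥0 zero    = ≤-respˡ (+-identityʳ _) (+-mono-≤ ≤-refl (sum-nonNeg (f≥0 ∘ suc)))
  term≤sum f≥0 (suc i) = ≤-respˡ (+-identityˡ _) (+-mono-≤ (f≥0 zero) (term≤sum (f≥0 ∘ suc) i))

  sum-++ : ∀ m {n} (f : Fin (m ℕ.+ n) → ℝ) → sum f ≈ sum (λ i → f (i ↑ˡ n)) + sum (λ j → f (m ↑ʳ j))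
  sum-++ zero    f = ≈.sym (+-identityˡ _)
  sum-++ (suc m) f = ≈.trans (+-congˡ (sum-++ m (f ∘ suc))) (≈.sym (+-assoc _ _ _))

  sum-ind : ∀ {n} (j : Fin n) (f : Fin n → ℝ) → sum (λ i → ind (j ≡ i) * f i) ≈ f j
  sum-ind zero f = begin
    ind (zero ≡ zero) * f zero + sum (λ i → ind (zero ≡ suc i) * f (suc i))
      ≈⟨ +-cong (*-congʳ (ind-true refl)) (sum-zero {f = λ i → ind (zero ≡ Fin.suc i) * f (suc i)} λ i →
           ≈.trans (*-congʳ (ind-false λ ())) (zeroˡ _)) ⟩
    1# * f zero + 0#
      ≈⟨ solve 1 (λ x → con (+ 1) :* x :+ con (+ 0) := x) ≈.refl (f zero) ⟩
    f zero ∎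
  sum-ind (suc j) f = begin
    ind (suc j ≡ zero) * f zero + sum (λ i → ind (suc j ≡ suc i) * f (suc i))
      ≈⟨ +-cong (≈.trans (*-congʳ (ind-false λ ())) (zeroˡ _))
           (sum-cong-≋ {x = λ i → ind (suc j ≡ suc i) * f (suc i)} λ i → *-congʳ (ind-cong (mk⇔ Finₚ.suc-injective (cong suc)))) ⟩
    0# + sum (λ i → ind (j ≡ i) * f (suc i))
      ≈⟨ ≈.trans (+-identityˡ _) (sum-ind j (f ∘ suc)) ⟩
    f (suc j) ∎

  -- Eliminate a coordinate at which the first vector does not vanish.
  dependent : ∀ n (b : Fin (suc n) → Fin n → ℝ) →
              ∃ λ c → (∃ λ i → ¬ c i ≈ 0#) × (∀ a → lin c b a ≈ 0#)
  dependent zero b = (λ _ → 1#) , (zero , 0≉1 ∘ ≈.sym) , λ ()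
  dependent (suc n) b with em {∃ λ j → ¬ b zero j ≈ 0#}
  ... | no b₀≈0 = c , (zero , 0≉1 ∘ ≈.sym) , λ a → begin
    1# * b zero a + sum (λ i → 0# * b (suc i) a)
      ≈⟨ +-cong (≈.trans (*-identityˡ _) (zero? a)) (sum-zero {f = λ i → 0# * b (suc i) a} λ i → zeroˡ _) ⟩
    0# + 0#  ≈⟨ +-identityˡ 0# ⟩
    0#       ∎
    where
    c : Fin (suc (suc n)) → ℝ
    c zero    = 1#
    c (suc _) = 0#
    zero? : ∀ a → b zero a ≈ 0#
    zero? a with em {b zero a ≈ 0#}
    ... | yes p = p
    ... | no ¬p = contradiction (a , ¬p) b₀≈0
  ... | yes (j , β≉0) = c , nontrivial , vanish
    where
    β = b zero j
    γ : Fin (suc n) → ℝ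
    γ i = b (suc i) j * β ⁻¹
    reduced : Fin (suc n) → Fin (suc n) → ℝ
    reduced i a = b (suc i) a - γ i * b zero a
    ih = dependent n (λ i a → reduced i (punchIn j a))
    c′ = proj₁ ih
    c : Fin (suc (suc n)) → ℝ
    c zero    = - sum (λ i → c′ i * γ i)
    c (suc i) = c′ i
    nontrivial : ∃ λ i → ¬ c i ≈ 0#
    nontrivial = let i , p = proj₁ (proj₂ ih) in suc i , p
    lin-reduced : ∀ a → lin c b a ≈ sum (λ i → c′ i * reduced i a)
    lin-reduced a = begin
      - sum (λ i → c′ i * γ i) * b zero a + sum (λ i → c′ i * b (suc i) a)
        ≈⟨ solve 3 (λ s x t → :- s :* x :+ t := t :- s :* x) ≈.refl _ _ _ ⟩
      sum (λ i → c′ i * b (suc i) a) - sum (λ i → c′ i * γ i) * b zero a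
        ≈⟨ +-congˡ (-‿cong (*-distribʳ-sum (b zero a) (λ i → c′ i * γ i))) ⟩
      sum (λ i → c′ i * b (suc i) a) - sum (λ i → c′ i * γ i * b zero a)
        ≈⟨ sum-diff (λ i → c′ i * b (suc i) a) (λ i → c′ i * γ i * b zero a) ⟨
      sum (λ i → c′ i * b (suc i) a - c′ i * γ i * b zero a)
        ≈⟨ sum-cong-≋ (λ i → solve 4 (λ c x g y → c :* x :- c :* g :* y := c :* (x :- g :* y)) ≈.refl
             (c′ i) (b (suc i) a) (γ i) (b zero a)) ⟩
      sum (λ i → c′ i * reduced i a) ∎
    reduced-j : ∀ i → reduced i j ≈ 0#
    reduced-j i = begin
      b (suc i) j - b (suc i) j * β ⁻¹ * β
        ≈⟨ solve 3 (λ x y z → x :- x :* y :* z := x :* (con (+ 1) :- z :* y)) ≈.refl (b (suc i) j) (β ⁻¹) β ⟩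
      b (suc i) j * (1# - β * β ⁻¹)
        ≈⟨ *-congˡ (≈.trans (+-congˡ (-‿cong (⁻¹-inverseʳ β β≉0))) (-‿inverseʳ 1#)) ⟩
      b (suc i) j * 0#
        ≈⟨ zeroʳ _ ⟩
      0# ∎
    vanish : ∀ a → lin c b a ≈ 0#
    vanish a with j Finₚ.≟ a
    ... | yes refl = ≈.trans (lin-reduced j)
            (sum-zero {f = λ i → c′ i * reduced i j} λ i → ≈.trans (*-congˡ (reduced-j i)) (zeroʳ _))
    ... | no j≢a = ≈.trans (lin-reduced a) (subst (λ x → sum (λ i → c′ i * reduced i x) ≈ 0#)
            (Finₚ.punchIn-punchOut j≢a) (proj₂ (proj₂ ih) (punchOut j≢a)))

  independent⇒≤ : ∀ {m n} (b : Fin n → ℝ^ Fin m) → LinearlyIndependent b → n ℕ.≤ m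
  independent⇒≤ {m} {n} b ind-b = ℕₚ.≮⇒≥ λ m<n → go (ℕₚ.m≤n⇒∃[o]m+o≡n m<n) b ind-b
    where
    go : ∀ {n} → (∃ λ d → suc m ℕ.+ d ≡ n) → (b : Fin n → ℝ^ Fin m) → ¬ LinearlyIndependent b
    go (d , refl) b ind-b =
      -- `dependent` expects exactly one vector more than there are coordinates, so `d` zero
      -- coordinates are appended.
      let padded = λ i a → [ b i , (λ _ → 0#) ]′ (splitAt m a)
          c , (i , cᵢ≉0) , lin≈0 = dependent (m ℕ.+ d) padded
      in cᵢ≉0 (ind-b c (λ a → ≈.trans
           (sum-cong-≋ {x = λ i → c i * b i a} {λ i → c i * padded i (a ↑ˡ d)} λ i →
              *-congˡ (≈.reflexive (sym (cong [ b i , (λ _ → 0#) ]′ (Finₚ.splitAt-↑ˡ m a d)))))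
           (lin≈0 (a ↑ˡ d))) i)

  -- If Σ c b + Σ d f = 0 then F = Σ d f is orthogonal to itself.
  orthogonal⇒≤ : ∀ {d l m} (b : Fin d → ℝ^ Fin m) (f : Fin l → ℝ^ Fin m) →
    LinearlyIndependent b → LinearlyIndependent f →
    (∀ i j → sum (λ a → b i a * f j a) ≈ 0#) → d ℕ.+ l ℕ.≤ m
  orthogonal⇒≤ {d} {l} {m} b f ind-b ind-f b⊥f = independent⇒≤ both ind-both
    where
    both : Fin (d ℕ.+ l) → ℝ^ Fin m
    both i = [ b , f ]′ (splitAt d i)
    ind-both : LinearlyIndependent both
    ind-both c lin≈0 i = subst (λ j → c j ≈ 0#) (Finₚ.join-splitAt d l i) (split (splitAt d i))
      where
      cb = λ i → c (i ↑ˡ l)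
      cf = λ j → c (d ↑ʳ j)
      B = lin cb b
      F = lin cf f
      B+F : ∀ a → B a + F a ≈ 0#
      B+F a = begin
        B a + F a ≈⟨ +-cong
            (sum-cong-≋ λ i → *-congˡ (≈.reflexive (cong (λ s → [ b , f ]′ s a) (Finₚ.splitAt-↑ˡ d i l))))
            (sum-cong-≋ λ j → *-congˡ (≈.reflexive (cong (λ s → [ b , f ]′ s a) (Finₚ.splitAt-↑ʳ d l j)))) ⟨
        sum (λ i → c (i ↑ˡ l) * both (i ↑ˡ l) a) + sum (λ j → c (d ↑ʳ j) * both (d ↑ʳ j) a)
          ≈⟨ sum-++ d (λ i → c i * both i a) ⟨
        lin c both a ≈⟨ lin≈0 a ⟩
        0# ∎
      b⊥F : ∀ i → sum (λ a → b i a * F a) ≈ 0#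
      b⊥F i = begin
        sum (λ a → b i a * F a)
          ≈⟨ sum-cong-≋ (λ a → *-distribˡ-sum (b i a) (λ j → cf j * f j a)) ⟩
        sum (λ a → sum (λ j → b i a * (cf j * f j a)))
          ≈⟨ ∑-comm (λ a j → b i a * (cf j * f j a)) ⟩
        sum (λ j → sum (λ a → b i a * (cf j * f j a)))
          ≈⟨ sum-zero (λ j → begin
               sum (λ a → b i a * (cf j * f j a))
                 ≈⟨ sum-cong-≋ (λ a → solve 3 (λ x y z → x :* (y :* z) := y :* (x :* z)) ≈.refl (b i a) (cf j) (f j a)) ⟩
               sum (λ a → cf j * (b i a * f j a))
                 ≈⟨ *-distribˡ-sum (cf j) (λ a → b i a * f j a) ⟨
               cf j * sum (λ a → b i a * f j a)
                 ≈⟨ *-congˡ (b⊥f i j) ⟩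
               cf j * 0# ≈⟨ zeroʳ _ ⟩
               0# ∎) ⟩
        0# ∎
      B⊥F : sum (λ a → B a * F a) ≈ 0#
      B⊥F = begin
        sum (λ a → B a * F a)
          ≈⟨ sum-cong-≋ (λ a → *-distribʳ-sum (F a) (λ i → cb i * b i a)) ⟩
        sum (λ a → sum (λ i → cb i * b i a * F a))
          ≈⟨ ∑-comm (λ a i → cb i * b i a * F a) ⟩
        sum (λ i → sum (λ a → cb i * b i a * F a))
          ≈⟨ sum-zero (λ i → begin
               sum (λ a → cb i * b i a * F a)
                 ≈⟨ sum-cong-≋ (λ a → *-assoc (cb i) (b i a) (F a)) ⟩
               sum (λ a → cb i * (b i a * F a))
                 ≈⟨ *-distribˡ-sum (cb i) (λ a → b i a * F a) ⟨
               cb i * sum (λ a → b i a * F a)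
                 ≈⟨ *-congˡ (b⊥F i) ⟩
               cb i * 0# ≈⟨ zeroʳ _ ⟩
               0# ∎) ⟩
        0# ∎
      F⊥F : sum (λ a → F a * F a) ≈ 0#
      F⊥F = begin
        sum (λ a → F a * F a)
          ≈⟨ sum-cong-≋ (λ a → solve 2 (λ x y → y :* y := (x :+ y) :* y :- x :* y) ≈.refl (B a) (F a)) ⟩
        sum (λ a → (B a + F a) * F a - B a * F a)
          ≈⟨ sum-diff (λ a → (B a + F a) * F a) (λ a → B a * F a) ⟩
        sum (λ a → (B a + F a) * F a) - sum (λ a → B a * F a)
          ≈⟨ +-cong (sum-zero λ a → ≈.trans (*-congʳ (B+F a)) (zeroˡ _)) (-‿cong B⊥F) ⟩
        0# - 0# ≈⟨ -‿inverseʳ 0# ⟩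
        0# ∎
      F≈0 : ∀ a → F a ≈ 0#
      F≈0 a with em {F a ≈ 0#}
      ... | yes p = p
      ... | no ¬p = x*y≈0⇒y≈0 ¬p (antisym
              (≤-respʳ F⊥F (term≤sum (λ a → x*x≥0 (F a)) a)) (x*x≥0 (F a)))
      B≈0 : ∀ a → B a ≈ 0#
      B≈0 a = ≈.trans (≈.sym (+-identityʳ _)) (≈.trans (+-congˡ (≈.sym (F≈0 a))) (B+F a))
      split : ∀ s → c (Fin.join d l s) ≈ 0#
      split (inj₁ i) = ind-b cb B≈0 i
      split (inj₂ j) = ind-f cf F≈0 j

-- Consecutive occurrences

⇔-trans : ∀ {P Q R : Set} → P ⇔ Q → Q ⇔ R → P ⇔ R
⇔-trans f g = mk⇔ (Equivalence.to g ∘ Equivalence.to f) (Equivalence.from f ∘ Equivalence.from g)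

⇔-sym : ∀ {P Q : Set} → P ⇔ Q → Q ⇔ P
⇔-sym f = mk⇔ (Equivalence.from f) (Equivalence.to f)

≡⇒⇔ : ∀ {P Q : Set} → P ≡ Q → P ⇔ Q
≡⇒⇔ refl = mk⇔ id id

-- The distinctness proof stored in `σ` is irrelevant; decidable equality on `Fin n` turns what it
-- yields into a usable equation.
⟨⟩-injective : ∀ {n} (σ : S n) {i j} → σ ⟨ i ⟩ ≡ σ ⟨ j ⟩ → i ≡ j
⟨⟩-injective (w , [ u ]) {i} {j} eq = recompute (i Finₚ.≟ j) (lookup-injective u i j eq)

-- Pigeonhole: were `v` missed, punching it out would inject the positions into one value fewer.
⟨⟩-surjective : ∀ {n} (σ : S n) v → ∃ λ i → σ ⟨ i ⟩ ≡ v
⟨⟩-surjective {suc n} σ v with Finₚ.any? (λ i → σ ⟨ i ⟩ Finₚ.≟ v)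
... | yes p = p
... | no ¬p = contradiction
    (Finₚ.injective⇒≤ {f = λ i → punchOut (v≢ i)}
      (λ {i} {j} eq → ⟨⟩-injective σ (Finₚ.punchOut-injective (v≢ i) (v≢ j) eq)))
    ℕₚ.1+n≰n
  where
  v≢ : ∀ i → v ≢ σ ⟨ i ⟩
  v≢ i eq = ¬p (i , sym eq)

SameOrder : ∀ {l m n} → (Fin l → Fin m) → (Fin l → Fin n) → Set
SameOrder x y = ∀ i j → x i Fin.< x j ⇔ y i Fin.< y j

-- Induction on the value: the entry of `ρ` just below the one at `i` is also below it in `π`, and
-- its value in `π` is already at least `v` by induction.
order⇒≤ : ∀ {n} (ρ π : S n) → SameOrder (ρ ⟨_⟩) (π ⟨_⟩) →
          ∀ v i → toℕ (ρ ⟨ i ⟩) ≡ v → v ℕ.≤ toℕ (π ⟨ i ⟩)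
order⇒≤ ρ π same zero i eq = ℕ.z≤n
order⇒≤ {n} ρ π same (suc v) i eq =
  let v<n = ℕₚ.<-trans (subst (v ℕ.<_) (sym eq) ℕₚ.≤-refl) (Finₚ.toℕ<n (ρ ⟨ i ⟩))
      j , ρj≡v = ⟨⟩-surjective ρ (fromℕ< v<n)
      ρj≡v′ = trans (cong toℕ ρj≡v) (Finₚ.toℕ-fromℕ< v<n)
  in ℕₚ.≤-<-trans (order⇒≤ ρ π same v j ρj≡v′)
       (Equivalence.to (same j i) (subst₂ ℕ._<_ (sym ρj≡v′) (sym eq) ℕₚ.≤-refl))

-- The uniqueness half of standardisation. It allows patterns to be compared through relative order
-- alone, without unfolding ranks.
order-determines : ∀ {n} (ρ π : S n) → SameOrder (ρ ⟨_⟩) (π ⟨_⟩) → ρ ≡ π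
order-determines ρ π same = value-injective
  (trans (sym (Vecₚ.tabulate∘lookup (value ρ)))
    (trans (Vecₚ.tabulate-cong (λ i → Finₚ.toℕ-injective (ℕₚ.≤-antisym
      (order⇒≤ ρ π same _ i refl)
      (order⇒≤ π ρ (λ i j → ⇔-sym (same i j)) _ i refl))))
    (Vecₚ.tabulate∘lookup (value π))))

pat-spec : ∀ {m n} (I : Positions m n) (σ : S n) →
           SameOrder (pat I σ ⟨_⟩) (λ i → σ ⟨ at I i ⟩)
pat-spec I (w , [ u ]) i j = std-spec (λ i → lookup w (at I i)) (restrict-injective I u) i j

pat-cong : ∀ {l m n} (I : Positions l m) (J : Positions l n) (σ : S m) (τ : S n) →
           SameOrder (λ i → σ ⟨ at I i ⟩) (λ i → τ ⟨ at J i ⟩) → pat I σ ≡ pat J τ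
pat-cong I J σ τ same = order-determines _ _ λ i j →
  ⇔-trans (pat-spec I σ i j) (⇔-trans (same i j) (⇔-sym (pat-spec J τ i j)))

pat-cong⁻ : ∀ {l m n} (I : Positions l m) (J : Positions l n) (σ : S m) (τ : S n) →
            pat I σ ≡ pat J τ → SameOrder (λ i → σ ⟨ at I i ⟩) (λ i → τ ⟨ at J i ⟩)
pat-cong⁻ I J σ τ eq i j = ⇔-trans (⇔-sym (pat-spec I σ i j))
  (subst (λ ρ → ρ ⟨ i ⟩ Fin.< ρ ⟨ j ⟩ ⇔ τ ⟨ at J i ⟩ Fin.< τ ⟨ at J j ⟩) (sym eq) (pat-spec J τ i j))

pat-ext : ∀ {m n} (I J : Positions m n) (σ : S n) → (∀ i → at I i ≡ at J i) → pat I σ ≡ pat J σ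
pat-ext I J σ eq = pat-cong I J σ σ
  λ i j → ≡⇒⇔ (cong₂ (λ a b → σ ⟨ a ⟩ Fin.< σ ⟨ b ⟩) (eq i) (eq j))

-- window with its start a natural number, so that starts can be shifted freely
win : ∀ {k n} i → i ℕ.+ k ℕ.≤ n → Positions k n
win {k} {n} i i+k≤n = record
  { at = λ j → fromℕ< (bound j)
  ; increasing = λ {j} {j′} j<j′ → subst₂ ℕ._<_
      (sym (Finₚ.toℕ-fromℕ< (bound j))) (sym (Finₚ.toℕ-fromℕ< (bound j′)))
      (ℕₚ.+-monoʳ-< i j<j′)
  }
  where
  bound : (j : Fin k) → i ℕ.+ toℕ j ℕ.< n
  bound j = ℕₚ.<-≤-trans (ℕₚ.+-monoʳ-< i (Finₚ.toℕ<n j)) i+k≤n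

toℕ-at-win : ∀ {k n} i (h : i ℕ.+ k ℕ.≤ n) j → toℕ (at (win i h) j) ≡ i ℕ.+ toℕ j
toℕ-at-win i h j = Finₚ.toℕ-fromℕ< _

toℕ-at-window : ∀ {k n} (i : Fin (suc n ℕ.∸ k)) j → toℕ (at (window {k} {n} i) j) ≡ toℕ i ℕ.+ toℕ j
toℕ-at-window i j = Finₚ.toℕ-fromℕ< _

-- The bound is part of the proposition, so a start that overshoots is a non-occurrence and counts
-- may run over any range of naturals.
Occ : ∀ {k n} → S k → S n → ℕ → Set
Occ {k} {n} π σ i = Σ (i ℕ.+ k ℕ.≤ n) λ h → pat (win i h) σ ≡ π

Occ-transfer : ∀ {k m n} (π : S k) (σ : S m) (τ : S n) i j (h : i ℕ.+ k ℕ.≤ m) (h′ : j ℕ.+ k ℕ.≤ n) →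
               SameOrder (λ a → σ ⟨ at (win i h) a ⟩) (λ a → τ ⟨ at (win j h′) a ⟩) →
               Occ π σ i ⇔ Occ π τ j
Occ-transfer π σ τ i j h h′ same = mk⇔
  (λ (g , eq) → h′ , trans (sym p) (trans (pat-ext (win i h) (win i g) σ (λ a → Finₚ.toℕ-injective
     (trans (toℕ-at-win i h a) (sym (toℕ-at-win i g a))))) eq))
  (λ (g , eq) → h , trans p (trans (pat-ext (win j h′) (win j g) τ (λ a → Finₚ.toℕ-injective
     (trans (toℕ-at-win j h′ a) (sym (toℕ-at-win j g a))))) eq))
  where
  p = pat-cong (win i h) (win j h′) σ τ same

-- What `⊕` and `⊖` have in common: each block keeps its internal order. How the two blocks compare
-- with each other enters only in `⊕-closed` and `⊖-closed`.
record BlockSum (_∙_ : ∀ {m n} → S m → S n → S (m ℕ.+ n)) : Set where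
  field
    left  : ∀ {m n} (σ : S m) (τ : S n) → SameOrder (λ i → (σ ∙ τ) ⟨ i ↑ˡ n ⟩) (σ ⟨_⟩)
    right : ∀ {m n} (σ : S m) (τ : S n) → SameOrder (λ j → (σ ∙ τ) ⟨ m ↑ʳ j ⟩) (τ ⟨_⟩)

shift⇒SameOrder : ∀ {l m n} (x : Fin l → Fin m) (y : Fin l → Fin n) c →
                  (∀ i → toℕ (x i) ≡ c ℕ.+ toℕ (y i)) → SameOrder x y
shift⇒SameOrder x y c eq i j = mk⇔
  (λ lt → ℕₚ.+-cancelˡ-< c _ _ (subst₂ ℕ._<_ (eq i) (eq j) lt))
  (λ lt → subst₂ ℕ._<_ (sym (eq i)) (sym (eq j)) (ℕₚ.+-monoʳ-< c lt))

module _ {m n} (σ : S m) (τ : S n) where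

  ⊕-↑ˡ : ∀ i → toℕ ((σ ⊕ τ) ⟨ i ↑ˡ n ⟩) ≡ toℕ (σ ⟨ i ⟩)
  ⊕-↑ˡ i = trans (cong toℕ (trans (Vecₚ.lookup-++ˡ (Vec.map (_↑ˡ n) (value σ)) _ i)
                               (Vecₚ.lookup-map i (_↑ˡ n) (value σ))))
    (Finₚ.toℕ-↑ˡ _ n)

  ⊕-↑ʳ : ∀ j → toℕ ((σ ⊕ τ) ⟨ m ↑ʳ j ⟩) ≡ m ℕ.+ toℕ (τ ⟨ j ⟩)
  ⊕-↑ʳ j = trans (cong toℕ (trans (Vecₚ.lookup-++ʳ (Vec.map (_↑ˡ n) (value σ)) _ j)
                               (Vecₚ.lookup-map j (m ↑ʳ_) (value τ))))
    (Finₚ.toℕ-↑ʳ m _)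

  ⊖-↑ˡ : ∀ i → toℕ ((σ ⊖ τ) ⟨ i ↑ˡ n ⟩) ≡ n ℕ.+ toℕ (σ ⟨ i ⟩)
  ⊖-↑ˡ i = trans (cong toℕ (trans (Vecₚ.lookup-++ˡ (Vec.map (Fin.cast (ℕₚ.+-comm n m) ∘ (n ↑ʳ_)) (value σ)) _ i)
                               (Vecₚ.lookup-map i (Fin.cast (ℕₚ.+-comm n m) ∘ (n ↑ʳ_)) (value σ))))
    (trans (Finₚ.toℕ-cast (ℕₚ.+-comm n m) _) (Finₚ.toℕ-↑ʳ n _))

  ⊖-↑ʳ : ∀ j → toℕ ((σ ⊖ τ) ⟨ m ↑ʳ j ⟩) ≡ toℕ (τ ⟨ j ⟩)
  ⊖-↑ʳ j = trans (cong toℕ (trans (Vecₚ.lookup-++ʳ (Vec.map (Fin.cast (ℕₚ.+-comm n m) ∘ (n ↑ʳ_)) (value σ)) _ j)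
                               (Vecₚ.lookup-map j (Fin.cast (ℕₚ.+-comm n m) ∘ (_↑ˡ m)) (value τ))))
    (trans (Finₚ.toℕ-cast (ℕₚ.+-comm n m) _) (Finₚ.toℕ-↑ˡ _ m))

⊕-blockSum : BlockSum _⊕_
⊕-blockSum = record
  { left  = λ σ τ → shift⇒SameOrder _ _ 0 (⊕-↑ˡ σ τ)
  ; right = λ {m} σ τ → shift⇒SameOrder _ _ m (⊕-↑ʳ σ τ)
  }

⊖-blockSum : BlockSum _⊖_
⊖-blockSum = record
  { left  = λ {n = n} σ τ → shift⇒SameOrder _ _ n (⊖-↑ˡ σ τ)
  ; right = λ σ τ → shift⇒SameOrder _ _ 0 (⊖-↑ʳ σ τ)
  }

SameOrder-∘ : ∀ {l m n p} {x : Fin m → Fin n} {y : Fin m → Fin p} → SameOrder x y →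
              (f : Fin l → Fin m) → SameOrder (x ∘ f) (y ∘ f)
SameOrder-∘ same f i j = same (f i) (f j)

SameOrder-reindex : ∀ {l m n p} (x : Fin m → Fin n) {y : Fin l → Fin p} {f g : Fin l → Fin m} →
                    (∀ i → f i ≡ g i) → SameOrder (x ∘ g) y → SameOrder (x ∘ f) y
SameOrder-reindex x f≡g same i j =
  ⇔-trans (≡⇒⇔ (cong₂ (λ a b → x a Fin.< x b) (f≡g i) (f≡g j))) (same i j)

module _ {_∙_ : ∀ {m n} → S m → S n → S (m ℕ.+ n)} (blockSum : BlockSum _∙_)
         {k m n} (π : S k) (σ : S m) (τ : S n) where
  open BlockSum blockSum

  Occ-left : ∀ i → i ℕ.+ k ℕ.≤ m → Occ π (σ ∙ τ) i ⇔ Occ π σ i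
  Occ-left i h = Occ-transfer π (σ ∙ τ) σ i i h′ h
    (SameOrder-reindex ((σ ∙ τ) ⟨_⟩) (λ a → Finₚ.toℕ-injective
       (trans (toℕ-at-win i h′ a) (sym (trans (Finₚ.toℕ-↑ˡ _ n) (toℕ-at-win i h a)))))
      (SameOrder-∘ (left σ τ) (at (win i h))))
    where
    h′ : i ℕ.+ k ℕ.≤ m ℕ.+ n
    h′ = ℕₚ.≤-trans h (ℕₚ.m≤m+n m n)

  Occ-right : ∀ i → Occ π (σ ∙ τ) (m ℕ.+ i) ⇔ Occ π τ i
  Occ-right i = mk⇔ (λ occ → Equivalence.to (transfer (unshift (proj₁ occ))) occ)
                    (λ occ → Equivalence.from (transfer (proj₁ occ)) occ)
    where
    unshift : m ℕ.+ i ℕ.+ k ℕ.≤ m ℕ.+ n → i ℕ.+ k ℕ.≤ n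
    unshift h = ℕₚ.+-cancelˡ-≤ m _ _ (subst (ℕ._≤ m ℕ.+ n) (ℕₚ.+-assoc m i k) h)
    transfer : i ℕ.+ k ℕ.≤ n → Occ π (σ ∙ τ) (m ℕ.+ i) ⇔ Occ π τ i
    transfer h = Occ-transfer π (σ ∙ τ) τ (m ℕ.+ i) i h′ h
      (SameOrder-reindex ((σ ∙ τ) ⟨_⟩) (λ a → Finₚ.toℕ-injective (trans (toℕ-at-win (m ℕ.+ i) h′ a)
         (trans (ℕₚ.+-assoc m i _) (sym (trans (Finₚ.toℕ-↑ʳ m _) (cong (m ℕ.+_) (toℕ-at-win i h a)))))))
        (SameOrder-∘ (right σ τ) (at (win i h))))
      where
      h′ : m ℕ.+ i ℕ.+ k ℕ.≤ m ℕ.+ n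
      h′ = subst (ℕ._≤ m ℕ.+ n) (sym (ℕₚ.+-assoc m i k)) (ℕₚ.+-monoʳ-≤ m h)

punchIn-SameOrder : ∀ {n} (c : Fin (suc n)) → SameOrder (punchIn c) id
punchIn-SameOrder c i j = mk⇔
  (λ lt → ℕₚ.≰⇒> λ j≤i → ℕₚ.<⇒≱ lt (Finₚ.punchIn-mono-≤ c j i j≤i))
  (λ lt → ℕₚ.≰⇒> λ j≤i → ℕₚ.<⇒≱ lt (Finₚ.punchIn-cancel-≤ c j i j≤i))

<-punchIn : ∀ {n} (c : Fin (suc n)) j → c Fin.< punchIn c j ⇔ toℕ c ℕ.≤ toℕ j
<-punchIn zero    j       = mk⇔ (λ _ → ℕ.z≤n) (λ _ → ℕ.s≤s ℕ.z≤n)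
<-punchIn (suc c) zero    = mk⇔ (λ ()) (λ ())
<-punchIn (suc c) (suc j) =
  let rec = <-punchIn c j in mk⇔ (λ { (ℕ.s≤s lt) → ℕ.s≤s (Equivalence.to rec lt) })
                                 (λ { (ℕ.s≤s le) → ℕ.s≤s (Equivalence.from rec le) })

prepend : ∀ {n} → Fin (suc n) → S n → S (suc n)
prepend c (w , [ u ]) = c ∷ Vec.map (punchIn c) w ,
  [ VAllₚ.map⁺ (VAll.universal (λ j eq → Finₚ.punchInᵢ≢i c j (sym eq)) w)
    VAllPairs.∷ map⁺ (Finₚ.punchIn-injective c _ _) u ]

prepend-suc : ∀ {n} c (σ : S n) i → prepend c σ ⟨ suc i ⟩ ≡ punchIn c (σ ⟨ i ⟩)
prepend-suc c σ i = Vecₚ.lookup-map i (punchIn c) (value σ)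

prepend-SameOrder : ∀ {n} c (σ : S n) → SameOrder (λ i → prepend c σ ⟨ suc i ⟩) (σ ⟨_⟩)
prepend-SameOrder c σ i j =
  ⇔-trans (≡⇒⇔ (cong₂ Fin._<_ (prepend-suc c σ i) (prepend-suc c σ j)))
    (punchIn-SameOrder c (σ ⟨ i ⟩) (σ ⟨ j ⟩))

Occ-prepend : ∀ {k n} c (π : S k) (σ : S n) i → Occ π (prepend c σ) (suc i) ⇔ Occ π σ i
Occ-prepend c π σ i = mk⇔
  (λ occ → Equivalence.to (transfer (ℕ.s≤s⁻¹ (proj₁ occ))) occ)
  (λ occ → Equivalence.from (transfer (proj₁ occ)) occ)
  where
  transfer : _ → Occ π (prepend c σ) (suc i) ⇔ Occ π σ i
  transfer h = Occ-transfer π (prepend c σ) σ (suc i) i (ℕ.s≤s h) h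
    (SameOrder-reindex (prepend c σ ⟨_⟩) (λ a → Finₚ.toℕ-injective
       (trans (toℕ-at-win (suc i) (ℕ.s≤s h) a) (sym (cong suc (toℕ-at-win i h a)))))
      (SameOrder-∘ (prepend-SameOrder c σ) (at (win i h))))

-- Counting occurrences across a block boundary

module Counting (em : ExcludedMiddle 0ℓ) where

  bit : ∀ {P : Set} → Dec P → ℕ
  bit (yes _) = 1
  bit (no _)  = 0

  -- Counting over an initial segment of the naturals: ranges split and shift here without casts
  -- between different `Fin` types, which is why `c-occ` is translated into this form.
  # : (ℕ → Set) → ℕ → ℕ
  # P zero    = 0
  # P (suc n) = bit (em {P 0}) ℕ.+ # (P ∘ suc) n

  bit-mono : ∀ {P Q : Set} (p? : Dec P) (q? : Dec Q) → (P → Q) → bit p? ℕ.≤ bit q?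
  bit-mono (no _)  _       f = ℕ.z≤n
  bit-mono (yes p) (yes _) f = ℕₚ.≤-refl
  bit-mono (yes p) (no ¬q) f = contradiction (f p) ¬q

  bit≤1 : ∀ {P : Set} (p? : Dec P) → bit p? ℕ.≤ 1
  bit≤1 (yes _) = ℕₚ.≤-refl
  bit≤1 (no _)  = ℕ.z≤n

  bit-cong : ∀ {P Q : Set} (p? : Dec P) (q? : Dec Q) → P ⇔ Q → bit p? ≡ bit q?
  bit-cong p? q? P⇔Q = ℕₚ.≤-antisym (bit-mono p? q? (Equivalence.to P⇔Q)) (bit-mono q? p? (Equivalence.from P⇔Q))

  #-mono : ∀ {P Q} n → (∀ i → i ℕ.< n → P i → Q i) → # P n ℕ.≤ # Q n
  #-mono zero    P⇒Q = ℕ.z≤n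
  #-mono (suc n) P⇒Q = ℕₚ.+-mono-≤ (bit-mono em em (P⇒Q 0 ℕₚ.0<1+n))
    (#-mono n λ i i<n → P⇒Q (suc i) (ℕ.s≤s i<n))

  #-cong : ∀ {P Q} n → (∀ i → i ℕ.< n → P i ⇔ Q i) → # P n ≡ # Q n
  #-cong n P⇔Q = ℕₚ.≤-antisym (#-mono n λ i i<n → Equivalence.to (P⇔Q i i<n))
                              (#-mono n λ i i<n → Equivalence.from (P⇔Q i i<n))

  #≤ : ∀ P n → # P n ℕ.≤ n
  #≤ P zero    = ℕ.z≤n
  #≤ P (suc n) = ℕₚ.+-mono-≤ (bit≤1 em) (#≤ (P ∘ suc) n)

  #-+ : ∀ P m n → # P (m ℕ.+ n) ≡ # P m ℕ.+ # (λ i → P (m ℕ.+ i)) n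
  #-+ P zero    n = refl
  #-+ P (suc m) n = trans (cong (bit em ℕ.+_) (#-+ (P ∘ suc) m n)) (sym (ℕₚ.+-assoc (bit (em {P 0})) _ _))

  #-empty : ∀ {P} n → (∀ i → ¬ P i) → # P n ≡ 0
  #-empty zero    ¬P = refl
  #-empty {P} (suc n) ¬P with em {P 0}
  ... | yes p = contradiction p (¬P 0)
  ... | no _  = #-empty n (¬P ∘ suc)

  #-extend : ∀ {P m n} → m ℕ.≤ n → (∀ i → m ℕ.≤ i → ¬ P i) → # P m ≡ # P n
  #-extend {P} {m} {n} m≤n ¬P = sym (begin
    # P n                                        ≡⟨ cong (# P) (ℕₚ.m+[n∸m]≡n m≤n) ⟨
    # P (m ℕ.+ (n ℕ.∸ m))                        ≡⟨ #-+ P m (n ℕ.∸ m) ⟩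
    # P m ℕ.+ # (λ i → P (m ℕ.+ i)) (n ℕ.∸ m)    ≡⟨ cong (# P m ℕ.+_) (#-empty (n ℕ.∸ m) λ i → ¬P (m ℕ.+ i) (ℕₚ.m≤m+n m i)) ⟩
    # P m ℕ.+ 0                                  ≡⟨ ℕₚ.+-identityʳ _ ⟩
    # P m                                        ∎)
    where open ≡-Reasoning

  count-tabulate : ∀ {A : Set} {Q : Pred A 0ℓ} {P : ℕ → Set} (Q? : Decidable Q) {m} (f : Fin m → A) →
                   (∀ i → Q (f i) ⇔ P (toℕ i)) → count Q? (tabulate f) ≡ # P m
  count-tabulate Q? {zero}  f Q⇔P = refl
  count-tabulate Q? {suc m} f Q⇔P with Q? (f zero) | bit-cong (Q? (f zero)) em (Q⇔P zero)
  ... | yes _ | eq = cong₂ ℕ._+_ eq (count-tabulate Q? (f ∘ suc) (Q⇔P ∘ suc))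
  ... | no _  | eq = cong₂ ℕ._+_ eq (count-tabulate Q? (f ∘ suc) (Q⇔P ∘ suc))

  -- Starts from `n ∸ k` on overshoot, so extending the range of starts to `n` adds nothing.
  c-occ≡# : ∀ {k n} (π : S (suc k)) (σ : S n) → c-occ π σ ≡ # (Occ π σ) n
  c-occ≡# {k} {n} π σ = trans
    (count-tabulate (λ i → pat (window i) σ ≟ˢ π) id
      (λ i → let h = start-bound i in mk⇔
        (λ eq → h , trans (pat-ext (win (toℕ i) h) (window i) σ (λ a → Finₚ.toℕ-injective
           (trans (toℕ-at-win (toℕ i) h a) (sym (toℕ-at-window i a))))) eq)
        (λ (h , eq) → trans (pat-ext (window i) (win (toℕ i) h) σ (λ a → Finₚ.toℕ-injective
           (trans (toℕ-at-window i a) (sym (toℕ-at-win (toℕ i) h a))))) eq)))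
    (#-extend (ℕₚ.m∸n≤m n k) λ i n∸k≤i (h , _) → ℕₚ.<⇒≱ (subst (ℕ._≤ n) (ℕₚ.+-suc i k) h)
      (ℕₚ.≤-trans (ℕₚ.m≤n+m∸n n k) (ℕₚ.≤-trans (ℕₚ.+-monoʳ-≤ k n∸k≤i) (ℕₚ.≤-reflexive (ℕₚ.+-comm k i)))))
    where
    start-bound : (i : Fin (n ℕ.∸ k)) → toℕ i ℕ.+ suc k ℕ.≤ n
    start-bound i = subst (ℕ._≤ n) (trans (cong (λ l → suc (toℕ i ℕ.+ l)) (Finₚ.toℕ-fromℕ k)) (sym (ℕₚ.+-suc (toℕ i) k)))
      (window-bound {suc k} {n} i (Fin.fromℕ k))

  module _ {_∙_ : ∀ {m n} → S m → S n → S (m ℕ.+ n)} (blockSum : BlockSum _∙_)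
           {k m n} (π : S (suc k)) (σ : S m) (τ : S n) where

    c-occ-∙ : c-occ π (σ ∙ τ) ≡ # (Occ π (σ ∙ τ)) m ℕ.+ c-occ π τ
    c-occ-∙ = trans (c-occ≡# π (σ ∙ τ)) (trans (#-+ (Occ π (σ ∙ τ)) m n)
      (cong (# (Occ π (σ ∙ τ)) m ℕ.+_)
        (trans (#-cong n λ i _ → Occ-right blockSum π σ τ i) (sym (c-occ≡# π τ)))))

    c-occ-∙-≥ : c-occ π σ ℕ.+ c-occ π τ ℕ.≤ c-occ π (σ ∙ τ)
    c-occ-∙-≥ = subst₂ ℕ._≤_ (cong (ℕ._+ c-occ π τ) (sym (c-occ≡# π σ))) (sym c-occ-∙)
      (ℕₚ.+-monoˡ-≤ (c-occ π τ) (#-mono m λ i _ occ → Equivalence.from (Occ-left blockSum π σ τ i (proj₁ occ)) occ))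

    -- A window starting before `m ∸ k` stays inside the left block, so at most `k` starts can
    -- straddle the boundary; this is rounded up to the window length `suc k`.
    c-occ-∙-≤ : c-occ π (σ ∙ τ) ℕ.≤ c-occ π σ ℕ.+ suc k ℕ.+ c-occ π τ
    c-occ-∙-≤ = subst (ℕ._≤ c-occ π σ ℕ.+ suc k ℕ.+ c-occ π τ) (sym c-occ-∙)
      (ℕₚ.+-monoˡ-≤ (c-occ π τ) (begin
        # P m                                                ≡⟨ cong (# P) (ℕₚ.m+[n∸m]≡n l≤m) ⟨
        # P (l ℕ.+ (m ℕ.∸ l))                                ≡⟨ #-+ P l (m ℕ.∸ l) ⟩
        # P l ℕ.+ # (λ i → P (l ℕ.+ i)) (m ℕ.∸ l)            ≤⟨ ℕₚ.+-mono-≤ early (ℕₚ.≤-trans (#≤ _ (m ℕ.∸ l)) late) ⟩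
        # (Occ π σ) l ℕ.+ suc k                              ≤⟨ ℕₚ.+-monoˡ-≤ (suc k) (ℕₚ.m≤m+n _ _) ⟩
        # (Occ π σ) l ℕ.+ # (λ i → Occ π σ (l ℕ.+ i)) (m ℕ.∸ l) ℕ.+ suc k
                                                             ≡⟨ cong (ℕ._+ suc k) (#-+ (Occ π σ) l (m ℕ.∸ l)) ⟨
        # (Occ π σ) (l ℕ.+ (m ℕ.∸ l)) ℕ.+ suc k              ≡⟨ cong (λ x → # (Occ π σ) x ℕ.+ suc k) (ℕₚ.m+[n∸m]≡n l≤m) ⟩
        # (Occ π σ) m ℕ.+ suc k                              ≡⟨ cong (ℕ._+ suc k) (c-occ≡# π σ) ⟨
        c-occ π σ ℕ.+ suc k                                  ∎))
      where
      open ℕₚ.≤-Reasoning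
      P = Occ π (σ ∙ τ)
      l = m ℕ.∸ k
      l≤m = ℕₚ.m∸n≤m m k
      early : # P l ℕ.≤ # (Occ π σ) l
      early = #-mono l λ i i<l → Equivalence.to (Occ-left blockSum π σ τ i
        (subst (ℕ._≤ m) (trans (cong (λ x → suc (i ℕ.+ x)) (Finₚ.toℕ-fromℕ k)) (sym (ℕₚ.+-suc i k)))
          (subst (λ x → x ℕ.+ toℕ (Fin.fromℕ k) ℕ.< m) (Finₚ.toℕ-fromℕ< i<l) (window-bound {suc k} {m} (fromℕ< i<l) (Fin.fromℕ k)))))
      late : m ℕ.∸ l ℕ.≤ suc k
      late = ℕₚ.≤-trans (ℕₚ.m≤n+o⇒m∸n≤o m l (subst (m ℕ.≤_) (ℕₚ.+-comm k l) (ℕₚ.m≤n+m∸n m k))) (ℕₚ.n≤1+n k)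

-- Realising walks; sums of permutations

-- A predicate that is upward closed along `f` is a cut. The search lowers the cut from `n`, where
-- validity is vacuous, until one more step would fail.
threshold : ExcludedMiddle 0ℓ → ∀ {l} n (f : Fin l → ℕ) (P : Pred (Fin l) 0ℓ) → (∀ a → f a ℕ.< n) →
            (∀ a b → P a → f a ℕ.≤ f b → P b) →
            ∃ λ c → c ℕ.≤ n × ∀ a → P a ⇔ c ℕ.≤ f a
threshold em n f P f<n up = go n ℕₚ.≤-refl λ a n≤f → contradiction n≤f (ℕₚ.<⇒≱ (f<n a))
  where
  go : ∀ c → c ℕ.≤ n → (∀ a → c ℕ.≤ f a → P a) → ∃ λ c → c ℕ.≤ n × ∀ a → P a ⇔ c ℕ.≤ f a
  go zero    c≤n valid = 0 , c≤n , λ a → mk⇔ (λ _ → ℕ.z≤n) (valid a)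
  go (suc c) c≤n valid with em {∀ a → c ℕ.≤ f a → P a}
  ... | yes valid′ = go c (ℕₚ.<⇒≤ c≤n) valid′
  ... | no ¬valid′ = suc c , c≤n , λ a → mk⇔
    (λ Pa → ℕₚ.≰⇒> λ fa≤c → ¬valid′ λ b c≤fb → up a b Pa (ℕₚ.≤-trans fa≤c c≤fb))
    (valid a)

≮⇒> : ∀ {n} {i j : Fin n} → i ≢ j → ¬ i Fin.< j → j Fin.< i
≮⇒> i≢j i≮j = ℕₚ.≤∧≢⇒< (ℕₚ.≮⇒≥ i≮j) (λ eq → i≢j (Finₚ.toℕ-injective (sym eq)))

flip-< : ∀ {m n} {i j : Fin m} {k l : Fin n} → i ≢ j → k ≢ l →
         i Fin.< j ⇔ k Fin.< l → j Fin.< i ⇔ l Fin.< k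
flip-< i≢j k≢l iff = mk⇔
  (λ j<i → ≮⇒> k≢l λ k<l → ℕₚ.<-asym j<i (Equivalence.from iff k<l))
  (λ l<k → ≮⇒> i≢j λ i<j → ℕₚ.<-asym l<k (Equivalence.to iff i<j))

pat-beginning : ∀ {k n} (i : ℕ) (h : i ℕ.+ suc k ℕ.≤ n) (h′ : i ℕ.+ k ℕ.≤ n) (σ : S n) →
                pat (beginning (suc k)) (pat (win i h) σ) ≡ pat (win i h′) σ
pat-beginning {k} i h h′ σ = trans (sym (pat-∘ (win i h) (beginning (suc k)) σ))
  (pat-ext (win i h ∘ᵖ beginning (suc k)) (win i h′) σ λ a → Finₚ.toℕ-injective
    (trans (toℕ-at-win i h (inject₁ a)) (trans (cong (i ℕ.+_) (Finₚ.toℕ-inject₁ a)) (sym (toℕ-at-win i h′ a)))))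

pat-ending : ∀ {k n} (i : ℕ) (h : i ℕ.+ suc k ℕ.≤ n) (h′ : suc i ℕ.+ k ℕ.≤ n) (σ : S n) →
             pat (ending (suc k)) (pat (win i h) σ) ≡ pat (win (suc i) h′) σ
pat-ending {k} i h h′ σ = trans (sym (pat-∘ (win i h) (ending (suc k)) σ))
  (pat-ext (win i h ∘ᵖ ending (suc k)) (win (suc i) h′) σ λ a → Finₚ.toℕ-injective
    (trans (toℕ-at-win i h (suc a)) (trans (ℕₚ.+-suc i (toℕ a)) (sym (toℕ-at-win (suc i) h′ a)))))

pat-full : ∀ {n} (h : n ℕ.≤ n) (σ : S n) → pat (win 0 h) σ ≡ σ
pat-full h σ = order-determines _ σ λ i j → ⇔-trans (pat-spec (win 0 h) σ i j)
  (SameOrder-reindex (σ ⟨_⟩) (λ a → Finₚ.toℕ-injective (toℕ-at-win 0 h a)) (λ i j → mk⇔ id id) i j)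

-- The first `k` entries of `σ` are ordered like `e` without its first entry. Hence those that must
-- exceed the new entry are upward closed by value, and the `threshold` of this set is the value to
-- insert.
prepend-realises : ExcludedMiddle 0ℓ → ∀ {k n} (e : S (suc k)) (σ : S n) (h : k ℕ.≤ n) →
                   pat (win 0 h) σ ≡ pat (ending (suc k)) e →
                   ∃ λ c → pat (win 0 (ℕ.s≤s h)) (prepend c σ) ≡ e
prepend-realises em {k} {n} e σ h eq = c , order-determines _ e λ i j →
  ⇔-trans (pat-spec (win 0 (ℕ.s≤s h)) τ i j) (SameOrder-reindex (τ ⟨_⟩) g≡ same i j)
  where
  J : Positions k n
  J = win 0 h
  tail : SameOrder (λ a → σ ⟨ at J a ⟩) (λ a → e ⟨ suc a ⟩)
  tail = pat-cong⁻ J (ending (suc k)) σ e eq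
  P : Pred (Fin k) 0ℓ
  P a = e ⟨ zero ⟩ Fin.< e ⟨ suc a ⟩
  up : ∀ a b → P a → toℕ (σ ⟨ at J a ⟩) ℕ.≤ toℕ (σ ⟨ at J b ⟩) → P b
  up a b Pa fa≤fb with ℕₚ.m≤n⇒m<n∨m≡n fa≤fb
  ... | inj₁ fa<fb = ℕₚ.<-trans Pa (Equivalence.to (tail a b) fa<fb)
  ... | inj₂ fa≡fb = subst P (at-injective J (⟨⟩-injective σ (Finₚ.toℕ-injective fa≡fb))) Pa
  cut = threshold em n (λ a → toℕ (σ ⟨ at J a ⟩)) P (λ a → Finₚ.toℕ<n _) up
  c : Fin (suc n)
  c = fromℕ< (ℕ.s≤s (proj₁ (proj₂ cut)))
  c-spec : ∀ a → c Fin.< punchIn c (σ ⟨ at J a ⟩) ⇔ P a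
  c-spec a = ⇔-trans (<-punchIn c (σ ⟨ at J a ⟩))
    (⇔-trans (≡⇒⇔ (cong (ℕ._≤ toℕ (σ ⟨ at J a ⟩)) (Finₚ.toℕ-fromℕ< (ℕ.s≤s (proj₁ (proj₂ cut))))))
      (⇔-sym (proj₂ (proj₂ cut) a)))
  τ : S (suc n)
  τ = prepend c σ
  g : Fin (suc k) → Fin (suc n)
  g zero    = zero
  g (suc a) = suc (at J a)
  g≡ : ∀ a → at (win 0 (ℕ.s≤s h)) a ≡ g a
  g≡ zero    = Finₚ.toℕ-injective (toℕ-at-win 0 (ℕ.s≤s h) zero)
  g≡ (suc a) = Finₚ.toℕ-injective (trans (toℕ-at-win 0 (ℕ.s≤s h) (suc a)) (cong suc (sym (toℕ-at-win 0 h a))))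
  first : ∀ b → τ ⟨ zero ⟩ Fin.< τ ⟨ suc (at J b) ⟩ ⇔ P b
  first b = ⇔-trans (≡⇒⇔ (cong (c Fin.<_) (prepend-suc c σ (at J b)))) (c-spec b)
  same : SameOrder (λ a → τ ⟨ g a ⟩) (e ⟨_⟩)
  same zero    zero    = mk⇔ (λ lt → contradiction lt (ℕₚ.<-irrefl refl)) (λ lt → contradiction lt (ℕₚ.<-irrefl refl))
  same zero    (suc b) = first b
  same (suc a) zero    = flip-< (λ p → Finₚ.0≢1+n (⟨⟩-injective τ p)) (λ p → Finₚ.0≢1+n (⟨⟩-injective e p)) (first a)
  same (suc a) (suc b) = ⇔-trans (prepend-SameOrder c σ (at J a) (at J b)) (tail a b)

-- Unlike `Linked`, a path carries its endpoints, so there is an empty walk at each vertex, where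
-- realisation starts, and walks concatenate by type.
data Path (G : Graph) : Graph.V G → List (Graph.E G) → Graph.V G → Set where
  stay : ∀ {u} → Path G u [] u
  step : ∀ {u w es} e → Graph.st G e ≡ u → Path G (Graph.ar G e) es w → Path G u (e ∷ es) w

path-++ : ∀ {G u v w es fs} → Path G u es v → Path G v fs w → Path G u (es ++ fs) w
path-++ stay           q = q
path-++ (step e eq p) q = step e eq (path-++ p q)

path-repeat : ∀ {G u es} → Path G u es u → ∀ n → Path G u (List.concat (List.replicate n es)) u
path-repeat p zero    = stay
path-repeat p (suc n) = path-++ p (path-repeat p n)

occurrences : ∀ {k} → S k → List (S k) → ℕ
occurrences π xs = length (filter (π ≟ˢ_) xs)

occurrences-++ : ∀ {k} (π : S k) xs ys → occurrences π (xs ++ ys) ≡ occurrences π xs ℕ.+ occurrences π ys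
occurrences-++ π xs ys = trans (cong length (Listₚ.filter-++ (π ≟ˢ_) xs ys)) (Listₚ.length-++ (filter (π ≟ˢ_) xs))

module Realisation (em : ExcludedMiddle 0ℓ) (k : ℕ) (B : Pred 𝒮 0ℓ) where
  open Counting em
  private G = OverlapGraph (suc k) B
  open Graph G

  occurrences-∷ : ∀ {k} (π ρ : S k) xs → bit (π ≟ˢ ρ) ℕ.+ occurrences π xs ≡ occurrences π (ρ ∷ xs)
  occurrences-∷ π ρ xs with π ≟ˢ ρ
  ... | yes π≡ρ = sym (cong length (Listₚ.filter-accept (π ≟ˢ_) π≡ρ))
  ... | no π≢ρ  = sym (cong length (Listₚ.filter-reject (π ≟ˢ_) π≢ρ))

  -- The occurrence of `u` at position 0 is the invariant that makes the next edge fit. The size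
  -- counts one entry per edge on top of the `k` entries of the final vertex.
  Realises : V → List E → Set
  Realises u es = ∃ λ (σ : S (length es ℕ.+ k)) →
    Occ (value u) σ 0 × ∀ π → c-occ {suc k} π σ ≡ occurrences π (map value es)

  extend : ∀ e es (σ : S (length es ℕ.+ k)) (h : k ℕ.≤ length es ℕ.+ k) c →
           pat (win 0 (ℕ.s≤s h)) (prepend c σ) ≡ value e →
           (∀ π → c-occ {suc k} π σ ≡ occurrences π (map value es)) → Realises (st e) (e ∷ es)
  extend e es σ h c eq′ counts =
    τ , (h₁ , trans (sym (pat-beginning 0 (ℕ.s≤s h) h₁ τ)) (cong (pat (beginning (suc k))) eq′)) , counts⁺
    where
    h₁ : k ℕ.≤ suc (length es ℕ.+ k)
    h₁ = ℕₚ.m≤n⇒m≤1+n h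
    τ : S (suc (length es ℕ.+ k))
    τ = prepend c σ
    first : ∀ π → Occ π τ 0 ⇔ π ≡ value e
    first π = mk⇔
      (λ (h′ , q) → trans (sym q) (trans (pat-ext (win 0 h′) (win 0 (ℕ.s≤s h)) τ
        (λ a → Finₚ.toℕ-injective (trans (toℕ-at-win 0 h′ a) (sym (toℕ-at-win 0 (ℕ.s≤s h) a))))) eq′))
      (λ { refl → ℕ.s≤s h , eq′ })
    counts⁺ : ∀ π → c-occ π τ ≡ occurrences π (value e ∷ map value es)
    counts⁺ π = begin
      c-occ π τ                                                         ≡⟨ c-occ≡# π τ ⟩
      bit em ℕ.+ # (Occ π τ ∘ suc) (length es ℕ.+ k)
        ≡⟨ cong₂ ℕ._+_ (bit-cong em (π ≟ˢ value e) (first π)) (#-cong (length es ℕ.+ k) λ i _ → Occ-prepend c π σ i) ⟩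
      bit (π ≟ˢ value e) ℕ.+ # (Occ π σ) (length es ℕ.+ k)              ≡⟨ cong (bit (π ≟ˢ value e) ℕ.+_) (trans (sym (c-occ≡# π σ)) (counts π)) ⟩
      bit (π ≟ˢ value e) ℕ.+ occurrences π (map value es)               ≡⟨ occurrences-∷ π (value e) (map value es) ⟩
      occurrences π (value e ∷ map value es)                            ∎
      where open ≡-Reasoning

  realise : ∀ {u es w} → Path G u es w → Realises u es
  realise {u} stay = value u , (ℕₚ.≤-refl , pat-full ℕₚ.≤-refl (value u)) , λ π →
    trans (c-occ≡# π (value u)) (#-empty k λ i (h , _) → ℕₚ.<⇒≱ ℕₚ.≤-refl (ℕₚ.≤-trans (ℕₚ.m≤n+m (suc k) i) h))
  realise (step {es = es} e refl p) =
    let σ , (h , eq) , counts = realise p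
        c , eq′ = prepend-realises em (value e) σ h eq
    in extend e es σ h c eq′ counts

module BlockSums (em : ExcludedMiddle 0ℓ) {_∙_ : ∀ {m n} → S m → S n → S (m ℕ.+ n)} (blockSum : BlockSum _∙_) where
  open Counting em

  -- `power p` consists of `suc p` copies, since `𝒮` has no empty permutation to start from.
  power : ℕ → 𝒮 → 𝒮
  power zero    s       = s
  power (suc p) (m , σ) = let n , τ = power p (m , σ) in m ℕ.+ suc n , σ ∙ τ

  power-size : ∀ p s → size (power p s) ≡ suc p ℕ.* size s
  power-size zero    s = sym (ℕₚ.+-identityʳ _)
  power-size (suc p) s = cong (size s ℕ.+_) (power-size p s)

  power-Av : ∀ {C : Pred 𝒮 0ℓ} → C Closed-under _∙_ → ∀ p s → s ∈ C → power p s ∈ C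
  power-Av closed zero    s s∈C = s∈C
  power-Av closed (suc p) (m , σ) s∈C =
    closed {τ = σ} {proj₂ (power p (m , σ))} s∈C
      (power-Av (λ {m} {n} {τ} {σ} → closed {m} {n} {τ} {σ}) p (m , σ) s∈C)

  module _ {k} (π : S (suc k)) where

    occ : 𝒮 → ℕ
    occ (_ , σ) = c-occ π σ

    power-occ-≥ : ∀ p s → suc p ℕ.* occ s ℕ.≤ occ (power p s)
    power-occ-≥ zero    s = ℕₚ.≤-reflexive (ℕₚ.+-identityʳ _)
    power-occ-≥ (suc p) s = ℕₚ.≤-trans (ℕₚ.+-monoʳ-≤ (occ s) (power-occ-≥ p s))
      (c-occ-∙-≥ blockSum π (proj₂ s) (proj₂ (power p s)))

    power-occ-≤ : ∀ p s → occ (power p s) ℕ.≤ suc p ℕ.* (occ s ℕ.+ suc k)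
    power-occ-≤ zero    s = ℕₚ.≤-trans (ℕₚ.m≤m+n _ (suc k)) (ℕₚ.≤-reflexive (sym (ℕₚ.+-identityʳ _)))
    power-occ-≤ (suc p) s = ℕₚ.≤-trans (c-occ-∙-≤ blockSum π (proj₂ s) (proj₂ (power p s)))
      (ℕₚ.+-monoʳ-≤ (occ s ℕ.+ suc k) (power-occ-≤ p s))

module _ {_∙_ : ∀ {m n} → S m → S n → S (m ℕ.+ n)} (blockSum : BlockSum _∙_)
         {t m n} (τ : S (suc t)) (σ : S m) (ρ : S n) (I : Positions (suc t) (m ℕ.+ n)) (eq : pat I (σ ∙ ρ) ≡ τ) where
  open BlockSum blockSum
  private end = Fin.fromℕ t

  at≤at-end : ∀ a → toℕ (at I a) ℕ.≤ toℕ (at I end)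
  at≤at-end a with ℕₚ.m≤n⇒m<n∨m≡n (subst (toℕ a ℕ.≤_) (sym (Finₚ.toℕ-fromℕ t)) (ℕ.s≤s⁻¹ (Finₚ.toℕ<n a)))
  ... | inj₁ a<end = ℕₚ.<⇒≤ (increasing I a<end)
  ... | inj₂ a≡end = ℕₚ.≤-reflexive (cong (λ x → toℕ (at I x)) (Finₚ.toℕ-injective a≡end))

  at-zero≤at : ∀ a → toℕ (at I zero) ℕ.≤ toℕ (at I a)
  at-zero≤at zero    = ℕₚ.≤-refl
  at-zero≤at (suc a) = ℕₚ.<⇒≤ (increasing I (ℕ.s≤s ℕ.z≤n))

  contained-left : toℕ (at I end) ℕ.< m → Contains σ τ
  contained-left end<m = J , trans (pat-cong J I σ (σ ∙ ρ) λ a b →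
      ⇔-trans (⇔-sym (left σ ρ (at J a) (at J b)))
        (≡⇒⇔ (cong₂ (λ i j → (σ ∙ ρ) ⟨ i ⟩ Fin.< (σ ∙ ρ) ⟨ j ⟩) (at≡ a) (at≡ b)))) eq
    where
    at<m : ∀ a → toℕ (at I a) ℕ.< m
    at<m a = ℕₚ.≤-<-trans (at≤at-end a) end<m
    J : Positions (suc t) m
    J = record { at = λ a → fromℕ< (at<m a) ; increasing = λ {a} {b} a<b → subst₂ ℕ._<_
          (sym (Finₚ.toℕ-fromℕ< (at<m a))) (sym (Finₚ.toℕ-fromℕ< (at<m b))) (increasing I a<b) }
    at≡ : ∀ a → at J a ↑ˡ n ≡ at I a
    at≡ a = Finₚ.toℕ-injective (trans (Finₚ.toℕ-↑ˡ _ n) (Finₚ.toℕ-fromℕ< (at<m a)))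

  contained-right : m ℕ.≤ toℕ (at I zero) → Contains ρ τ
  contained-right m≤first = J , trans (pat-cong J I ρ (σ ∙ ρ) λ a b →
      ⇔-trans (⇔-sym (right σ ρ (at J a) (at J b)))
        (≡⇒⇔ (cong₂ (λ i j → (σ ∙ ρ) ⟨ i ⟩ Fin.< (σ ∙ ρ) ⟨ j ⟩) (at≡ a) (at≡ b)))) eq
    where
    m≤at : ∀ a → m ℕ.≤ toℕ (at I a)
    m≤at a = ℕₚ.≤-trans m≤first (at-zero≤at a)
    at-m<n : ∀ a → toℕ (at I a) ℕ.∸ m ℕ.< n
    at-m<n a = ℕₚ.+-cancelˡ-< m _ _ (subst (ℕ._< m ℕ.+ n) (sym (ℕₚ.m+[n∸m]≡n (m≤at a))) (Finₚ.toℕ<n (at I a)))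
    J : Positions (suc t) n
    J = record { at = λ a → fromℕ< (at-m<n a) ; increasing = λ {a} {b} a<b → subst₂ ℕ._<_
          (sym (Finₚ.toℕ-fromℕ< (at-m<n a))) (sym (Finₚ.toℕ-fromℕ< (at-m<n b)))
          (ℕₚ.∸-monoˡ-< (increasing I a<b) (m≤at a)) }
    at≡ : ∀ a → m ↑ʳ at J a ≡ at I a
    at≡ a = Finₚ.toℕ-injective (trans (Finₚ.toℕ-↑ʳ m _)
      (trans (cong (m ℕ.+_) (Finₚ.toℕ-fromℕ< (at-m<n a))) (ℕₚ.m+[n∸m]≡n (m≤at a))))

  straddled : toℕ (at I zero) ℕ.< m → m ℕ.≤ toℕ (at I end) →
              ∃ λ i → ∃ λ j → (σ ∙ ρ) ⟨ i ↑ˡ n ⟩ Fin.< (σ ∙ ρ) ⟨ m ↑ʳ j ⟩ ⇔ τ ⟨ zero ⟩ Fin.< τ ⟨ end ⟩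
  straddled first<m m≤end = fromℕ< first<m , fromℕ< end-m<n ,
    ⇔-trans (≡⇒⇔ (cong₂ (λ i j → (σ ∙ ρ) ⟨ i ⟩ Fin.< (σ ∙ ρ) ⟨ j ⟩) first≡ end≡))
      (⇔-trans (⇔-sym (pat-spec I (σ ∙ ρ) zero end))
        (≡⇒⇔ (cong (λ x → x ⟨ zero ⟩ Fin.< x ⟨ end ⟩) eq)))
    where
    end-m<n : toℕ (at I end) ℕ.∸ m ℕ.< n
    end-m<n = ℕₚ.+-cancelˡ-< m _ _ (subst (ℕ._< m ℕ.+ n) (sym (ℕₚ.m+[n∸m]≡n m≤end)) (Finₚ.toℕ<n (at I end)))
    first≡ : fromℕ< first<m ↑ˡ n ≡ at I zero
    first≡ = Finₚ.toℕ-injective (trans (Finₚ.toℕ-↑ˡ _ n) (Finₚ.toℕ-fromℕ< first<m))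
    end≡ : m ↑ʳ fromℕ< end-m<n ≡ at I end
    end≡ = Finₚ.toℕ-injective (trans (Finₚ.toℕ-↑ʳ m _)
      (trans (cong (m ℕ.+_) (Finₚ.toℕ-fromℕ< end-m<n)) (ℕₚ.m+[n∸m]≡n m≤end)))

closed-unless-straddled : {_∙_ : ∀ {m n} → S m → S n → S (m ℕ.+ n)} (blockSum : BlockSum _∙_) → ∀ {t} (τ : S (suc t)) →
  (∀ {m n} (σ : S m) (ρ : S n) i j →
    ¬ ((σ ∙ ρ) ⟨ i ↑ˡ n ⟩ Fin.< (σ ∙ ρ) ⟨ m ↑ʳ j ⟩ ⇔ τ ⟨ zero ⟩ Fin.< τ ⟨ Fin.fromℕ t ⟩)) →
  ∀ {m n} (σ : S (suc m)) (ρ : S (suc n)) → Avoids ｛ t , τ ｝ σ → Avoids ｛ t , τ ｝ ρ → Avoids ｛ t , τ ｝ (σ ∙ ρ)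
closed-unless-straddled blockSum {t} τ unstraddled {m} σ ρ σ∈ ρ∈ .(t , τ) refl (I , eq) =
  [ (λ end<m → σ∈ (t , τ) refl (contained-left blockSum τ σ ρ I eq end<m))
  , (λ m≤end →
      [ (λ first<m → let i , j , iff = straddled blockSum τ σ ρ I eq first<m m≤end in unstraddled σ ρ i j iff)
      , (λ m≤first → ρ∈ (t , τ) refl (contained-right blockSum τ σ ρ I eq m≤first))
      ]′ (ℕₚ.<-≤-connex (toℕ (at I zero)) (suc m)))
  ]′ (ℕₚ.<-≤-connex (toℕ (at I (Fin.fromℕ t))) (suc m))

module _ {t} (τ : S (suc t)) where

  ⊖-closed : τ ⟨ zero ⟩ Fin.< τ ⟨ Fin.fromℕ t ⟩ → ∀ {m n} (σ : S (suc m)) (ρ : S (suc n)) →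
             Avoids ｛ t , τ ｝ σ → Avoids ｛ t , τ ｝ ρ → Avoids ｛ t , τ ｝ (σ ⊖ ρ)
  ⊖-closed up = closed-unless-straddled {_⊖_} ⊖-blockSum τ λ {m} {n} σ ρ i j iff →
    ℕₚ.<-asym (Equivalence.from iff up) (subst₂ ℕ._<_ (sym (⊖-↑ʳ σ ρ j)) (sym (⊖-↑ˡ σ ρ i))
      (ℕₚ.<-≤-trans (Finₚ.toℕ<n (ρ ⟨ j ⟩)) (ℕₚ.m≤m+n n _)))

  ⊕-closed : ¬ τ ⟨ zero ⟩ Fin.< τ ⟨ Fin.fromℕ t ⟩ → ∀ {m n} (σ : S (suc m)) (ρ : S (suc n)) →
             Avoids ｛ t , τ ｝ σ → Avoids ｛ t , τ ｝ ρ → Avoids ｛ t , τ ｝ (σ ⊕ ρ)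
  ⊕-closed ¬up = closed-unless-straddled {_⊕_} ⊕-blockSum τ λ {m} {n} σ ρ i j iff →
    ¬up (Equivalence.to iff (subst₂ ℕ._<_ (sym (⊕-↑ˡ σ ρ i)) (sym (⊕-↑ʳ σ ρ j))
      (ℕₚ.<-≤-trans (Finₚ.toℕ<n (σ ⟨ i ⟩)) (ℕₚ.m≤m+n m _))))

Av-singleton-closed : ∀ τ → Av ｛ τ ｝ Closed-under _⊕_ ⊎ Av ｛ τ ｝ Closed-under _⊖_
Av-singleton-closed (t , τ) = decide (τ ⟨ zero ⟩ Finₚ.<? τ ⟨ Fin.fromℕ t ⟩)
  where
  decide : Dec (τ ⟨ zero ⟩ Fin.< τ ⟨ Fin.fromℕ t ⟩) → _
  decide (yes up) = inj₂ (λ {_} {_} {σ} {ρ} → ⊖-closed τ up σ ρ)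
  decide (no ¬up) = inj₁ (λ {_} {_} {σ} {ρ} → ⊕-closed τ ¬up σ ρ)

-- Simple cycles and circulations

unique-lookup-injective : ∀ {A : Set} {xs : List A} → LUnique.Unique xs →
                          ∀ {i j} → List.lookup xs i ≡ List.lookup xs j → i ≡ j
unique-lookup-injective (_ ∷ _)    {zero}  {zero}  _  = refl
unique-lookup-injective (x∉ ∷ _)   {zero}  {suc j} eq = contradiction eq (LAll.lookup x∉ (LMemₚ.∈-lookup j))
unique-lookup-injective (x∉ ∷ _)   {suc i} {zero}  eq = contradiction (sym eq) (LAll.lookup x∉ (LMemₚ.∈-lookup i))
unique-lookup-injective (_ ∷ uniq) {suc i} {suc j} eq = cong suc (unique-lookup-injective uniq eq)

unique-length≤ : ∀ {A : Set} {n} → A HasCardinality n → ∀ {xs} → LUnique.Unique xs → length xs ℕ.≤ n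
unique-length≤ A↔ {xs} uniq = Finₚ.injective⇒≤ {f = Inverse.from A↔ ∘ List.lookup xs} λ eq →
  unique-lookup-injective uniq (trans (sym (Inverse.strictlyInverseˡ A↔ _))
    (trans (cong (Inverse.to A↔) eq) (Inverse.strictlyInverseˡ A↔ _)))

last-∷ : ∀ {A : Set} (x y : A) ys → last (x ∷ (y ∷ ys)) ≡ last (y ∷ ys)
last-∷ x y ys with List.initLast ys
... | []           = refl
... | _ List.∷ʳ′ _ = refl

-- For cutting a walk at `y`: the segment before it keeps distinct vertices, and another edge with
-- the source of `y` may be put in front of that segment.
unique-++ˡ : ∀ {A B : Set} (f : A → B) xs {y ys} → LUnique.Unique (map f (xs ++ y ∷ ys)) →
             LUnique.Unique (map f xs) × All (f y ≢_) (map f xs)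
unique-++ˡ f []       _          = [] , []
unique-++ˡ f (x ∷ xs) {y} {ys} (x∉ ∷ uniq) =
  let uniq′ , y∉ = unique-++ˡ f xs uniq
      x∉xs , x∉rest = LAllₚ.++⁻ xs (LAllₚ.map⁻ {f = f} x∉)
  in (LAllₚ.map⁺ x∉xs ∷ uniq′) , (LAll.head x∉rest ∘ sym) ∷ y∉

module _ (em : ExcludedMiddle 0ℓ) (G : Graph) where
  open Graph G

  linked-++ˡ : ∀ f xs {y ys} → Linked (λ e f → ar e ≡ st f) (f ∷ xs ++ y ∷ ys) →
               Linked (λ e f → ar e ≡ st f) (f ∷ xs) × st y ≡ ar (last (f ∷ xs))
  linked-++ˡ f []       (eq ∷ _)      = [-] , sym eq
  linked-++ˡ f (x ∷ xs) (eq ∷ linked) =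
    let linked′ , eq′ = linked-++ˡ x xs linked
    in eq ∷ linked′ , trans eq′ (cong ar (sym (last-∷ f x xs)))

  module _ {P : Pred E 0ℓ} (pred : ∀ e → P e → ∃ λ f → P f × ar f ≡ st e) {n} (V↔ : V HasCardinality n) where

    -- Prolong a walk with distinct vertices backwards until a vertex repeats.
    extend-to-cycle : ∀ fuel e es → n ℕ.< fuel ℕ.+ length (e ∷ es) →
      Linked (λ e f → ar e ≡ st f) (e ∷ es) → LUnique.Unique (map st (e ∷ es)) → All P (e ∷ es) →
      ∃ λ C → IsSimpleCycle G C × All P (toList C)
    extend-to-cycle zero e es n<len linked uniq ps = contradiction
      (subst (ℕ._≤ n) (Listₚ.length-map st (e ∷ es)) (unique-length≤ V↔ uniq)) (ℕₚ.<⇒≱ n<len)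
    extend-to-cycle (suc fuel) e es n<len linked uniq (p ∷ ps) with pred e p
    ... | f , Pf , f→e with em {st f LMem.∈ map st (e ∷ es)}
    ...   | no st-f∉ = extend-to-cycle fuel f (e ∷ es)
              (subst (n ℕ.<_) (sym (ℕₚ.+-suc fuel _)) n<len)
              (f→e ∷ linked) (LAll.tabulate (λ { {x} x∈ refl → st-f∉ x∈ }) ∷ uniq) (Pf ∷ p ∷ ps)
    ...   | yes st-f∈ with LMemₚ.∈-map⁻ st st-f∈
    ...     | g , g∈ , st-f≡st-g with LMemₚ.∈-∃++ g∈
    -- The new edge `f` has the same source as `g`, and the edges before `g` lead to that source, so
    -- `f` followed by them closes up.
    ...       | before , after , split = (f ∷ before) , record
                { walk = proj₁ closing
                ; closed = trans st-f≡st-g (proj₂ closing)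
                ; edges-distinct = LUniqueₚ.map⁻ vertices
                ; vertices-distinct = vertices
                } , Pf ∷ LAllₚ.++⁻ˡ before (subst (All P) split (p ∷ ps))
      where
      closing = linked-++ˡ f before (subst (λ xs → Linked (λ e f → ar e ≡ st f) (f ∷ xs)) split (f→e ∷ linked))
      prefix = unique-++ˡ st before (subst (λ xs → LUnique.Unique (map st xs)) split uniq)
      vertices : LUnique.Unique (map st (f ∷ before))
      vertices = LAll.map (λ g≢x f≡x → g≢x (trans (sym st-f≡st-g) f≡x)) (proj₂ prefix) ∷ proj₁ prefix

    simple-cycle : ∃ P → ∃ λ C → IsSimpleCycle G C × All P (toList C)
    simple-cycle (e , Pe) = extend-to-cycle n e [] (ℕₚ.m<m+n n ℕₚ.0<1+n) [-] ([] ∷ []) (Pe ∷ [])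

module Flows (em : ExcludedMiddle 0ℓ) (ℝ-field : CompleteOrderedField) (G : Graph)
             {a} (E↔ : Graph.E G HasCardinality a) {b} (V↔ : Graph.V G HasCardinality b) where
  open Reals ℝ-field
  open LinearAlgebra em ℝ-field
  open Graph G
  open Relation.Binary.Reasoning.Setoid setoid
  open LMem using () renaming (_∈_ to _∈ˡ_)

  private
    edge : Fin a → E
    edge = Inverse.to E↔

  sumᴱ : (E → ℝ) → ℝ
  sumᴱ g = sum (g ∘ edge)

  sumᴱ-ind : ∀ x (g : E → ℝ) → sumᴱ (λ e → ind (x ≡ e) * g e) ≈ g x
  sumᴱ-ind x g = begin
    sum (λ i → ind (x ≡ edge i) * g (edge i))
      ≈⟨ sum-cong-≋ reindex ⟩
    sum (λ i → ind (Inverse.from E↔ x ≡ i) * g (edge i))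
      ≈⟨ sum-ind (Inverse.from E↔ x) (g ∘ edge) ⟩
    g (edge (Inverse.from E↔ x))
      ≡⟨ cong g (Inverse.strictlyInverseˡ E↔ x) ⟩
    g x ∎
    where
    reindex : ∀ i → ind (x ≡ edge i) * g (edge i) ≈ ind (Inverse.from E↔ x ≡ i) * g (edge i)
    reindex i = *-congʳ (ind-cong (mk⇔
      (λ { refl → Inverse.strictlyInverseʳ E↔ i })
      (λ { refl → sym (Inverse.strictlyInverseˡ E↔ x) })))

  mult : List E → E → ℝ
  mult []       e = 0#
  mult (x ∷ xs) e = ind (x ≡ e) + mult xs e

  sumˡ : (E → ℝ) → List E → ℝ
  sumˡ g []       = 0#
  sumˡ g (x ∷ xs) = g x + sumˡ g xs

  sumᴱ-mult : ∀ xs (g : E → ℝ) → sumᴱ (λ e → mult xs e * g e) ≈ sumˡ g xs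
  sumᴱ-mult []       g = sum-zero {f = λ i → 0# * g (edge i)} λ i → zeroˡ _
  sumᴱ-mult (x ∷ xs) g = begin
    sumᴱ (λ e → (ind (x ≡ e) + mult xs e) * g e)
      ≈⟨ sum-cong-≋ (λ i → distribʳ (g (edge i)) (ind (x ≡ edge i)) (mult xs (edge i))) ⟩
    sumᴱ (λ e → ind (x ≡ e) * g e + mult xs e * g e)
      ≈⟨ ∑-distrib-+ (λ i → ind (x ≡ edge i) * g (edge i)) (λ i → mult xs (edge i) * g (edge i)) ⟩
    sumᴱ (λ e → ind (x ≡ e) * g e) + sumᴱ (λ e → mult xs e * g e)
      ≈⟨ +-cong (sumᴱ-ind x g) (sumᴱ-mult xs g) ⟩
    g x + sumˡ g xs ∎

  mult-∉ : ∀ {xs e} → ¬ e ∈ˡ xs → mult xs e ≈ 0#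
  mult-∉ {[]}     e∉ = ≈.refl
  mult-∉ {x ∷ xs} e∉ = ≈.trans (+-cong (ind-false (λ { refl → e∉ (here refl) })) (mult-∉ (e∉ ∘ there))) (+-identityˡ 0#)

  mult-∈ : ∀ {xs e} → LUnique.Unique xs → e ∈ˡ xs → mult xs e ≈ 1#
  mult-∈ (x∉ ∷ uniq) (here refl) =
    ≈.trans (+-cong (ind-true refl) (mult-∉ (λ e∈ → LAll.lookup x∉ e∈ refl))) (+-identityʳ 1#)
  mult-∈ (x∉ ∷ uniq) (there e∈) =
    ≈.trans (+-cong (ind-false (LAll.lookup x∉ e∈)) (mult-∈ uniq e∈)) (+-identityˡ 1#)

  mult≈filter : ∀ xs e → mult xs e ≈ ι (length (filter (e ≟ᴱ_) xs))
  mult≈filter []       e = ≈.refl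
  mult≈filter (x ∷ xs) e = compare (e ≟ᴱ x)
    where
    compare : Dec (e ≡ x) → mult (x ∷ xs) e ≈ ι (length (filter (e ≟ᴱ_) (x ∷ xs)))
    compare (yes e≡x) = ≈.trans (+-cong (ind-true (sym e≡x)) (mult≈filter xs e))
                    (≈.reflexive (cong (ι ∘ length) (sym (Listₚ.filter-accept (e ≟ᴱ_) e≡x))))
    compare (no e≢x)  = ≈.trans (+-cong (ind-false (e≢x ∘ sym)) (mult≈filter xs e))
                    (≈.trans (+-identityˡ _) (≈.reflexive (cong (ι ∘ length) (sym (Listₚ.filter-reject (e ≟ᴱ_) e≢x)))))

  sumˡ-1 : ∀ xs → sumˡ (λ _ → 1#) xs ≈ ι (length xs)
  sumˡ-1 []       = ≈.refl
  sumˡ-1 (x ∷ xs) = +-congˡ (sumˡ-1 xs)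

  sumˡ-telescope : ∀ (φ : V → ℝ) x xs → Linked (λ e f → ar e ≡ st f) (x ∷ xs) →
                   sumˡ (λ e → φ (ar e) - φ (st e)) (x ∷ xs) ≈ φ (ar (last (x ∷ xs))) - φ (st x)
  sumˡ-telescope φ x []       _             = +-identityʳ _
  sumˡ-telescope φ x (y ∷ ys) (eq ∷ linked) = begin
    φ (ar x) - φ (st x) + sumˡ (λ e → φ (ar e) - φ (st e)) (y ∷ ys)
      ≈⟨ +-congˡ (sumˡ-telescope φ y ys linked) ⟩
    φ (ar x) - φ (st x) + (φ (ar (last (y ∷ ys))) - φ (st y))
      ≈⟨ +-congˡ (+-cong (≈.reflexive (cong (φ ∘ ar) (sym (last-∷ x y ys)))) (-‿cong (≈.reflexive (cong φ (sym eq))))) ⟩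
    φ (ar x) - φ (st x) + (φ (ar (last (x ∷ (y ∷ ys)))) - φ (ar x))
      ≈⟨ solve 3 (λ p q r → p :- q :+ (r :- p) := r :- q) ≈.refl _ _ _ ⟩
    φ (ar (last (x ∷ (y ∷ ys)))) - φ (st x) ∎

  -- Net inflow, written as one linear functional per vertex: this is the expression that telescopes
  -- along a walk and that later serves as a constraint for the dimension. Loops cancel by
  -- themselves.
  Circulation : Pred (ℝ^ E) 0ℓ
  Circulation w = ∀ x → sumᴱ (λ e → w e * (ind (ar e ≡ x) - ind (st e ≡ x))) ≈ 0#

  cycle-circulation : ∀ {C} → IsSimpleCycle G C → Circulation (mult (toList C))
  cycle-circulation {C@(e ∷ es)} simple x = begin
    sumᴱ (λ f → mult (toList C) f * (ind (ar f ≡ x) - ind (st f ≡ x)))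
      ≈⟨ sumᴱ-mult (toList C) (λ f → ind (ar f ≡ x) - ind (st f ≡ x)) ⟩
    sumˡ (λ f → ind (ar f ≡ x) - ind (st f ≡ x)) (e ∷ es)
      ≈⟨ sumˡ-telescope (λ v → ind (v ≡ x)) e es (IsSimpleCycle.walk simple) ⟩
    ind (ar (last (e ∷ es)) ≡ x) - ind (st e ≡ x)
      ≡⟨ cong (λ v → ind (v ≡ x) - ind (st e ≡ x)) (sym (IsSimpleCycle.closed simple)) ⟩
    ind (st e ≡ x) - ind (st e ≡ x)
      ≈⟨ -‿inverseʳ _ ⟩
    0# ∎

  -- Inflow at the source of e equals outflow, which is at least w e > 0.
  inflow : ∀ {w} → Circulation w → (∀ e → 0# ≤ w e) → ∀ e → ¬ w e ≈ 0# → ∃ λ f → ¬ w f ≈ 0# × ar f ≡ st e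
  inflow {w} circ w≥0 e we≉0 with em {∃ λ f → ¬ w f ≈ 0# × ar f ≡ st e}
  ... | yes p = p
  ... | no ¬p = contradiction (antisym we≤0 (w≥0 e)) we≉0
    where
    x = st e
    in≈0 : ∀ f → w f * ind (ar f ≡ x) ≈ 0#
    in≈0 f with em {ar f ≡ x} | em {w f ≈ 0#}
    ... | no ar≢x | _        = zeroʳ _
    ... | yes _   | yes wf≈0 = ≈.trans (*-congʳ wf≈0) (zeroˡ _)
    ... | yes ar≡ | no wf≉0  = contradiction (f , wf≉0 , ar≡) ¬p
    out = λ f → w f * ind (st f ≡ x)
    out≈0 : sumᴱ out ≈ 0#
    out≈0 = begin
      sumᴱ out
        ≈⟨ solve 1 (λ o → o := con (+ 0) :- (con (+ 0) :- o)) ≈.refl _ ⟩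
      0# - (0# - sumᴱ out)
        ≈⟨ +-congˡ (-‿cong (+-congʳ (sum-zero (in≈0 ∘ edge)))) ⟨
      0# - (sumᴱ (λ f → w f * ind (ar f ≡ x)) - sumᴱ out)
        ≈⟨ +-congˡ (-‿cong (sum-diff (λ i → w (edge i) * ind (ar (edge i) ≡ x)) (out ∘ edge))) ⟨
      0# - sumᴱ (λ f → w f * ind (ar f ≡ x) - w f * ind (st f ≡ x))
        ≈⟨ +-congˡ (-‿cong (sum-cong-≋ (λ i → solve 3 (λ p q r → p :* (q :- r) := p :* q :- p :* r) ≈.refl
             (w (edge i)) (ind (ar (edge i) ≡ x)) (ind (st (edge i) ≡ x))))) ⟨
      0# - sumᴱ (λ f → w f * (ind (ar f ≡ x) - ind (st f ≡ x)))
        ≈⟨ +-congˡ (-‿cong (circ x)) ⟩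
      0# - 0#
        ≈⟨ -‿inverseʳ 0# ⟩
      0# ∎
    we≤0 : w e ≤ 0#
    we≤0 = ≤-respʳ out≈0 (≤-respˡ (begin
      out (edge (Inverse.from E↔ e))  ≡⟨ cong out (Inverse.strictlyInverseˡ E↔ e) ⟩
      w e * ind (st e ≡ x)            ≈⟨ *-congˡ (ind-true refl) ⟩
      w e * 1#                        ≈⟨ *-identityʳ _ ⟩
      w e                             ∎)
      (term≤sum (λ i → *-nonNeg (w≥0 (edge i)) (ind-≥0 _)) (Inverse.from E↔ e)))

  argmin : ∀ (w : E → ℝ) x xs → ∃ λ e → e ∈ˡ (x ∷ xs) × ∀ f → f ∈ˡ (x ∷ xs) → w e ≤ w f
  argmin w x []       = x , here refl , λ { f (here refl) → ≤-refl }
  argmin w x (y ∷ ys) with argmin w y ys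
  ... | e , e∈ , min with total (w x) (w e)
  ...   | inj₁ x≤e = x , here refl , λ { f (here refl) → ≤-refl ; f (there f∈) → ≤-trans x≤e (min f f∈) }
  ...   | inj₂ e≤x = e , there e∈ , λ { f (here refl) → e≤x ; f (there f∈) → min f f∈ }

  -- The convex hull without normalised weights, because peeling off a cycle changes the total.
  -- Since each cycle vector has total 1, `circulation⇒polytope` recovers the normalisation at the
  -- end.
  Cone : Pred (ℝ^ E) 0ℓ → Pred (ℝ^ E) 0ℓ
  Cone X v = ∃ λ n → Σ (Fin n → ℝ) λ c → Σ (Fin n → ℝ^ E) λ p →
    (∀ i → p i ∈ X) × (∀ i → 0# ≤ c i) × v ≋ lin c p

  CycleVectors : Pred (ℝ^ E) 0ℓ
  CycleVectors v = ∃ λ C → IsSimpleCycle G C × v ≋ cycleVector G C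

  mult≈cycleVector : ∀ C e → mult (toList C) e ≈ ι (length (toList C)) * cycleVector G C e
  mult≈cycleVector C@(x ∷ xs) e = begin
    mult (toList C) e                    ≈⟨ mult≈filter (toList C) e ⟩
    m                                    ≈⟨ *-identityʳ m ⟨
    m * 1#                               ≈⟨ *-congˡ (⁻¹-inverseʳ l (pos⇒≉0 (ι-pos (length xs)))) ⟨
    m * (l * l ⁻¹)                       ≈⟨ solve 3 (λ m l i → m :* (l :* i) := l :* (m :* i)) ≈.refl m l (l ⁻¹) ⟩
    l * (m * l ⁻¹)                       ∎
    where
    l = ι (length (toList C))
    m = ι (length (filter (e ≟ᴱ_) (toList C)))

  -- Subtract from w the largest possible multiple of a simple cycle inside its support.
  decompose : ∀ fuel (supp : List E) → length supp ℕ.≤ fuel → ∀ w → (∀ e → ¬ w e ≈ 0# → e ∈ˡ supp) →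
              Circulation w → (∀ e → 0# ≤ w e) → w ∈ Cone CycleVectors
  decompose fuel supp len≤ w ⊆supp circ w≥0 with em {∃ λ e → ¬ w e ≈ 0#}
  ... | no w≈0 = 0 , (λ ()) , (λ ()) , (λ ()) , (λ ()) , λ e → vanish e em
    where
    vanish : ∀ e → Dec (w e ≈ 0#) → w e ≈ 0#
    vanish e (yes p) = p
    vanish e (no ¬p) = contradiction (e , ¬p) w≈0
  ... | yes nonzero with simple-cycle em G (inflow circ w≥0) V↔ nonzero
  ...   | C@(x ∷ xs) , simple , C⊆ with argmin w x xs
  ...     | m , m∈C , m-min = peel fuel len≤
    where
    μ = w m
    w′ : E → ℝ
    w′ e = w e - μ * mult (toList C) e
    w′-∉ : ∀ {e} → ¬ e ∈ˡ toList C → w′ e ≈ w e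
    w′-∉ {e} e∉ = ≈.trans (+-congˡ (-‿cong (≈.trans (*-congˡ (mult-∉ e∉)) (zeroʳ μ))))
      (solve 1 (λ x → x :- con (+ 0) := x) ≈.refl (w e))
    w′-∈ : ∀ {e} → e ∈ˡ toList C → w′ e ≈ w e - μ
    w′-∈ e∈ = +-congˡ (-‿cong (≈.trans (*-congˡ (mult-∈ (IsSimpleCycle.edges-distinct simple) e∈)) (*-identityʳ μ)))
    w′≥0 : ∀ e → 0# ≤ w′ e
    w′≥0 e with em {e ∈ˡ toList C}
    ... | yes e∈ = ≤-respʳ (≈.sym (w′-∈ e∈)) (y-x≥0 (m-min e e∈))
    ... | no e∉  = ≤-respʳ (≈.sym (w′-∉ e∉)) (w≥0 e)
    w′m≈0 : w′ m ≈ 0#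
    w′m≈0 = ≈.trans (w′-∈ m∈C) (-‿inverseʳ μ)
    supp⊆ : ∀ e → ¬ w′ e ≈ 0# → ¬ w e ≈ 0#
    supp⊆ e w′e≉0 with em {e ∈ˡ toList C}
    ... | yes e∈ = LAll.lookup C⊆ e∈
    ... | no e∉  = λ we≈0 → w′e≉0 (≈.trans (w′-∉ e∉) we≈0)
    -- The lightest edge `m` of the cycle drops to zero, so it can leave the list that bounds the
    -- recursion.
    supp′ = filter (λ e → em {e ≢ m}) supp
    shorter : length supp′ ℕ.< length supp
    shorter = Listₚ.filter-notAll (λ e → em {e ≢ m}) supp
      (LAny.map (λ { refl m≢m → m≢m refl }) (⊆supp m (LAll.lookup C⊆ m∈C)))
    circ′ : Circulation w′
    circ′ x = begin
      sumᴱ (λ e → w′ e * d e)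
        ≈⟨ sum-cong-≋ (λ i → solve 4 (λ w μ c d → (w :- μ :* c) :* d := w :* d :- μ :* (c :* d)) ≈.refl
             (w (edge i)) μ (mult (toList C) (edge i)) (d (edge i))) ⟩
      sumᴱ (λ e → w e * d e - μ * (mult (toList C) e * d e))
        ≈⟨ sum-diff (λ i → w (edge i) * d (edge i)) (λ i → μ * (mult (toList C) (edge i) * d (edge i))) ⟩
      sumᴱ (λ e → w e * d e) - sumᴱ (λ e → μ * (mult (toList C) e * d e))
        ≈⟨ +-cong (circ x) (-‿cong (≈.trans
             (≈.sym (*-distribˡ-sum μ (λ i → mult (toList C) (edge i) * d (edge i))))
             (*-congˡ (cycle-circulation simple x)))) ⟩
      0# - μ * 0#
        ≈⟨ solve 1 (λ μ → con (+ 0) :- μ :* con (+ 0) := con (+ 0)) ≈.refl μ ⟩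
      0# ∎
      where
      d : E → ℝ
      d e = ind (ar e ≡ x) - ind (st e ≡ x)
    peel : ∀ fuel → length supp ℕ.≤ fuel → w ∈ Cone CycleVectors
    peel zero len≤ = contradiction (ℕₚ.<-≤-trans shorter len≤) ℕₚ.n≮0
    peel (suc fuel) len≤ =
      let n , c , p , p∈ , c≥0 , eq = decompose fuel supp′ (ℕ.s≤s⁻¹ (ℕₚ.<-≤-trans shorter len≤)) w′
            (λ e w′e≉0 → LMemₚ.∈-filter⁺ (λ e → em {e ≢ m}) (⊆supp e (supp⊆ e w′e≉0)) (λ { refl → w′e≉0 w′m≈0 }))
            circ′ w′≥0
          l = ι (length (toList C))
      in suc n , (λ { zero → μ * l ; (suc i) → c i }) , (λ { zero → cycleVector G C ; (suc i) → p i }) ,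
         (λ { zero → C , simple , (λ _ → ≈.refl) ; (suc i) → p∈ i }) ,
         (λ { zero → *-nonNeg (w≥0 m) (ι-nonNeg (length (toList C))) ; (suc i) → c≥0 i }) ,
         λ e → begin
           w e
             ≈⟨ solve 2 (λ w x → w := x :+ (w :- x)) ≈.refl (w e) (μ * mult (toList C) e) ⟩
           μ * mult (toList C) e + w′ e
             ≈⟨ +-cong (≈.trans (*-congˡ (mult≈cycleVector C e)) (≈.sym (*-assoc μ l _))) (eq e) ⟩
           μ * l * cycleVector G C e + sum (λ i → c i * p i e) ∎

  cycleVector-sum : ∀ {v} → v ∈ CycleVectors → sumᴱ v ≈ 1#
  cycleVector-sum {v} (C@(x ∷ xs) , simple , eq) = begin
    sumᴱ v
      ≈⟨ sum-cong-≋ (λ i → ≈.trans (eq (edge i)) (scale (edge i))) ⟩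
    sumᴱ (λ e → l ⁻¹ * (mult (toList C) e * 1#))
      ≈⟨ *-distribˡ-sum (l ⁻¹) (λ i → mult (toList C) (edge i) * 1#) ⟨
    l ⁻¹ * sumᴱ (λ e → mult (toList C) e * 1#)
      ≈⟨ *-congˡ (≈.trans (sumᴱ-mult (toList C) (λ _ → 1#)) (sumˡ-1 (toList C))) ⟩
    l ⁻¹ * l
      ≈⟨ ≈.trans (*-comm _ _) (⁻¹-inverseʳ l (pos⇒≉0 (ι-pos (length xs)))) ⟩
    1# ∎
    where
    l = ι (length (toList C))
    scale : ∀ e → cycleVector G C e ≈ l ⁻¹ * (mult (toList C) e * 1#)
    scale e = ≈.trans (*-congʳ (≈.sym (mult≈filter (toList C) e)))
      (solve 2 (λ m i → m :* i := i :* (m :* con (+ 1))) ≈.refl _ _)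

  circulation⇒polytope : ∀ {w} → Circulation w → (∀ e → 0# ≤ w e) → sumᴱ w ≈ 1# → w ∈ CyclePolytope G
  circulation⇒polytope {w} circ w≥0 total≈1 =
    let n , c , p , p∈ , c≥0 , eq = decompose _ (List.map edge (List.allFin a)) ℕₚ.≤-refl w
          (λ e _ → subst (_∈ˡ List.map edge (List.allFin a)) (Inverse.strictlyInverseˡ E↔ e)
            (LMemₚ.∈-map⁺ edge (LMemₚ.∈-allFin (Inverse.from E↔ e)))) circ w≥0
    in n , c , p , p∈ , c≥0 , (begin
      sum c
        ≈⟨ sum-cong-≋ (λ i → ≈.trans (*-congˡ (cycleVector-sum (p∈ i))) (*-identityʳ (c i))) ⟨
      sum (λ i → c i * sumᴱ (p i))
        ≈⟨ sum-cong-≋ (λ i → *-distribˡ-sum (c i) (p i ∘ edge)) ⟩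
      sum (λ i → sum (λ j → c i * p i (edge j)))
        ≈⟨ ∑-comm (λ i j → c i * p i (edge j)) ⟩
      sumᴱ (lin c p)
        ≈⟨ sum-cong-≋ (λ j → eq (edge j)) ⟨
      sumᴱ w
        ≈⟨ total≈1 ⟩
      1# ∎) , eq

-- Approximating the feasible region

module Estimates (em : ExcludedMiddle 0ℓ) (ℝ-field : CompleteOrderedField) where
  open Reals ℝ-field
  open Relation.Binary.Reasoning.Setoid setoid

  -- The non-strict counterpart of `∣_-_∣<_`: it survives scaling by zero and empty sums.
  Near : ℝ → ℝ → ℝ → Set
  Near ε x y = x ≤ y + ε × y ≤ x + ε

  half : ℝ → ℝ
  half x = x * ι 2 ⁻¹

  half+half : ∀ x → half x + half x ≈ x
  half+half x = begin
    x * h + x * h               ≈⟨ solve 2 (λ x h → x :* h :+ x :* h := x :* ((con (+ 1) :+ (con (+ 1) :+ con (+ 0))) :* h)) ≈.refl x h ⟩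
    x * (ι 2 * h)               ≈⟨ *-congˡ (⁻¹-inverseʳ (ι 2) (pos⇒≉0 (ι-pos 1))) ⟩
    x * 1#                      ≈⟨ *-identityʳ x ⟩
    x                           ∎
    where h = ι 2 ⁻¹

  half-pos : ∀ {x} → 0# < x → 0# < half x
  half-pos 0<x = *-pos 0<x (⁻¹-pos (ι-pos 1))

  ≤-by-approximation : ∀ {x y} → (∀ ε → 0# < ε → x ≤ y + ε) → x ≤ y
  ≤-by-approximation {x} {y} approx with total x y
  ... | inj₁ x≤y = x≤y
  ... | inj₂ y≤x with em {x ≈ y}
  ...   | yes x≈y = ≤-reflexive x≈y
  -- With `h` half of `x - y`, adding `x ≤ y + h` to itself gives `x ≤ y`.
  ...   | no x≉y  = certify _ (+-nonNeg bound bound)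
      (≈.trans (solve 3 (λ x y h → y :- x := (y :+ h :- x) :+ (y :+ h :- x) :+ ((x :- y) :- (h :+ h))) ≈.refl x y h)
        (≈.trans (+-congˡ (≈.trans (+-congˡ (-‿cong (half+half (x - y)))) (-‿inverseʳ _))) (+-identityʳ _)))
    where
    h = half (x - y)
    bound : 0# ≤ y + h - x
    bound = y-x≥0 (approx h (half-pos (y-x≥0 y≤x , λ 0≈x-y → x≉y
      (≈.trans (solve 2 (λ x y → x := x :- y :+ y) ≈.refl x y) (≈.trans (+-congʳ (≈.sym 0≈x-y)) (+-identityˡ y))))))

  near⇒≈ : ∀ {x y} → (∀ ε → 0# < ε → Near ε x y) → x ≈ y
  near⇒≈ near = antisym (≤-by-approximation λ ε 0<ε → proj₁ (near ε 0<ε))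
                        (≤-by-approximation λ ε 0<ε → proj₂ (near ε 0<ε))

  near-sym : ∀ {ε x y} → Near ε x y → Near ε y x
  near-sym (a , b) = b , a

  near-trans : ∀ {ε δ x y z} → Near ε x y → Near δ y z → Near (ε + δ) x z
  near-trans {ε} {δ} {x} {y} {z} (a , b) (c , d) =
    certify _ (+-nonNeg (y-x≥0 a) (y-x≥0 c))
      (solve 5 (λ e d x y z → z :+ (e :+ d) :- x := (y :+ e :- x) :+ (z :+ d :- y)) ≈.refl ε δ x y z) ,
    certify _ (+-nonNeg (y-x≥0 b) (y-x≥0 d))
      (solve 5 (λ e d x y z → x :+ (e :+ d) :- z := (x :+ e :- y) :+ (y :+ d :- z)) ≈.refl ε δ x y z)

  near-weaken : ∀ {ε δ x y} → ε ≤ δ → Near ε x y → Near δ x y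
  near-weaken ε≤δ (a , b) = ≤-trans a (+-mono-≤ ≤-refl ε≤δ) , ≤-trans b (+-mono-≤ ≤-refl ε≤δ)

  near-resp : ∀ {ε ε′ x x′ y y′} → ε ≈ ε′ → x ≈ x′ → y ≈ y′ → Near ε x y → Near ε′ x′ y′
  near-resp ε≈ x≈ y≈ (a , b) =
    ≤-respˡ x≈ (≤-respʳ (+-cong y≈ ε≈) a) , ≤-respˡ y≈ (≤-respʳ (+-cong x≈ ε≈) b)

  near-scale : ∀ {ε x y} z → 0# ≤ z → Near ε x y → Near (z * ε) (z * x) (z * y)
  near-scale {ε} {x} {y} z z≥0 (a , b) =
    ≤-respʳ (distribˡ z y ε) (*-monoˡ-≤ z z≥0 a) , ≤-respʳ (distribˡ z x ε) (*-monoˡ-≤ z z≥0 b)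

  near-unscale : ∀ {ε x y} z → 0# < z → Near (z * ε) (z * x) (z * y) → Near ε x y
  near-unscale {ε} {x} {y} z z>0 (a , b) =
    *-cancelˡ-≤ z>0 (≤-respʳ (≈.sym (distribˡ z y ε)) a) , *-cancelˡ-≤ z>0 (≤-respʳ (≈.sym (distribˡ z x ε)) b)

  near-+ : ∀ {ε δ w x y z} → Near ε w x → Near δ y z → Near (ε + δ) (w + y) (x + z)
  near-+ {ε} {δ} {w} {x} {y} {z} (a , b) (c , d) =
    ≤-respʳ (solve 4 (λ p q r s → p :+ q :+ (r :+ s) := p :+ r :+ (q :+ s)) ≈.refl x ε z δ) (+-mono-≤ a c) ,
    ≤-respʳ (solve 4 (λ p q r s → p :+ q :+ (r :+ s) := p :+ r :+ (q :+ s)) ≈.refl w ε y δ) (+-mono-≤ b d)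

  near-sum : ∀ {n} {ε f g : Fin n → ℝ} → (∀ i → Near (ε i) (f i) (g i)) → Near (sum ε) (sum f) (sum g)
  near-sum {zero}  near = ≤-reflexive (≈.sym (+-identityʳ 0#)) , ≤-reflexive (≈.sym (+-identityʳ 0#))
  near-sum {suc n} near = near-+ (near zero) (near-sum (near ∘ suc))

  -- The weight `p - q` may have either sign. Bounding the two parts separately costs `ε` times
  -- `p + q`, at most twice `ε`, and avoids a case distinction.
  near-weigh : ∀ {ε x y} p q → 0# ≤ p → p ≤ 1# → 0# ≤ q → q ≤ 1# → 0# ≤ ε → Near ε x y →
               Near (ε + ε) (x * (p - q)) (y * (p - q))
  near-weigh {ε} {x} {y} p q p≥0 p≤1 q≥0 q≤1 ε≥0 (a , b) =
    certify _ (+-nonNeg (+-nonNeg (*-nonNeg (y-x≥0 a) p≥0) (*-nonNeg (y-x≥0 b) q≥0))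
                        (+-nonNeg (*-nonNeg ε≥0 (y-x≥0 p≤1)) (*-nonNeg ε≥0 (y-x≥0 q≤1))))
      (solve 5 (λ e x y p q → y :* (p :- q) :+ (e :+ e) :- x :* (p :- q)
        := (y :+ e :- x) :* p :+ (x :+ e :- y) :* q :+ (e :* (con (+ 1) :- p) :+ e :* (con (+ 1) :- q))) ≈.refl ε x y p q) ,
    certify _ (+-nonNeg (+-nonNeg (*-nonNeg (y-x≥0 b) p≥0) (*-nonNeg (y-x≥0 a) q≥0))
                        (+-nonNeg (*-nonNeg ε≥0 (y-x≥0 p≤1)) (*-nonNeg ε≥0 (y-x≥0 q≤1))))
      (solve 5 (λ e x y p q → x :* (p :- q) :+ (e :+ e) :- y :* (p :- q)
        := (x :+ e :- y) :* p :+ (y :+ e :- x) :* q :+ (e :* (con (+ 1) :- p) :+ e :* (con (+ 1) :- q))) ≈.refl ε x y p q)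

  sum-const : ∀ n x → sum {n} (λ _ → x) ≈ ι n * x
  sum-const zero    x = ≈.sym (zeroˡ x)
  sum-const (suc n) x = ≈.trans (+-congˡ (sum-const n x))
    (solve 2 (λ i x → x :+ i :* x := (con (+ 1) :+ i) :* x) ≈.refl (ι n) x)

  multiple-exceeds : ∀ x {δ} → 0# < δ → ∃ λ N → x ≤ δ * ι N
  multiple-exceeds x {δ} 0<δ =
    let N , bound = archimedean em (δ ⁻¹ * x)
    in N , ≤-respˡ (begin
         δ * (δ ⁻¹ * x)   ≈⟨ *-assoc δ (δ ⁻¹) x ⟨
         δ * δ ⁻¹ * x     ≈⟨ *-congʳ (⁻¹-inverseʳ δ (pos⇒≉0 0<δ)) ⟩
         1# * x           ≈⟨ *-identityˡ x ⟩
         x                ∎) (*-monoˡ-≤ δ (proj₁ 0<δ) bound)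

  -- The bound `M` makes this a finite search; `q ≤ M` in the result turns `M ∸ q` into a true
  -- subtraction where copies are divided between two blocks.
  floor : ∀ M x → 0# ≤ x → x ≤ ι M → ∃ λ q → q ℕ.≤ M × ι q ≤ x × x ≤ ι (suc q)
  floor zero    x x≥0 x≤M = 0 , ℕ.z≤n , x≥0 , ≤-trans x≤M (ι-nonNeg 1)
  floor (suc M) x x≥0 x≤M with total x (ι M)
  ... | inj₁ x≤M′ = let q , q≤M , bounds = floor M x x≥0 x≤M′ in q , ℕₚ.m≤n⇒m≤1+n q≤M , bounds
  ... | inj₂ M≤x  = M , ℕₚ.n≤1+n M , M≤x , x≤M

  ÷-* : ∀ c n → ι (suc n) * (c ÷ suc n) ≈ ι c
  ÷-* c n = begin
    ι (suc n) * (ι c * ι (suc n) ⁻¹)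
      ≈⟨ solve 3 (λ n c i → n :* (c :* i) := c :* (n :* i)) ≈.refl (ι (suc n)) (ι c) (ι (suc n) ⁻¹) ⟩
    ι c * (ι (suc n) * ι (suc n) ⁻¹)
      ≈⟨ *-congˡ (⁻¹-inverseʳ (ι (suc n)) (pos⇒≉0 (ι-pos n))) ⟩
    ι c * 1#
      ≈⟨ *-identityʳ _ ⟩
    ι c ∎

  ÷-nonNeg : ∀ c n → 0# ≤ c ÷ suc n
  ÷-nonNeg c n = *-nonNeg (ι-nonNeg c) (proj₁ (⁻¹-pos (ι-pos n)))

  ÷-≤1 : ∀ {c n} → c ℕ.≤ suc n → c ÷ suc n ≤ 1#
  ÷-≤1 {c} {n} c≤n = *-cancelˡ-≤ (ι-pos n)
    (≤-respˡ (≈.sym (÷-* c n)) (≤-respʳ (≈.sym (*-identityʳ (ι (suc n)))) (ι-mono c≤n)))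

module Regions (em : ExcludedMiddle 0ℓ) (ℝ-field : CompleteOrderedField) (k : ℕ) where
  open Reals ℝ-field
  open Estimates em ℝ-field
  open Finiteness em
  open Counting em
  open Relation.Binary.Reasoning.Setoid setoid

  Patterns : Set
  Patterns = S (suc k)

  occ : Patterns → 𝒮 → ℕ
  occ π (_ , σ) = c-occ π σ

  occ≤size : ∀ π s → occ π s ℕ.≤ size s
  occ≤size π (n , σ) = subst (ℕ._≤ suc n) (sym (c-occ≡# π σ)) (#≤ (Occ π σ) (suc n))

  -- Cleared of the denominator `size s`: counts, unlike frequencies, add up over blocks.
  Approximates : ℝ → (Patterns → ℝ) → 𝒮 → Set
  Approximates δ v s = ∀ π → Near (ι (size s) * δ) (ι (occ π s)) (ι (size s) * v π)

  -- The feasible region without division and without sequences.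
  Approximable : Pred 𝒮 0ℓ → Pred (ℝ^ Patterns) 0ℓ
  Approximable B v = ∀ δ → 0# < δ → ∀ N → ∃ λ s → s ∈ Av B × N ℕ.≤ size s × Approximates δ v s

  feasible⇒approximable : ∀ {B v} → v ∈ FeasibleRegion (suc k) B → v ∈ Approximable B
  feasible⇒approximable {B} {v} (_ , σ , σ∈ , large , converges) δ 0<δ N = s , σ∈ m ,
    proj₂ (large N) m (ℕₚ.m≤n⊔m _ _) , λ π →
      let close = proj₂ (converges π δ 0<δ) m (ℕₚ.≤-trans (proj₂ uniform π) (ℕₚ.m≤m⊔n _ _))
      in near-resp ≈.refl (÷-* (occ π s) (proj₁ s)) ≈.refl
           (near-scale (ι (size s)) (ι-nonNeg (size s)) (proj₁ (proj₁ close) , proj₁ (proj₂ close)))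
    where
    -- There are finitely many patterns, so one index serves them all.
    uniform = bounded (S-finite (suc k)) (λ π → proj₁ (converges π δ 0<δ))
    m = proj₁ uniform ℕ.⊔ proj₁ (large N)
    s = σ m

  approximate-frequency : ∀ {δ v s} → Approximates δ v s → ∀ π → Near δ (c-occ~ π s) (v π)
  approximate-frequency {s = s} approx π = near-unscale (ι (size s)) (ι-pos (proj₁ s))
    (near-resp ≈.refl (≈.sym (÷-* (occ π s) (proj₁ s))) ≈.refl (approx π))

  approximable⇒unitCube : ∀ {B v} → v ∈ Approximable B → v ∈ UnitCube
  approximable⇒unitCube {v = v} approx π =
    ≤-by-approximation (λ ε 0<ε → let s , _ , _ , near = approx ε 0<ε 0 in
      ≤-trans (÷-nonNeg (occ π s) (proj₁ s)) (proj₁ (approximate-frequency {v = v} {s} near π))) ,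
    ≤-by-approximation (λ ε 0<ε → let s , _ , _ , near = approx ε 0<ε 0 in
      ≤-trans (proj₂ (approximate-frequency {v = v} {s} near π)) (+-mono-≤ (÷-≤1 (occ≤size π s)) ≤-refl))

  approximable⇒feasible : ∀ {B v} → v ∈ Approximable B → v ∈ FeasibleRegion (suc k) B
  approximable⇒feasible {B} {v} approx = approximable⇒unitCube approx , (λ m → proj₁ (choice m)) ,
    (λ m → proj₁ (proj₂ (choice m))) ,
    (λ N → N , λ m N≤m → ℕₚ.≤-trans N≤m (proj₁ (proj₂ (proj₂ (choice m))))) ,
    λ π ε 0<ε → let N , 1≤εN = multiple-exceeds 1# 0<ε in N , λ m N≤m →
      let near = approximate-frequency {v = v} {proj₁ (choice m)} (proj₂ (proj₂ (proj₂ (choice m)))) π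
          below = λ x → (strict {x} (small m 0<ε (≤-trans 1≤εN (*-monoˡ-≤ ε (proj₁ 0<ε) (ι-mono N≤m)))))
      in ≤-<-trans (proj₁ near) (below _) , ≤-<-trans (proj₂ near) (below _)
    where
    choice = λ m → approx (ι (suc m) ⁻¹) (⁻¹-pos (ι-pos m)) m
    strict : ∀ {x y z} → y < z → x + y < x + z
    strict {x} {y} {z} (y≤z , y≉z) = +-mono-≤ ≤-refl y≤z , λ eq → y≉z (begin
      y              ≈⟨ solve 2 (λ x y → y := (x :+ y) :- x) ≈.refl x y ⟩
      x + y - x      ≈⟨ +-congʳ eq ⟩
      x + z - x      ≈⟨ solve 2 (λ x y → (x :+ y) :- x := y) ≈.refl x z ⟩
      z              ∎)
    -- If `ε` were at most 1/(m+1), then (m+1)ε ≤ 1 ≤ mε and `ε` would not be positive. The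
    -- strictness gained here is what `∣_-_∣<_` demands.
    small : ∀ m {ε} → 0# < ε → 1# ≤ ε * ι m → ι (suc m) ⁻¹ < ε
    small m {ε} 0<ε 1≤εm = ≰⇒> λ ε≤i → <⇒≱ 0<ε (certify _
      (+-nonNeg (y-x≥0 1≤εm) (y-x≥0 (*-monoˡ-≤ (ι (suc m)) (ι-nonNeg (suc m)) ε≤i)))
      (≈.sym (≈.trans (+-congˡ (+-congʳ (⁻¹-inverseʳ (ι (suc m)) (pos⇒≉0 (ι-pos m)))))
        (solve 2 (λ e m → (e :* m :- con (+ 1)) :+ (con (+ 1) :- (con (+ 1) :+ m) :* e) := con (+ 0) :- e) ≈.refl ε (ι m)))))

  approximates-perturb : ∀ {δ ε u v} s → (∀ π → Near ε (u π) (v π)) → Approximates δ u s → Approximates (δ + ε) v s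
  approximates-perturb s u≈v approx π = near-resp (≈.sym (distribˡ _ _ _)) ≈.refl ≈.refl
    (near-trans (approx π) (near-scale (ι (size s)) (ι-nonNeg (size s)) (u≈v π)))

  -- `Approximable` takes the place of the usual diagonal sequence: half of `δ` pays for passing to
  -- a nearby feasible point, half for the permutation approximating that point.
  feasible-closed : ∀ B → Closed (FeasibleRegion (suc k) B)
  feasible-closed B v adherent = approximable⇒feasible λ δ 0<δ N →
    let w , w∈ , near = adherent (half δ) (half-pos 0<δ)
        s , s∈ , N≤ , approx = feasible⇒approximable w∈ (half δ) (half-pos 0<δ) N
    in s , s∈ , N≤ , λ π → near-resp (*-congˡ (half+half δ)) ≈.refl ≈.refl
         (approximates-perturb s (λ π → proj₁ (proj₁ (near π)) , proj₁ (proj₂ (near π))) approx π)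

  -- Vectors are functions and are only known to agree pointwise, so membership has to be
  -- transported along `≋` explicitly.
  feasible-resp-≋ : ∀ {B u v} → u ≋ v → u ∈ FeasibleRegion (suc k) B → v ∈ FeasibleRegion (suc k) B
  feasible-resp-≋ u≋v u∈ = approximable⇒feasible λ δ 0<δ N →
    let s , s∈ , N≤ , approx = feasible⇒approximable u∈ δ 0<δ N
    in s , s∈ , N≤ , λ π → near-resp ≈.refl ≈.refl (*-congˡ (u≋v π)) (approx π)

-- Convexity

module Mixtures (em : ExcludedMiddle 0ℓ) (ℝ-field : CompleteOrderedField) (k : ℕ)
                {_∙_ : ∀ {m n} → S m → S n → S (m ℕ.+ n)} (blockSum : BlockSum _∙_) where
  open Reals ℝ-field
  open Estimates em ℝ-field
  open Regions em ℝ-field k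
  open Counting em
  open BlockSums em blockSum hiding (occ)
  open Relation.Binary.Reasoning.Setoid setoid

  _⊞_ : 𝒮 → 𝒮 → 𝒮
  (m , σ) ⊞ (n , τ) = m ℕ.+ suc n , σ ∙ τ

  private
    K = suc k
    κ = ι K

  powers-occ-≥ : ∀ π a b s r → suc a ℕ.* occ π s ℕ.+ suc b ℕ.* occ π r ℕ.≤ occ π (power a s ⊞ power b r)
  powers-occ-≥ π a b s r = ℕₚ.≤-trans (ℕₚ.+-mono-≤ (power-occ-≥ π a s) (power-occ-≥ π b r))
    (c-occ-∙-≥ blockSum π (proj₂ (power a s)) (proj₂ (power b r)))

  powers-occ-≤ : ∀ π a b s r → occ π (power a s ⊞ power b r) ℕ.≤
                 suc a ℕ.* (occ π s ℕ.+ K) ℕ.+ K ℕ.+ suc b ℕ.* (occ π r ℕ.+ K)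
  powers-occ-≤ π a b s r = ℕₚ.≤-trans (c-occ-∙-≤ blockSum π (proj₂ (power a s)) (proj₂ (power b r)))
    (ℕₚ.+-mono-≤ (ℕₚ.+-monoˡ-≤ K (power-occ-≤ π a s)) (power-occ-≤ π b r))

  -- The boundary terms are absorbed by the precision δ because the blocks have length at least κ / δ.
  powers-approximate : ∀ {δ u v} a b s r → 0# < δ → κ ≤ δ * ι (size s) → κ ≤ δ * ι (size r) →
    Approximates δ u s → Approximates δ v r → ∀ π →
    let α = ι (suc a) * ι (size s); β = ι (suc b) * ι (size r) in
    Near ((α + β) * (δ + δ + δ)) (ι (occ π (power a s ⊞ power b r))) (α * u π + β * v π)
  powers-approximate {δ} {u} {v} a b s r 0<δ κ≤δS κ≤δR us vr π =
    ≤-trans (ι-mono (powers-occ-≤ π a b s r)) (≤-respˡ (≈.sym upper≈)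
      (certify _ (+-nonNeg (+-nonNeg (+-nonNeg (*-nonNeg A≥0 (y-x≥0 (proj₁ (us π)))) (*-nonNeg B≥0 (y-x≥0 (proj₁ (vr π)))))
                           (+-nonNeg (*-nonNeg A≥0 (y-x≥0 κ≤δS)) (*-nonNeg B≥0 (y-x≥0 κ≤δR))))
                 (+-nonNeg (+-nonNeg (y-x≥0 κ≤δS) (*-nonNeg (ι-nonNeg a) δS≥0)) (*-nonNeg B≥0 δR≥0)))
        (solve 10 (λ a B c d S R u v δ κ →
          let A = con (+ 1) :+ a in
          A :* S :* u :+ B :* R :* v :+ (A :* S :+ B :* R) :* (δ :+ δ :+ δ)
            :- (A :* (c :+ κ) :+ κ :+ B :* (d :+ κ))
          := (A :* (S :* u :+ S :* δ :- c) :+ B :* (R :* v :+ R :* δ :- d))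
             :+ (A :* (δ :* S :- κ) :+ B :* (δ :* R :- κ))
             :+ ((δ :* S :- κ) :+ a :* (δ :* S) :+ B :* (δ :* R)))
          ≈.refl (ι a) B c d Sz Rz (u π) (v π) δ κ))) ,
    ≤-trans (certify _ (+-nonNeg (+-nonNeg (*-nonNeg A≥0 (y-x≥0 (proj₂ (us π)))) (*-nonNeg B≥0 (y-x≥0 (proj₂ (vr π)))))
                         (+-nonNeg (*-nonNeg A≥0 (+-nonNeg δS≥0 δS≥0)) (*-nonNeg B≥0 (+-nonNeg δR≥0 δR≥0))))
        (solve 9 (λ A B c d S R u v δ →
          A :* c :+ B :* d :+ (A :* S :+ B :* R) :* (δ :+ δ :+ δ) :- (A :* S :* u :+ B :* R :* v)
          := (A :* (c :+ S :* δ :- S :* u) :+ B :* (d :+ R :* δ :- R :* v))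
             :+ (A :* (δ :* S :+ δ :* S) :+ B :* (δ :* R :+ δ :* R)))
          ≈.refl A B c d Sz Rz (u π) (v π) δ))
      (+-mono-≤ (≤-respˡ lower≈ (ι-mono (powers-occ-≥ π a b s r))) ≤-refl)
    where
    A = ι (suc a)
    B = ι (suc b)
    c = ι (occ π s)
    d = ι (occ π r)
    Sz = ι (size s)
    Rz = ι (size r)
    A≥0 = ι-nonNeg (suc a)
    B≥0 = ι-nonNeg (suc b)
    δS≥0 = *-nonNeg (proj₁ 0<δ) (ι-nonNeg (size s))
    δR≥0 = *-nonNeg (proj₁ 0<δ) (ι-nonNeg (size r))
    lower≈ : ι (suc a ℕ.* occ π s ℕ.+ suc b ℕ.* occ π r) ≈ A * c + B * d
    lower≈ = ≈.trans (ι-+ (suc a ℕ.* occ π s) _) (+-cong (ι-* (suc a) (occ π s)) (ι-* (suc b) (occ π r)))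
    block≈ : ∀ x y → ι (suc x ℕ.* (y ℕ.+ K)) ≈ ι (suc x) * (ι y + κ)
    block≈ x y = ≈.trans (ι-* (suc x) (y ℕ.+ K)) (*-congˡ (ι-+ y K))
    upper≈ : ι (suc a ℕ.* (occ π s ℕ.+ K) ℕ.+ K ℕ.+ suc b ℕ.* (occ π r ℕ.+ K)) ≈ A * (c + κ) + κ + B * (d + κ)
    upper≈ = ≈.trans (ι-+ (suc a ℕ.* (occ π s ℕ.+ K) ℕ.+ K) _)
      (+-cong (≈.trans (ι-+ (suc a ℕ.* (occ π s ℕ.+ K)) K) (+-congʳ (block≈ a (occ π s)))) (block≈ b (occ π r)))

  -- For permutations of lengths S and R, taken R (m - q) and S q times respectively; then g = S R.
  mixture-weights : ∀ {t u v δ g q m} → 0# ≤ g → 0# ≤ u → u ≤ 1# → 0# ≤ v → v ≤ 1# →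
    Near (1# + 1#) q (t * m) → 1# + 1# + (1# + 1#) ≤ δ * m →
    Near (g * m * δ) (g * (m - q) * u + g * q * v) (g * m * ((1# - t) * u + t * v))
  mixture-weights {t} {u} {v} {δ} {g} {q} {m} g≥0 u≥0 u≤1 v≥0 v≤1 (a , b) 4≤δm =
    certify _ (*-nonNeg g≥0 (+-nonNeg (+-nonNeg (+-nonNeg (*-nonNeg (y-x≥0 a) v≥0) (*-nonNeg (y-x≥0 b) u≥0)) rest) (y-x≥0 4≤δm)))
      (solve 7 (λ t u v δ g q m → let two = con (+ 1) :+ con (+ 1) in
        g :* m :* ((con (+ 1) :- t) :* u :+ t :* v) :+ g :* m :* δ :- (g :* (m :- q) :* u :+ g :* q :* v)
        := g :* ((t :* m :+ two :- q) :* v :+ (q :+ two :- t :* m) :* u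
             :+ (two :* (con (+ 1) :- u) :+ two :* (con (+ 1) :- v)) :+ (δ :* m :- (two :+ two))))
        ≈.refl t u v δ g q m) ,
    certify _ (*-nonNeg g≥0 (+-nonNeg (+-nonNeg (+-nonNeg (*-nonNeg (y-x≥0 b) v≥0) (*-nonNeg (y-x≥0 a) u≥0)) rest) (y-x≥0 4≤δm)))
      (solve 7 (λ t u v δ g q m → let two = con (+ 1) :+ con (+ 1) in
        g :* (m :- q) :* u :+ g :* q :* v :+ g :* m :* δ :- g :* m :* ((con (+ 1) :- t) :* u :+ t :* v)
        := g :* ((q :+ two :- t :* m) :* v :+ (t :* m :+ two :- q) :* u
             :+ (two :* (con (+ 1) :- u) :+ two :* (con (+ 1) :- v)) :+ (δ :* m :- (two :+ two))))
        ≈.refl t u v δ g q m)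
    where
    two≥0 = +-nonNeg 0≤1 0≤1
    rest = +-nonNeg (*-nonNeg two≥0 (y-x≥0 u≤1)) (*-nonNeg two≥0 (y-x≥0 v≤1))

  feasible-convex : ∀ {B} → Av B Closed-under _∙_ → Convex (FeasibleRegion (suc k) B)
  feasible-convex {B} closed {u} {v} u∈ v∈ t 0≤t t≤1 = approximable⇒feasible mix
    where
    mix : (λ π → (1# - t) * u π + t * v π) ∈ Approximable B
    mix ε 0<ε N = s ⊞ r , closed {τ = proj₂ s} {proj₂ r} s∈ r∈ , N≤ , near
      where
      -- Of the four quarters of `ε`, three go to `powers-approximate` and one to the rounding of
      -- the weights.
      δ = half (half ε)
      0<δ : 0# < δ
      0<δ = half-pos (half-pos 0<ε)
      blocks = multiple-exceeds κ 0<δ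
      -- The constant is the rounding error allowed in `mixture-weights`: it has to be at most
      -- `δ * m`.
      copies = multiple-exceeds (1# + 1# + (1# + 1#)) 0<δ
      M = proj₁ copies
      goodᵘ = feasible⇒approximable u∈ δ 0<δ (proj₁ blocks ℕ.⊔ N)
      goodᵛ = feasible⇒approximable v∈ δ 0<δ (proj₁ blocks ℕ.⊔ N)
      s₀ = proj₁ goodᵘ
      r₀ = proj₁ goodᵛ
      long : ∀ {n} → proj₁ blocks ℕ.⊔ N ℕ.≤ n → κ ≤ δ * ι n
      long le = ≤-trans (proj₂ blocks) (*-monoˡ-≤ δ (proj₁ 0<δ) (ι-mono (ℕₚ.≤-trans (ℕₚ.m≤m⊔n _ N) le)))
      split = floor M (t * ι M) (*-nonNeg 0≤t (ι-nonNeg M))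
        (≤-respˡ (*-comm _ _) (≤-respʳ (*-identityʳ _) (*-monoˡ-≤ (ι M) (ι-nonNeg M) t≤1)))
      q = proj₁ split
      p = M ℕ.∸ q
      -- Chosen so that `suc a` is `size r₀ * suc p` and `suc b` is `size s₀ * suc q`. Each block is
      -- repeated a multiple of the other's length, so the total lengths are in the ratio `suc p` to
      -- `suc q`.
      a = p ℕ.+ proj₁ r₀ ℕ.* suc p
      b = q ℕ.+ proj₁ s₀ ℕ.* suc q
      s = power a s₀
      r = power b r₀
      s∈ = power-Av (λ {m} {n} {τ} {σ} → closed {m} {n} {τ} {σ}) a s₀ (proj₁ (proj₂ goodᵘ))
      r∈ = power-Av (λ {m} {n} {τ} {σ} → closed {m} {n} {τ} {σ}) b r₀ (proj₁ (proj₂ goodᵛ))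
      size≡ : size (s ⊞ r) ≡ suc a ℕ.* size s₀ ℕ.+ suc b ℕ.* size r₀
      size≡ = cong₂ ℕ._+_ (power-size a s₀) (power-size b r₀)
      N≤ : N ℕ.≤ size (s ⊞ r)
      N≤ = subst (N ℕ.≤_) (sym size≡) (ℕₚ.≤-trans (ℕₚ.m≤n⊔m (proj₁ blocks) N) (ℕₚ.≤-trans
        (proj₁ (proj₂ (proj₂ goodᵘ))) (ℕₚ.≤-trans (ℕₚ.m≤m+n (size s₀) _) (ℕₚ.m≤m+n _ _))))
      S₀ = ι (size s₀)
      R₀ = ι (size r₀)
      g = S₀ * R₀
      Q = ι (suc q)
      -- `p` and `q` add up to `M`, but the powers use `suc p` and `suc q`.
      m = ι (suc (suc M))
      P≈ : ι (suc p) ≈ m - Q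
      P≈ = begin
        1# + ι p
          ≈⟨ solve 2 (λ p q → con (+ 1) :+ p := (con (+ 1) :+ (con (+ 1) :+ (q :+ p))) :- (con (+ 1) :+ q)) ≈.refl (ι p) (ι q) ⟩
        1# + (1# + (ι q + ι p)) - Q
          ≈⟨ +-congʳ (+-congˡ (+-congˡ (≈.trans (≈.sym (ι-+ q p)) (≈.reflexive (cong ι (ℕₚ.m+[n∸m]≡n (proj₁ (proj₂ split)))))))) ⟩
        m - Q ∎
      α = ι (suc a) * S₀
      β = ι (suc b) * R₀
      α≈ : α ≈ g * (m - Q)
      α≈ = ≈.trans (*-congʳ (≈.trans (ι-* (size r₀) (suc p)) (*-congˡ P≈)))
        (solve 3 (λ s r x → r :* x :* s := s :* r :* x) ≈.refl S₀ R₀ (m - Q))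
      β≈ : β ≈ g * Q
      β≈ = ≈.trans (*-congʳ (ι-* (size s₀) (suc q)))
        (solve 3 (λ s r x → s :* x :* r := s :* r :* x) ≈.refl S₀ R₀ Q)
      α+β≈ : α + β ≈ g * m
      α+β≈ = ≈.trans (+-cong α≈ β≈) (solve 3 (λ g m q → g :* (m :- q) :+ g :* q := g :* m) ≈.refl g m Q)
      size≈ : ι (size (s ⊞ r)) ≈ g * m
      size≈ = ≈.trans (≈.reflexive (cong ι size≡)) (≈.trans (ι-+ (suc a ℕ.* size s₀) _)
        (≈.trans (+-cong (ι-* (suc a) (size s₀)) (ι-* (suc b) (size r₀))) α+β≈))
      Q-near : Near (1# + 1#) Q (t * m)
      Q-near =
        certify _ (+-nonNeg (+-nonNeg (y-x≥0 (proj₁ (proj₂ (proj₂ split)))) 0≤1) (+-nonNeg 0≤t 0≤t))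
          (solve 3 (λ t M q → t :* (con (+ 1) :+ (con (+ 1) :+ M)) :+ (con (+ 1) :+ con (+ 1)) :- (con (+ 1) :+ q)
            := (t :* M :- q) :+ con (+ 1) :+ (t :+ t)) ≈.refl t (ι M) (ι q)) ,
        certify _ (+-nonNeg (y-x≥0 (proj₂ (proj₂ (proj₂ split)))) (+-nonNeg (y-x≥0 t≤1) (y-x≥0 t≤1)))
          (solve 3 (λ t M q → (con (+ 1) :+ q) :+ (con (+ 1) :+ con (+ 1)) :- t :* (con (+ 1) :+ (con (+ 1) :+ M))
            := (con (+ 1) :+ q :- t :* M) :+ (con (+ 1) :- t :+ (con (+ 1) :- t))) ≈.refl t (ι M) (ι q))
      4≤δm : 1# + 1# + (1# + 1#) ≤ δ * m
      4≤δm = ≤-trans (proj₂ copies) (*-monoˡ-≤ δ (proj₁ 0<δ) (ι-mono (ℕₚ.m≤n+m M 2)))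
      near : Approximates ε (λ π → (1# - t) * u π + t * v π) (s ⊞ r)
      near π = near-resp ε≈ ≈.refl (*-congʳ (≈.sym size≈))
        (near-trans
          (near-resp (*-congʳ α+β≈) ≈.refl (+-cong (*-congʳ α≈) (*-congʳ β≈))
            (powers-approximate {δ} {u} {v} a b s₀ r₀ 0<δ
              (long (proj₁ (proj₂ (proj₂ goodᵘ)))) (long (proj₁ (proj₂ (proj₂ goodᵛ))))
              (proj₂ (proj₂ (proj₂ goodᵘ))) (proj₂ (proj₂ (proj₂ goodᵛ))) π))
          (mixture-weights (*-nonNeg (ι-nonNeg (size s₀)) (ι-nonNeg (size r₀)))
            (proj₁ (proj₁ u∈ π)) (proj₂ (proj₁ u∈ π)) (proj₁ (proj₁ v∈ π)) (proj₂ (proj₁ v∈ π)) Q-near 4≤δm))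
        where
        ε≈ : g * m * (δ + δ + δ) + g * m * δ ≈ ι (size (s ⊞ r)) * ε
        ε≈ = begin
          g * m * (δ + δ + δ) + g * m * δ
            ≈⟨ solve 2 (λ n d → n :* (d :+ d :+ d) :+ n :* d := n :* ((d :+ d) :+ (d :+ d))) ≈.refl (g * m) δ ⟩
          g * m * ((δ + δ) + (δ + δ))
            ≈⟨ *-cong (≈.sym size≈) (≈.trans (+-cong (half+half (half ε)) (half+half (half ε))) (half+half ε)) ⟩
          ι (size (s ⊞ r)) * ε ∎

-- The overlap polytope is feasible

linked⇒path : ∀ (G : Graph) x xs → Linked (λ e f → Graph.ar G e ≡ Graph.st G f) (x ∷ xs) →
              Path G (Graph.st G x) (x ∷ xs) (Graph.ar G (last (x ∷ xs)))
linked⇒path G x []       _             = step x refl stay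
linked⇒path G x (y ∷ ys) (eq ∷ linked) = step x refl
  (subst₂ (λ u w → Path G u (y ∷ ys) (Graph.ar G w)) (sym eq) (sym (last-∷ x y ys)) (linked⇒path G y ys linked))

occurrences≤length : ∀ {k} (π : S k) xs → occurrences π xs ℕ.≤ length xs
occurrences≤length π = Listₚ.length-filter (π ≟ˢ_)

repeated : ∀ {A : Set} → ℕ → List A → List A
repeated n xs = List.concat (List.replicate n xs)

occurrences-repeated : ∀ {A : Set} {k} (π : S k) (f : A → S k) n xs →
                       occurrences π (map f (repeated n xs)) ≡ n ℕ.* occurrences π (map f xs)
occurrences-repeated π f zero    xs = refl
occurrences-repeated π f (suc n) xs = trans (cong (occurrences π) (Listₚ.map-++ f xs (repeated n xs)))
  (trans (occurrences-++ π (map f xs) _) (cong (occurrences π (map f xs) ℕ.+_) (occurrences-repeated π f n xs)))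

length-repeated : ∀ {A : Set} n (xs : List A) → length (repeated n xs) ≡ n ℕ.* length xs
length-repeated zero    xs = refl
length-repeated (suc n) xs = trans (Listₚ.length-++ xs) (cong (length xs ℕ.+_) (length-repeated n xs))

module Hulls (em : ExcludedMiddle 0ℓ) (ℝ-field : CompleteOrderedField) {A : Set} where
  open Reals ℝ-field
  open LinearAlgebra em ℝ-field
  open Relation.Binary.Reasoning.Setoid setoid

  -- Allowing any positive total, and leaving it multiplied out in the conclusion, makes the tail of
  -- the combination an instance of the same statement. A tail of weight zero contributes nothing
  -- and the first point is returned.
  convex-combination : ∀ {Y : Pred (ℝ^ A) 0ℓ} → Convex Y → ∀ n (c : Fin n → ℝ) (p : Fin n → ℝ^ A) →
    (∀ i → p i ∈ Y) → (∀ i → 0# ≤ c i) → 0# < sum c → ∃ λ y → y ∈ Y × ∀ a → sum c * y a ≈ lin c p a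
  convex-combination convex zero c p p∈ c≥0 0<0 = contradiction ≈.refl (proj₂ 0<0)
  convex-combination convex (suc n) c p p∈ c≥0 0<s with em {sum (c ∘ suc) ≈ 0#}
  ... | yes s′≈0 = p zero , p∈ zero , λ a → begin
    (c zero + sum (c ∘ suc)) * p zero a
      ≈⟨ *-congʳ (≈.trans (+-congˡ s′≈0) (+-identityʳ _)) ⟩
    c zero * p zero a
      ≈⟨ +-identityʳ _ ⟨
    c zero * p zero a + 0#
      ≈⟨ +-congˡ (sum-zero {f = λ i → c (suc i) * p (suc i) a} (λ i → ≈.trans (*-congʳ (c≈0 i)) (zeroˡ _))) ⟨
    lin c p a ∎
    where
    c≈0 : ∀ i → c (suc i) ≈ 0#
    c≈0 i = antisym (≤-respʳ s′≈0 (term≤sum (c≥0 ∘ suc) i)) (c≥0 (suc i))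
  ... | no s′≉0 = (λ a → (1# - t) * p zero a + t * y′ a) , convex {p zero} {y′} (p∈ zero) y′∈ t 0≤t t≤1 , λ a → begin
    s * ((1# - t) * p zero a + t * y′ a)
      ≈⟨ solve 4 (λ s t x y → s :* ((con (+ 1) :- t) :* x :+ t :* y) := (s :- s :* t) :* x :+ s :* t :* y) ≈.refl s t (p zero a) (y′ a) ⟩
    (s - s * t) * p zero a + s * t * y′ a
      ≈⟨ +-cong (*-congʳ (≈.trans (+-congˡ (-‿cong st≈s′)) (solve 2 (λ c s → c :+ s :- s := c) ≈.refl (c zero) s′))) (*-congʳ st≈s′) ⟩
    c zero * p zero a + s′ * y′ a
      ≈⟨ +-congˡ (y′-eq a) ⟩
    lin c p a ∎
    where
    s = sum c
    s′ = sum (c ∘ suc)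
    0≤s′ : 0# ≤ s′
    0≤s′ = sum-nonNeg (c≥0 ∘ suc)
    rec = convex-combination (λ {u} {v} → convex {u} {v}) n (c ∘ suc) (p ∘ suc) (p∈ ∘ suc) (c≥0 ∘ suc) (0≤s′ , s′≉0 ∘ ≈.sym)
    y′ = proj₁ rec
    y′∈ = proj₁ (proj₂ rec)
    y′-eq = proj₂ (proj₂ rec)
    t = s ⁻¹ * s′
    st≈s′ : s * t ≈ s′
    st≈s′ = ≈.trans (≈.sym (*-assoc s (s ⁻¹) s′)) (≈.trans (*-congʳ (⁻¹-inverseʳ s (pos⇒≉0 0<s))) (*-identityˡ s′))
    0≤t : 0# ≤ t
    0≤t = *-nonNeg (proj₁ (⁻¹-pos 0<s)) 0≤s′
    t≤1 : t ≤ 1#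
    t≤1 = *-cancelˡ-≤ 0<s (≤-respˡ (≈.sym st≈s′) (≤-respʳ (≈.sym (*-identityʳ s))
      (≤-respˡ (+-identityˡ s′) (+-mono-≤ (c≥0 zero) ≤-refl))))

module Inclusions (em : ExcludedMiddle 0ℓ) (ℝ-field : CompleteOrderedField) (k : ℕ) (B : Pred 𝒮 0ℓ) where
  open Reals ℝ-field
  open LinearAlgebra em ℝ-field
  open Estimates em ℝ-field
  open Regions em ℝ-field k
  open Finiteness em
  open Realisation em k B
  open Hulls em ℝ-field
  open Relation.Binary.Reasoning.Setoid setoid

  G : Graph
  G = OverlapGraph (suc k) B
  open Graph G

  ∣E∣ ∣V∣ : ℕ
  ∣E∣ = proj₁ (Avₙ-finite B (suc k))
  ∣V∣ = proj₁ (Avₙ-finite B k)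

  E↔ : E HasCardinality ∣E∣
  E↔ = proj₂ (Avₙ-finite B (suc k))

  V↔ : V HasCardinality ∣V∣
  V↔ = proj₂ (Avₙ-finite B k)

  -- The cycle vector extended by zero: a pattern outside Avₖ(B) labels no edge and therefore occurs
  -- in no cycle.
  extendedCycleVector : List⁺ E → ℝ^ Patterns
  extendedCycleVector C π = occurrences π (map value (toList C)) ÷ length (toList C)

  -- Realising a walk controls only windows of length `suc k`; the permutation may well contain
  -- elements of `B` elsewhere, hence the region for `∅`.
  cycle-feasible : ∀ {C} → IsSimpleCycle G C → extendedCycleVector C ∈ FeasibleRegion (suc k) ∅
  cycle-feasible {C@(x ∷ xs)} simple = approximable⇒feasible λ δ 0<δ N → approximate δ 0<δ N
    where
    open IsSimpleCycle simple
    loop : Path G (st x) (x ∷ xs) (st x)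
    loop = subst (Path G (st x) (x ∷ xs)) (sym closed) (linked⇒path G x xs walk)
    approximate : extendedCycleVector C ∈ Approximable ∅
    approximate δ 0<δ N = s , (λ _ ()) , ℕₚ.≤-trans (ℕₚ.m≤n+m N N′) n≤size , near
      where
      -- The realising permutation has `k` entries more than the walk has edges; enough rounds make
      -- these `k` negligible against its size.
      rounds = multiple-exceeds (ι k) 0<δ
      N′ = proj₁ rounds
      n = N′ ℕ.+ N
      realised = realise (path-repeat loop (suc n))
      es = repeated (suc n) (x ∷ xs)
      s : 𝒮
      s = length (xs ++ repeated n (x ∷ xs)) ℕ.+ k , proj₁ realised
      length≡ : length es ≡ suc n ℕ.* suc (length xs)
      length≡ = length-repeated (suc n) (x ∷ xs)
      n≤size : n ℕ.≤ size s
      n≤size = ℕₚ.≤-trans (ℕₚ.n≤1+n n) (ℕₚ.≤-trans (ℕₚ.m≤m*n (suc n) (suc (length xs)))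
        (ℕₚ.≤-trans (ℕₚ.≤-reflexive (sym length≡)) (ℕₚ.m≤m+n _ k)))
      near : Approximates δ (extendedCycleVector C) s
      near π =
        certify _ (+-nonNeg (*-nonNeg (ι-nonNeg k) f≥0) (*-nonNeg (ι-nonNeg (size s)) (proj₁ 0<δ)))
          (≈.trans (+-congʳ (+-congʳ vf≈)) (≈.trans (+-congˡ (-‿cong occ≈))
            (solve 3 (λ c e d → c :+ e :+ d :- c := e :+ d) ≈.refl _ _ _))) ,
        certify _ (+-nonNeg (*-nonNeg (ι-nonNeg k) (y-x≥0 f≤1)) (y-x≥0 k≤sizeδ))
          (≈.trans (+-cong (+-congʳ occ≈) (-‿cong vf≈))
            (solve 4 (λ c k f d → c :+ d :- (c :+ k :* f) := k :* (con (+ 1) :- f) :+ (d :- k)) ≈.refl _ _ _ _))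
        where
        o = occurrences π (map value (x ∷ xs))
        f = extendedCycleVector C π
        c = ι (suc n) * ι o
        f≥0 : 0# ≤ f
        f≥0 = ÷-nonNeg o (length xs)
        f≤1 : f ≤ 1#
        f≤1 = ÷-≤1 (ℕₚ.≤-trans (occurrences≤length π (map value (x ∷ xs))) (ℕₚ.≤-reflexive (Listₚ.length-map value (x ∷ xs))))
        occ≈ : ι (occ π s) ≈ c
        occ≈ = ≈.trans (≈.reflexive (cong ι (trans (proj₂ (proj₂ realised) π) (occurrences-repeated π value (suc n) (x ∷ xs)))))
          (ι-* (suc n) o)
        vf≈ : ι (size s) * f ≈ c + ι k * f
        vf≈ = begin
          ι (length es ℕ.+ k) * f
            ≈⟨ *-congʳ (≈.trans (ι-+ (length es) k) (+-congʳ (≈.trans (≈.reflexive (cong ι length≡)) (ι-* (suc n) (suc (length xs)))))) ⟩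
          (ι (suc n) * ι (suc (length xs)) + ι k) * f
            ≈⟨ solve 4 (λ n l k f → (n :* l :+ k) :* f := n :* (l :* f) :+ k :* f) ≈.refl _ _ _ _ ⟩
          ι (suc n) * (ι (suc (length xs)) * f) + ι k * f
            ≈⟨ +-congʳ (*-congˡ (÷-* o (length xs))) ⟩
          c + ι k * f ∎
        k≤sizeδ : ι k ≤ ι (size s) * δ
        k≤sizeδ = ≤-respʳ (*-comm _ _) (≤-trans (proj₂ rounds)
          (*-monoˡ-≤ δ (proj₁ 0<δ) (ι-mono (ℕₚ.≤-trans (ℕₚ.m≤m+n N′ N) n≤size))))

  filter-occurrences : ∀ e xs → length (filter (e ≟ᴱ_) xs) ≡ occurrences (value e) (map value xs)
  filter-occurrences e []       = refl
  filter-occurrences e (x ∷ xs) = compare (e ≟ᴱ x)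
    where
    compare : Dec (e ≡ x) → length (filter (e ≟ᴱ_) (x ∷ xs)) ≡ occurrences (value e) (value x ∷ map value xs)
    compare (yes e≡x) = trans (cong length (Listₚ.filter-accept (e ≟ᴱ_) e≡x))
      (trans (cong suc (filter-occurrences e xs)) (sym (cong length (Listₚ.filter-accept (value e ≟ˢ_) (cong value e≡x)))))
    compare (no e≢x) = trans (cong length (Listₚ.filter-reject (e ≟ᴱ_) e≢x))
      (trans (filter-occurrences e xs) (sym (cong length (Listₚ.filter-reject (value e ≟ˢ_) (e≢x ∘ value-injective)))))

  -- Excluded middle acts as the decision procedure that makes the irrelevant avoidance proof
  -- relevant again.
  avoids : ∀ (e : E) → Avoids B (value e)
  avoids (_ , [ av ]) = recompute em av

  occurrences-∉Av : ∀ {π} → ¬ Avoids B π → ∀ (xs : List E) → occurrences π (map value xs) ≡ 0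
  occurrences-∉Av ¬av []       = refl
  occurrences-∉Av {π} ¬av (x ∷ xs) = trans
    (cong length (Listₚ.filter-reject (π ≟ˢ_) {xs = map value xs} (λ { refl → ¬av (avoids x) })))
    (occurrences-∉Av ¬av xs)

  overlap⊆feasible : OverlapPolytope (suc k) B ⊆ FeasibleRegion (suc k) ∅
  overlap⊆feasible {v} (vanishes , n , c , p , p∈ , c≥0 , total≈1 , eq) = feasible-resp-≋ y≋v y∈
    where
    q : Fin n → ℝ^ Patterns
    q i = extendedCycleVector (proj₁ (p∈ i))
    -- A combination of cycles need not come from one closed walk, so convexity of P_k is invoked;
    -- the class of all permutations is trivially closed under `⊕`.
    combination = convex-combination {Y = FeasibleRegion (suc k) ∅}
      (λ {u} {v} → Mixtures.feasible-convex em ℝ-field k ⊕-blockSum {∅} (λ _ _ _ ()) {u} {v}) n c q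
      (λ i → cycle-feasible (proj₁ (proj₂ (p∈ i)))) c≥0 (≤-respʳ (≈.sym total≈1) 0≤1 , λ 0≈total → 0≉1 (≈.trans 0≈total total≈1))
    y = proj₁ combination
    y∈ = proj₁ (proj₂ combination)
    term≈ : ∀ e i → c i * p i e ≈ c i * q i (value e)
    term≈ e i = *-congˡ (≈.trans (proj₂ (proj₂ (p∈ i)) e)
      (≈.reflexive (cong (_÷ length (toList (proj₁ (p∈ i)))) (filter-occurrences e (toList (proj₁ (p∈ i)))))))
    term≈0 : ∀ {π} → ¬ Avoids B π → ∀ i → c i * q i π ≈ 0#
    term≈0 {π} ¬av i = ≈.trans (*-congˡ (≈.trans (*-congʳ {y = 0#}
      (≈.reflexive (cong ι (occurrences-∉Av {π} ¬av (toList (proj₁ (p∈ i))))))) (zeroˡ _))) (zeroʳ (c i))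
    agree : ∀ π → Dec (Avoids B π) → lin c q π ≈ v π
    agree π (yes av) = ≈.sym (≈.trans (eq (π , [ av ])) (sum-cong-≋ {y = λ i → c i * q i π} (term≈ (π , [ av ]))))
    agree π (no ¬av) = ≈.trans (sum-zero {f = λ i → c i * q i π} (term≈0 {π} ¬av)) (≈.sym (vanishes π ¬av))
    y≋v : y ≋ v
    y≋v π = ≈.trans (≈.sym (≈.trans (*-congʳ total≈1) (*-identityˡ _))) (≈.trans (proj₂ (proj₂ combination) π) (agree π em))

-- Feasible points are circulations

module WindowWalk (em : ExcludedMiddle 0ℓ) (ℝ-field : CompleteOrderedField) (k : ℕ) (B : Pred 𝒮 0ℓ) where
  open Reals ℝ-field
  open LinearAlgebra em ℝ-field
  open Estimates em ℝ-field
  open Regions em ℝ-field k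
  open Counting em
  open Inclusions em ℝ-field k B
  open Graph G
  open Flows em ℝ-field G E↔ V↔
  open Relation.Binary.Reasoning.Setoid setoid

  windowEdge : ∀ {n} (σ : S n) → .(Avoids B σ) → Fin (n ℕ.∸ k) → E
  windowEdge {n} σ av i = pat (window {suc k} {n} i) σ , [ avoids-pat B (window {suc k} {n} i) σ av ]

  Consecutive : ∀ {n} → (Fin n → E) → Set
  Consecutive W = ∀ i j → toℕ j ≡ suc (toℕ i) → ar (W i) ≡ st (W j)

  windowEdge-consecutive : ∀ {n} (σ : S n) .(av : Avoids B σ) → Consecutive (windowEdge σ av)
  windowEdge-consecutive {n} σ av i j j≡1+i = value-injective
    (trans (sym (pat-∘ (window {suc k} {n} i) (ending (suc k)) σ))
      (trans (pat-ext (window i ∘ᵖ ending (suc k)) (window j ∘ᵖ beginning (suc k)) σ λ a → Finₚ.toℕ-injective (at≡ a))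
        (pat-∘ (window {suc k} {n} j) (beginning (suc k)) σ)))
    where
    at≡ : ∀ a → toℕ (at (window {suc k} {n} i) (suc a)) ≡ toℕ (at (window {suc k} {n} j) (Fin.inject₁ a))
    at≡ a = trans (toℕ-at-window {suc k} {n} i (suc a)) (trans (ℕₚ.+-suc (toℕ i) (toℕ a))
      (sym (trans (toℕ-at-window {suc k} {n} j (Fin.inject₁ a)) (cong₂ ℕ._+_ j≡1+i (Finₚ.toℕ-inject₁ a)))))

  count≈sum : ∀ {A : Set} {P : Pred A 0ℓ} (P? : Decidable P) {n} (f : Fin n → A) →
              ι (count P? (tabulate f)) ≈ sum (λ i → ind (P (f i)))
  count≈sum P? {zero}  f = ≈.refl
  count≈sum P? {suc n} f with P? (f zero)
  ... | yes p = +-cong (≈.sym (ind-true p)) (count≈sum P? (f ∘ suc))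
  ... | no ¬p = ≈.trans (count≈sum P? (f ∘ suc)) (≈.trans (≈.sym (+-identityˡ _)) (+-congʳ (≈.sym (ind-false ¬p))))

  c-occ≈sum : ∀ {n} (σ : S n) (av : Avoids B σ) (e : E) →
              ι (c-occ (value e) σ) ≈ sum (λ i → ind (windowEdge σ av i ≡ e))
  c-occ≈sum {n} σ av e = ≈.trans (count≈sum (λ i → pat (window {suc k} {n} i) σ ≟ˢ value e) id)
    (sum-cong-≋ {y = λ i → ind (windowEdge σ av i ≡ e)} λ i → ind-cong (mk⇔ value-injective (cong value)))

  -- Exchanging the sums over edges and windows turns a linear functional of the counts into a sum
  -- along the window walk, which telescopes when `g` is a `difference`.
  c-occ-functional : ∀ {n} (σ : S n) (av : Avoids B σ) (g : E → ℝ) →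
    sumᴱ (λ e → ι (c-occ (value e) σ) * g e) ≈ sum (λ i → g (windowEdge σ av i))
  c-occ-functional σ av g = begin
    sum (λ j → ι (c-occ (value (edge j)) σ) * g (edge j))
      ≈⟨ sum-cong-≋ (λ j → ≈.trans (*-congʳ (c-occ≈sum σ av (edge j)))
           (*-distribʳ-sum (g (edge j)) (λ i → ind (windowEdge σ av i ≡ edge j)))) ⟩
    sum (λ j → sum (λ i → ind (windowEdge σ av i ≡ edge j) * g (edge j)))
      ≈⟨ ∑-comm (λ j i → ind (windowEdge σ av i ≡ edge j) * g (edge j)) ⟩
    sum (λ i → sumᴱ (λ e → ind (windowEdge σ av i ≡ e) * g e))
      ≈⟨ sum-cong-≋ (λ i → sumᴱ-ind (windowEdge σ av i) g) ⟩
    sum (λ i → g (windowEdge σ av i)) ∎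
    where edge = Inverse.to E↔

  difference : (V → ℝ) → E → ℝ
  difference φ e = φ (ar e) - φ (st e)

  -- The final vertex stays existential because `telescope-bounded` uses nothing about it beyond the
  -- bounds on `φ`.
  telescope : ∀ (φ : V → ℝ) n (W : Fin (suc n) → E) → Consecutive W →
              ∃ λ x → sum (λ i → difference φ (W i)) ≈ φ x - φ (st (W zero))
  telescope φ zero    W consecutive = ar (W zero) , +-identityʳ _
  telescope φ (suc n) W consecutive =
    let x , eq = telescope φ n (W ∘ suc) (λ i j j≡1+i → consecutive (suc i) (suc j) (cong suc j≡1+i))
    in x , (begin
      φ (ar (W zero)) - φ (st (W zero)) + sum (λ i → difference φ (W (suc i)))
        ≈⟨ +-cong (+-congʳ (≈.reflexive (cong φ (consecutive zero (suc zero) refl)))) eq ⟩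
      φ (st (W (suc zero))) - φ (st (W zero)) + (φ x - φ (st (W (suc zero))))
        ≈⟨ solve 3 (λ p q r → p :- q :+ (r :- p) := r :- q) ≈.refl _ _ _ ⟩
      φ x - φ (st (W zero)) ∎)

  telescope-bounded : ∀ (φ : V → ℝ) → (∀ x → 0# ≤ φ x) → (∀ x → φ x ≤ 1#) → ∀ {n} (W : Fin n → E) → Consecutive W →
                      Near 1# (sum (λ i → difference φ (W i))) 0#
  telescope-bounded φ φ≥0 φ≤1 {zero}  W consecutive = 0≤0+1 , 0≤0+1
    where 0≤0+1 = ≤-respʳ (≈.sym (+-identityˡ 1#)) 0≤1
  telescope-bounded φ φ≥0 φ≤1 {suc n} W consecutive =
    let x , eq = telescope φ n W consecutive
        y = st (W zero)
    in near-resp ≈.refl (≈.sym eq) ≈.refl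
        ( certify _ (+-nonNeg (y-x≥0 (φ≤1 x)) (φ≥0 y))
            (solve 2 (λ p q → con (+ 0) :+ con (+ 1) :- (p :- q) := (con (+ 1) :- p) :+ q) ≈.refl (φ x) (φ y))
        , certify _ (+-nonNeg (y-x≥0 (φ≤1 y)) (φ≥0 x))
            (solve 2 (λ p q → p :- q :+ con (+ 1) :- con (+ 0) := (con (+ 1) :- q) :+ p) ≈.refl (φ x) (φ y)) )

  -- A linear relation that holds for counts up to a fixed error `C` becomes exact in the limit,
  -- since `C` is divided by the size. Flow conservation and total weight are both instances;
  -- writing the weights as `p - q` with values in the unit interval suits `near-weigh`.
  limit-relation : ∀ {v} → v ∈ FeasibleRegion (suc k) B → ∀ (p q : E → ℝ) →
    (∀ e → 0# ≤ p e) → (∀ e → p e ≤ 1#) → (∀ e → 0# ≤ q e) → (∀ e → q e ≤ 1#) → ∀ C l →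
    (∀ s → s ∈ Av B → Near C (sumᴱ (λ e → ι (occ (value e) s) * (p e - q e))) (ι (size s) * l)) →
    sumᴱ (λ e → v (value e) * (p e - q e)) ≈ l
  limit-relation {v} v∈ p q p≥0 p≤1 q≥0 q≤1 C l bounded = near⇒≈ near
    where
    near : ∀ ε → 0# < ε → Near ε (sumᴱ (λ e → v (value e) * (p e - q e))) l
    near ε 0<ε = near-unscale n (ι-pos (proj₁ s)) (near-weaken total≤ (near-trans approx within))
      where
      -- Every edge costs two shares of the precision through `near-weigh`, and `C` costs one more.
      parts = suc (∣E∣ ℕ.+ ∣E∣)
      δ = ε * ι parts ⁻¹
      0<δ : 0# < δ
      0<δ = *-pos 0<ε (⁻¹-pos (ι-pos (∣E∣ ℕ.+ ∣E∣)))
      long = multiple-exceeds C 0<δ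
      good = feasible⇒approximable v∈ δ 0<δ (proj₁ long)
      s = proj₁ good
      n = ι (size s)
      nδ≥0 = *-nonNeg (ι-nonNeg (size s)) (proj₁ 0<δ)
      within : Near C (sumᴱ (λ e → ι (occ (value e) s) * (p e - q e))) (n * l)
      within = bounded s (proj₁ (proj₂ good))
      scaled : n * sumᴱ (λ e → v (value e) * (p e - q e)) ≈ sumᴱ (λ e → n * v (value e) * (p e - q e))
      scaled = ≈.trans (*-distribˡ-sum n (λ i → v (value (Inverse.to E↔ i)) * (p (Inverse.to E↔ i) - q (Inverse.to E↔ i))))
        (sum-cong-≋ (λ i → ≈.sym (*-assoc n (v (value (Inverse.to E↔ i))) _)))
      approx : Near (sum {∣E∣} (λ _ → n * δ + n * δ)) (n * sumᴱ (λ e → v (value e) * (p e - q e)))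
                 (sumᴱ (λ e → ι (occ (value e) s) * (p e - q e)))
      approx = near-resp ≈.refl (≈.sym scaled) ≈.refl (near-sum {f = λ i → let e = Inverse.to E↔ i in n * v (value e) * (p e - q e)} λ i →
        let e = Inverse.to E↔ i in
        near-sym (near-weigh (p e) (q e) (p≥0 e) (p≤1 e) (q≥0 e) (q≤1 e) nδ≥0 (proj₂ (proj₂ (proj₂ good)) (value e))))
      total≤ : sum {∣E∣} (λ _ → n * δ + n * δ) + C ≤ n * ε
      total≤ = ≤-trans
        (+-mono-≤ (≤-reflexive (sum-const ∣E∣ (n * δ + n * δ)))
          (≤-trans (proj₂ long) (*-monoˡ-≤ δ (proj₁ 0<δ) (ι-mono (proj₁ (proj₂ (proj₂ good)))))))
        (≤-reflexive (begin
          ι ∣E∣ * (n * δ + n * δ) + δ * n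
            ≈⟨ solve 4 (λ a n e i → a :* (n :* (e :* i) :+ n :* (e :* i)) :+ (e :* i) :* n
                 := n :* (e :* ((con (+ 1) :+ (a :+ a)) :* i))) ≈.refl (ι ∣E∣) n ε (ι parts ⁻¹) ⟩
          n * (ε * ((1# + (ι ∣E∣ + ι ∣E∣)) * ι parts ⁻¹))
            ≈⟨ *-congˡ (*-congˡ (≈.trans (*-congʳ (+-congˡ (≈.sym (ι-+ ∣E∣ ∣E∣))))
                 (⁻¹-inverseʳ (ι parts) (pos⇒≉0 (ι-pos (∣E∣ ℕ.+ ∣E∣)))))) ⟩
          n * (ε * 1#)
            ≈⟨ *-congˡ (*-identityʳ ε) ⟩
          n * ε ∎))

  feasible-circulation : ∀ {v} → v ∈ FeasibleRegion (suc k) B → Circulation (v ∘ value)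
  feasible-circulation v∈ x = limit-relation v∈ (λ e → ind (ar e ≡ x)) (λ e → ind (st e ≡ x))
    (λ e → ind-≥0 _) (λ e → ind-≤1 _) (λ e → ind-≥0 _) (λ e → ind-≤1 _) 1# 0# λ (n , σ) av →
      near-resp ≈.refl (≈.sym (c-occ-functional σ av (difference λ v → ind (v ≡ x)))) (≈.sym (zeroʳ _))
        (telescope-bounded (λ v → ind (v ≡ x)) (λ _ → ind-≥0 _) (λ _ → ind-≤1 _)
          (windowEdge σ av) (windowEdge-consecutive σ av))

  -- A permutation of size `suc n` has `suc n ∸ k` windows, which is within `k` of its size. The
  -- constant weight 1 is written as `1# - 0#` to fit `limit-relation`.
  feasible-total : ∀ {v} → v ∈ FeasibleRegion (suc k) B → sumᴱ (v ∘ value) ≈ 1#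
  feasible-total {v} v∈ = ≈.trans (sum-cong-≋ (λ i → ≈.sym (one (v (value (Inverse.to E↔ i))))))
    (limit-relation v∈ (λ _ → 1#) (λ _ → 0#) (λ _ → 0≤1) (λ _ → ≤-refl) (λ _ → ≤-refl) (λ _ → 0≤1) (ι k) 1#
      λ (n , σ) av → near-resp ≈.refl
        (≈.sym (≈.trans (c-occ-functional σ av (λ _ → 1# - 0#)) (≈.trans (sum-const (suc n ℕ.∸ k) (1# - 0#)) (one _)))) ≈.refl
        ( ≤-trans (ι-mono (ℕₚ.m∸n≤m (suc n) k))
            (≤-respˡ (*-identityʳ _) (≤-respˡ (+-identityʳ _) (+-mono-≤ ≤-refl (ι-nonNeg k))))
        , ≤-respˡ (≈.sym (*-identityʳ _)) (≤-respʳ (≈.trans (ι-+ k _) (+-comm _ _)) (ι-mono (ℕₚ.m≤n+m∸n (suc n) k)))))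
    where
    one : ∀ x → x * (1# - 0#) ≈ x
    one x = solve 1 (λ x → x :* (con (+ 1) :- con (+ 0)) := x) ≈.refl x

  feasible-vanishes : ∀ {v} → v ∈ FeasibleRegion (suc k) B → ∀ π → ¬ Avoids B π → v π ≈ 0#
  feasible-vanishes {v} v∈ π ¬av = near⇒≈ λ ε 0<ε →
    let s , s∈ , _ , near = feasible⇒approximable v∈ ε 0<ε 0
    in near-sym (near-unscale (ι (size s)) (ι-pos (proj₁ s)) (near-resp ≈.refl
         (≈.trans (≈.reflexive (cong ι (none (proj₂ s) s∈))) (≈.sym (zeroʳ _))) ≈.refl (near π)))
    where
    none : ∀ {n} (σ : S n) → Avoids B σ → c-occ π σ ≡ 0
    none {n} σ av = trans (c-occ≡# π σ) (#-empty n λ i (h , eq) → ¬av (subst (Avoids B) eq (avoids-pat B (win i h) σ av)))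

  feasible⊆overlap : FeasibleRegion (suc k) B ⊆ OverlapPolytope (suc k) B
  feasible⊆overlap v∈ = feasible-vanishes v∈ ,
    circulation⇒polytope (feasible-circulation v∈) (λ e → proj₁ (proj₁ v∈ (value e))) (feasible-total v∈)

-- Dimension

module AffineSpans (em : ExcludedMiddle 0ℓ) (ℝ-field : CompleteOrderedField) {A : Set} where
  open Reals ℝ-field
  open LinearAlgebra em ℝ-field
  open Relation.Binary.Reasoning.Setoid setoid

  affineHull-empty : ∀ {X : Pred (ℝ^ A) 0ℓ} → (∀ v → ¬ v ∈ X) → ∀ v → ¬ v ∈ AffineHull X
  affineHull-empty X-empty v (zero  , c , p , p∈ , 0≈1 , _) = 0≉1 0≈1
  affineHull-empty X-empty v (suc n , c , p , p∈ , _)       = X-empty (p zero) (p∈ zero)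

  module _ (X : Pred (ℝ^ A) 0ℓ) (o : ℝ^ A) (o∈X : o ∈ X) where

    from-o : ∀ {d} → (Fin d → ℝ^ A) → Fin d → ℝ^ A
    from-o p i a = p i a - o a

    -- Affine independence of `o` together with the points `p`, tested on differences from `o`.
    Independent : ∀ {d} → (Fin d → ℝ^ A) → Set
    Independent p = (∀ i → p i ∈ X) × LinearlyIndependent (from-o p)

    Spanned : ∀ {d} → (Fin d → ℝ^ A) → Pred (ℝ^ A) 0ℓ
    Spanned p x = ∃ λ γ → ∀ a → x a - o a ≈ lin γ (from-o p) a

    cons : ∀ {d} → ℝ^ A → (Fin d → ℝ^ A) → Fin (suc d) → ℝ^ A
    cons x p zero    = x
    cons x p (suc i) = p i

    independent-cons : ∀ {d} (p : Fin d → ℝ^ A) x → Independent p → x ∈ X → ¬ x ∈ Spanned p → Independent (cons x p)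
    independent-cons {d} p x (p∈ , ind-p) x∈ unspanned = (λ { zero → x∈ ; (suc i) → p∈ i }) , independent
      where
      independent : LinearlyIndependent (from-o (cons x p))
      independent c lin≈0 = λ { zero → c₀≈0 ; (suc i) → ind-p (c ∘ suc) rest≈0 i }
        where
        rest = lin (c ∘ suc) (from-o p)
        c₀≈0 : c zero ≈ 0#
        c₀≈0 with em {c zero ≈ 0#}
        ... | yes c₀≈0 = c₀≈0
        ... | no c₀≉0 = contradiction ((λ j → - (c zero ⁻¹) * c (suc j)) , λ a → begin
          x a - o a
            ≈⟨ *-identityˡ _ ⟨
          1# * (x a - o a)
            ≈⟨ *-congʳ (⁻¹-inverseʳ (c zero) c₀≉0) ⟨
          c zero * c zero ⁻¹ * (x a - o a)
            ≈⟨ solve 4 (λ c i x r → c :* i :* x := i :* (c :* x :+ r) :+ :- i :* r) ≈.refl (c zero) (c zero ⁻¹) (x a - o a) (rest a) ⟩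
          c zero ⁻¹ * (c zero * (x a - o a) + rest a) + - (c zero ⁻¹) * rest a
            ≈⟨ +-congʳ (≈.trans (*-congˡ (lin≈0 a)) (zeroʳ _)) ⟩
          0# + - (c zero ⁻¹) * rest a
            ≈⟨ +-identityˡ _ ⟩
          - (c zero ⁻¹) * rest a
            ≈⟨ *-distribˡ-sum (- (c zero ⁻¹)) (λ j → c (suc j) * (p j a - o a)) ⟩
          sum (λ j → - (c zero ⁻¹) * (c (suc j) * (p j a - o a)))
            ≈⟨ sum-cong-≋ (λ j → *-assoc (- (c zero ⁻¹)) (c (suc j)) (p j a - o a)) ⟨
          lin (λ j → - (c zero ⁻¹) * c (suc j)) (from-o p) a ∎) unspanned
        rest≈0 : ∀ a → rest a ≈ 0#
        rest≈0 a = ≈.trans (≈.sym (≈.trans (+-congʳ (≈.trans (*-congʳ c₀≈0) (zeroˡ _))) (+-identityˡ _))) (lin≈0 a)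

    -- Greedy growth: a point of `X` that is not spanned enlarges the family, and `bound` stops this
    -- before the fuel `suc D` runs out.
    maximal : ∀ D → (∀ {d} (p : Fin d → ℝ^ A) → Independent p → d ℕ.≤ D) →
              ∃ λ d → Σ (Fin d → ℝ^ A) λ p → Independent p × ∀ x → x ∈ X → x ∈ Spanned p
    maximal D bound = grow (suc D) 0 (λ ()) ((λ ()) , λ _ _ ()) (ℕₚ.m≤m+n (suc D) 0)
      where
      grow : ∀ fuel d (p : Fin d → ℝ^ A) → Independent p → D ℕ.< fuel ℕ.+ d →
             ∃ λ d → Σ (Fin d → ℝ^ A) λ p → Independent p × ∀ x → x ∈ X → x ∈ Spanned p
      grow zero       d p ind-p D<d = contradiction (bound p ind-p) (ℕₚ.<⇒≱ D<d)
      grow (suc fuel) d p ind-p D<  with em {∃ λ x → x ∈ X × ¬ x ∈ Spanned p}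
      ... | yes (x , x∈ , unspanned) = grow fuel (suc d) (cons x p) (independent-cons p x ind-p x∈ unspanned)
              (subst (D ℕ.<_) (sym (ℕₚ.+-suc fuel d)) D<)
      ... | no ¬unspanned = d , p , ind-p , λ x x∈ → spanned x x∈ em
        where
        spanned : ∀ x → x ∈ X → Dec (x ∈ Spanned p) → x ∈ Spanned p
        spanned x x∈ (yes s) = s
        spanned x x∈ (no ¬s) = contradiction (x , x∈ , ¬s) ¬unspanned

    -- The differences of a maximal family span all of `X - o`. Because affine weights sum to 1,
    -- they then span the directions of the whole hull and serve as its basis.
    dimension : ∀ D → (∀ {d} (p : Fin d → ℝ^ A) → Independent p → d ℕ.≤ D) →
                ∃ λ d → d ℕ.≤ D × Dimension X (+ d)
    dimension D bound = d , bound p ind-p , flat o b (proj₂ ind-p) λ v → mk⇔ to from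
      where
      basis = maximal D bound
      d = proj₁ basis
      p = proj₁ (proj₂ basis)
      ind-p = proj₁ (proj₂ (proj₂ basis))
      spans = proj₂ (proj₂ (proj₂ basis))
      b = from-o p
      to : ∀ {v} → v ∈ AffineHull X → ∃ λ γ → v ≋ (λ a → o a + lin γ b a)
      to {v} (n , c , q , q∈ , total≈1 , eq) = (λ j → sum (λ i → c i * γ i j)) , λ a → begin
        v a
          ≈⟨ eq a ⟩
        sum (λ i → c i * q i a)
          ≈⟨ sum-cong-≋ (λ i → ≈.trans (solve 3 (λ c q o → c :* q := c :* o :+ c :* (q :- o)) ≈.refl (c i) (q i a) (o a))
               (+-congˡ (*-congˡ (γ-eq i a)))) ⟩
        sum (λ i → c i * o a + c i * lin (γ i) b a)
          ≈⟨ ∑-distrib-+ (λ i → c i * o a) (λ i → c i * lin (γ i) b a) ⟩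
        sum (λ i → c i * o a) + sum (λ i → c i * lin (γ i) b a)
          ≈⟨ +-cong (≈.trans (≈.sym (*-distribʳ-sum (o a) c)) (≈.trans (*-congʳ total≈1) (*-identityˡ _))) (begin
            sum (λ i → c i * lin (γ i) b a)
              ≈⟨ sum-cong-≋ (λ i → ≈.trans (*-distribˡ-sum (c i) (λ j → γ i j * b j a))
                   (sum-cong-≋ (λ j → ≈.sym (*-assoc (c i) (γ i j) (b j a))))) ⟩
            sum (λ i → sum (λ j → c i * γ i j * b j a))
              ≈⟨ ∑-comm (λ i j → c i * γ i j * b j a) ⟩
            sum (λ j → sum (λ i → c i * γ i j * b j a))
              ≈⟨ sum-cong-≋ (λ j → *-distribʳ-sum (b j a) (λ i → c i * γ i j)) ⟨
            lin (λ j → sum (λ i → c i * γ i j)) b a ∎) ⟩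
        o a + lin (λ j → sum (λ i → c i * γ i j)) b a ∎
        where
        γ : Fin n → Fin d → ℝ
        γ i = proj₁ (spans (q i) (q∈ i))
        γ-eq : ∀ i a → q i a - o a ≈ lin (γ i) b a
        γ-eq i = proj₂ (spans (q i) (q∈ i))
      from : ∀ {v} → (∃ λ γ → v ≋ (λ a → o a + lin γ b a)) → v ∈ AffineHull X
      from {v} (γ , eq) = suc d , weights , cons o p , (λ { zero → o∈X ; (suc i) → proj₁ ind-p i }) ,
        solve 1 (λ s → con (+ 1) :- s :+ s := con (+ 1)) ≈.refl (sum γ) , λ a → begin
          v a
            ≈⟨ eq a ⟩
          o a + sum (λ j → γ j * (p j a - o a))
            ≈⟨ +-congˡ (≈.trans
                 (sum-cong-≋ (λ j → solve 3 (λ g p o → g :* (p :- o) := g :* p :- g :* o) ≈.refl (γ j) (p j a) (o a)))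
                 (sum-diff (λ j → γ j * p j a) (λ j → γ j * o a))) ⟩
          o a + (sum (λ j → γ j * p j a) - sum (λ j → γ j * o a))
            ≈⟨ +-congˡ (+-congˡ (-‿cong (*-distribʳ-sum (o a) γ))) ⟨
          o a + (sum (λ j → γ j * p j a) - sum γ * o a)
            ≈⟨ solve 3 (λ o l s → o :+ (l :- s :* o) := (con (+ 1) :- s) :* o :+ l) ≈.refl (o a) _ (sum γ) ⟩
          (1# - sum γ) * o a + sum (λ j → γ j * p j a) ∎
        where
        weights : Fin (suc d) → ℝ
        weights zero    = 1# - sum γ
        weights (suc j) = γ j

module DimensionBound (em : ExcludedMiddle 0ℓ) (ℝ-field : CompleteOrderedField) (k : ℕ) (B : Pred 𝒮 0ℓ) where
  open Reals ℝ-field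
  open LinearAlgebra em ℝ-field
  open Regions em ℝ-field k
  open Inclusions em ℝ-field k B
  open Graph G
  open Flows em ℝ-field G E↔ V↔
  open WindowWalk em ℝ-field k B
  open AffineSpans em ℝ-field
  open Relation.Binary.Reasoning.Setoid setoid

  vertexAt : ∀ {n} (σ : S n) → Avoids B σ → ∀ i → i ℕ.+ k ℕ.≤ n → V
  vertexAt σ av i h = pat (win i h) σ , [ avoids-pat B (win i h) σ av ]

  edgeAt : ∀ {n} (σ : S n) → Avoids B σ → ∀ i → i ℕ.+ suc k ℕ.≤ n → E
  edgeAt σ av i h = pat (win i h) σ , [ avoids-pat B (win i h) σ av ]

  -- A combination of the constraints "total weight" and "flow conservation" that is zero on every edge.
  Potential : ℝ → (V → ℝ) → Set
  Potential α φ = ∀ e → α + (φ (ar e) - φ (st e)) ≈ 0#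

  -- Each edge of the window walk lowers `φ` by exactly `α`.
  potential-along : ∀ {α φ} → Potential α φ → ∀ {n} (σ : S n) (av : Avoids B σ) i h h₀ →
                    φ (vertexAt σ av i h) + ι i * α ≈ φ (vertexAt σ av 0 h₀)
  potential-along {α} {φ} pot σ av zero h h₀ =
    ≈.trans (solve 2 (λ x a → x :+ con (+ 0) :* a := x) ≈.refl _ α) (≈.reflexive (cong φ (value-injective
      (pat-ext (win 0 h) (win 0 h₀) σ λ a → Finₚ.toℕ-injective (trans (toℕ-at-win 0 h a) (sym (toℕ-at-win 0 h₀ a)))))))
  potential-along {α} {φ} pot {n} σ av (suc i) h h₀ = begin
    φ (vertexAt σ av (suc i) h) + (1# + ι i) * α
      ≈⟨ +-congʳ (≈.reflexive (cong φ (value-injective (pat-ending i hₑ h σ)))) ⟨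
    φ (ar e) + (1# + ι i) * α
      ≈⟨ solve 4 (λ a r s i → r :+ (con (+ 1) :+ i) :* a := (a :+ (r :- s)) :+ (s :+ i :* a)) ≈.refl α (φ (ar e)) (φ (st e)) (ι i) ⟩
    (α + (φ (ar e) - φ (st e))) + (φ (st e) + ι i * α)
      ≈⟨ +-cong (pot e) (+-congʳ (≈.reflexive (cong φ (value-injective (pat-beginning i hₑ hᵢ σ))))) ⟩
    0# + (φ (vertexAt σ av i hᵢ) + ι i * α)
      ≈⟨ ≈.trans (+-identityˡ _) (potential-along {α} {φ} pot σ av i hᵢ h₀) ⟩
    φ (vertexAt σ av 0 h₀) ∎
    where
    hᵢ : i ℕ.+ k ℕ.≤ n
    hᵢ = ℕₚ.<⇒≤ h
    hₑ : i ℕ.+ suc k ℕ.≤ n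
    hₑ = subst (ℕ._≤ n) (sym (ℕₚ.+-suc i k)) h
    e : E
    e = edgeAt σ av i hₑ

  -- Independence of the constraints in dual form: apart from constant potentials, no combination of
  -- total weight and conservation laws vanishes on every edge.
  Rigid : Set
  Rigid = ∀ {α φ} → Potential α φ → α ≈ 0# × ∀ u w → φ u ≈ φ w

  -- The conservation laws of all vertices add up to zero, so one of them follows from the rest.
  -- Total weight takes the slot of vertex `zero`, which keeps the number of constraints equal to
  -- the number of vertices.
  constraint : ∀ {n} → V HasCardinality n → Fin n → ℝ^ E
  constraint V↔ zero    e = 1#
  constraint V↔ (suc j) e = ind (ar e ≡ Inverse.to V↔ (suc j)) - ind (st e ≡ Inverse.to V↔ (suc j))

  constraint-independent : Rigid → ∀ {n} (V↔ : V HasCardinality n) → LinearlyIndependent (constraint V↔)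
  constraint-independent rigid {suc n} V↔ c lin≈0 = λ { zero → proj₁ rigidity ; (suc j) → c≈0 j }
    where
    x = Inverse.to V↔
    -- The coefficient of each vertex, and zero at the vertex without a conservation law; being
    -- constant, it is zero everywhere.
    φ : V → ℝ
    φ v = sum (λ j → ind (v ≡ x (suc j)) * c (suc j))
    potential : Potential (c zero) φ
    potential e = ≈.trans (+-cong (≈.sym (*-identityʳ _)) (≈.trans
      (≈.sym (sum-diff (λ j → ind (ar e ≡ x (suc j)) * c (suc j)) (λ j → ind (st e ≡ x (suc j)) * c (suc j))))
      (sum-cong-≋ (λ j → solve 3 (λ p q c → p :* c :- q :* c := c :* (p :- q)) ≈.refl
        (ind (ar e ≡ x (suc j))) (ind (st e ≡ x (suc j))) (c (suc j)))))) (lin≈0 e)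
    rigidity = rigid {c zero} {φ} potential
    x-injective : ∀ {i j} → x i ≡ x j → i ≡ j
    x-injective {i} {j} eq = trans (sym (Inverse.strictlyInverseʳ V↔ i)) (trans (cong (Inverse.from V↔) eq) (Inverse.strictlyInverseʳ V↔ j))
    base≈0 : φ (x zero) ≈ 0#
    base≈0 = sum-zero {f = λ j → ind (x zero ≡ x (suc j)) * c (suc j)} λ j →
      ≈.trans (*-congʳ (ind-false (λ eq → Finₚ.0≢1+n (x-injective eq)))) (zeroˡ _)
    c≈0 : ∀ j → c (suc j) ≈ 0#
    c≈0 j = begin
      c (suc j)
        ≈⟨ sum-ind j (c ∘ suc) ⟨
      sum (λ i → ind (j ≡ i) * c (suc i))
        ≈⟨ sum-cong-≋ (λ i → *-congʳ {x = c (suc i)} (ind-cong (mk⇔ (λ { refl → refl }) (λ eq → Finₚ.suc-injective (x-injective eq))))) ⟩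
      φ (x (suc j))
        ≈⟨ proj₂ rigidity (x (suc j)) (x zero) ⟩
      φ (x zero)
        ≈⟨ base≈0 ⟩
      0# ∎

  -- The linear space parallel to the affine space in which the feasible region lies.
  Direction : Pred (ℝ^ Patterns) 0ℓ
  Direction b = (∀ π → ¬ Avoids B π → b π ≈ 0#) × Circulation (b ∘ value) × sumᴱ (b ∘ value) ≈ 0#

  -- Directions are orthogonal to all constraints by definition, so `orthogonal⇒≤` adds the two
  -- counts. Directions vanish off Avₖ(B), hence restricting them to edges preserves independence.
  independent-directions : Rigid → ∀ {d} (b : Fin d → ℝ^ Patterns) → (∀ i → b i ∈ Direction) →
                           LinearlyIndependent b → d ℕ.+ ∣V∣ ℕ.≤ ∣E∣
  independent-directions rigid {d} b b∈ ind-b = orthogonal⇒≤ bᴱ (λ j i → constraint V↔ j (edge i)) ind-bᴱ ind-f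
    (λ i j → orthogonal (b∈ i) V↔ j)
    where
    edge = Inverse.to E↔
    bᴱ : Fin d → ℝ^ Fin ∣E∣
    bᴱ i j = b i (value (edge j))
    on-edges : ∀ {P : E → Set} → (∀ i → P (edge i)) → ∀ e → P e
    on-edges {P} p e = subst P (Inverse.strictlyInverseˡ E↔ e) (p (Inverse.from E↔ e))
    ind-bᴱ : LinearlyIndependent bᴱ
    ind-bᴱ c lin≈0 = ind-b c λ π → vanish π em
      where
      vanish : ∀ π → Dec (Avoids B π) → lin c b π ≈ 0#
      vanish π (yes av) = on-edges {λ e → lin c b (value e) ≈ 0#} lin≈0 (π , [ av ])
      vanish π (no ¬av) = sum-zero {f = λ i → c i * b i π} λ i → ≈.trans (*-congˡ (proj₁ (b∈ i) π ¬av)) (zeroʳ _)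
    ind-f : LinearlyIndependent (λ j i → constraint V↔ j (edge i))
    ind-f c lin≈0 = constraint-independent rigid V↔ c (on-edges {λ e → lin c (constraint V↔) e ≈ 0#} lin≈0)
    orthogonal : ∀ {b} → b ∈ Direction → ∀ {n} (V↔ : V HasCardinality n) j → sumᴱ (λ e → b (value e) * constraint V↔ j e) ≈ 0#
    orthogonal {b} (_ , _ , total≈0) V↔ zero =
      ≈.trans (sum-cong-≋ {x = λ i → b (value (edge i)) * 1#} (λ i → *-identityʳ (b (value (edge i))))) total≈0
    orthogonal (_ , circ , _) V↔ (suc j) = circ (Inverse.to V↔ (suc j))

  difference∈Direction : ∀ {u v} → u ∈ FeasibleRegion (suc k) B → v ∈ FeasibleRegion (suc k) B → (λ π → u π - v π) ∈ Direction
  difference∈Direction {u} {v} u∈ v∈ =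
    (λ π ¬av → ≈.trans (+-cong (feasible-vanishes u∈ π ¬av) (-‿cong (feasible-vanishes v∈ π ¬av))) (-‿inverseʳ 0#)) ,
    (λ x → let d = λ i → ind (ar (edge i) ≡ x) - ind (st (edge i) ≡ x) in begin
      sum (λ i → (uᴱ i - vᴱ i) * d i)
        ≈⟨ sum-cong-≋ (λ i → solve 3 (λ u v d → (u :- v) :* d := u :* d :- v :* d) ≈.refl (uᴱ i) (vᴱ i) (d i)) ⟩
      sum (λ i → uᴱ i * d i - vᴱ i * d i)
        ≈⟨ sum-diff (λ i → uᴱ i * d i) (λ i → vᴱ i * d i) ⟩
      sum (λ i → uᴱ i * d i) - sum (λ i → vᴱ i * d i)
        ≈⟨ +-cong (feasible-circulation u∈ x) (-‿cong (feasible-circulation v∈ x)) ⟩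
      0# - 0#
        ≈⟨ -‿inverseʳ 0# ⟩
      0# ∎) ,
    (begin
      sum (λ i → uᴱ i - vᴱ i)   ≈⟨ sum-diff uᴱ vᴱ ⟩
      sum uᴱ - sum vᴱ           ≈⟨ +-cong (feasible-total u∈) (-‿cong (feasible-total v∈)) ⟩
      1# - 1#                   ≈⟨ -‿inverseʳ 1# ⟩
      0#                        ∎)
    where
    edge = Inverse.to E↔
    uᴱ = λ i → u (value (edge i))
    vᴱ = λ i → v (value (edge i))

  -- Total weight 1 cannot be a sum over no edges. The edge is what the rigidity argument starts
  -- from.
  feasible⇒edge : ∀ {v} → v ∈ FeasibleRegion (suc k) B → E
  feasible⇒edge {v} v∈ = find em
    where
    find : Dec E → E
    find (yes e) = e
    find (no ¬e) = contradiction (≈.trans (≈.sym (sum-zero {f = λ i → v (value (Inverse.to E↔ i))}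
                  λ i → contradiction (Inverse.to E↔ i) ¬e)) (feasible-total v∈)) 0≉1

  DimensionBounded : Set
  DimensionBounded = ∃ λ d → Dimension (FeasibleRegion (suc k) B) d × d ℤ.≤ + ∣E∣ ℤ.- + ∣V∣

  nonempty-bound : Rigid → ∀ {v} → v ∈ FeasibleRegion (suc k) B → DimensionBounded
  nonempty-bound rigid {v} v∈ =
    let d , d≤ , dim = dimension (FeasibleRegion (suc k) B) v v∈ (∣E∣ ℕ.∸ ∣V∣) λ {d} p (p∈ , ind-p) →
          ℕₚ.m+n≤o⇒m≤o∸n d (independent-directions rigid (from-o (FeasibleRegion (suc k) B) v v∈ p)
            (λ i → difference∈Direction (p∈ i) v∈) ind-p)
    in + d , dim , subst (+ d ℤ.≤_) (sym (trans (ℤₚ.m-n≡m⊖n ∣E∣ ∣V∣) (ℤₚ.⊖-≥ (V≤E rigid)))) (ℤ.+≤+ d≤)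
    where
    -- The instance with no directions: the constraints alone are independent in the space of edge
    -- weights. It makes the truncated difference agree with the integer one.
    V≤E : Rigid → ∣V∣ ℕ.≤ ∣E∣
    V≤E rigid = independent-directions rigid {0} (λ ()) (λ ()) (λ _ _ ())

  -- The dimension is -1 here, and the claim concerns the graph only: with an edge, rigidity gives
  -- at least as many edges as vertices; without one, a single vertex still leaves a difference of
  -- -1.
  empty-bound : (∀ v → ¬ v ∈ FeasibleRegion (suc k) B) → (E → Rigid) → (¬ E → ∣V∣ ℕ.≤ 1) → DimensionBounded
  empty-bound region-empty rigid V≤1 = ℤ.-1ℤ , empty (affineHull-empty region-empty) , bound em
    where
    few : ∀ a {b} → b ℕ.≤ 1 → ℤ.-1ℤ ℤ.≤ + a ℤ.- + b
    few a       ℕ.z≤n         = ℤ.-≤+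
    few zero    (ℕ.s≤s ℕ.z≤n) = ℤ.-≤- ℕ.z≤n
    few (suc a) (ℕ.s≤s ℕ.z≤n) = ℤ.-≤+
    bound : Dec E → ℤ.-1ℤ ℤ.≤ + ∣E∣ ℤ.- + ∣V∣
    bound (yes e) = subst (ℤ.-1ℤ ℤ.≤_) (sym (trans (ℤₚ.m-n≡m⊖n ∣E∣ ∣V∣) (ℤₚ.⊖-≥
      (independent-directions (rigid e) {0} (λ ()) (λ ()) (λ _ _ ()))))) ℤ.-≤+
    bound (no ¬e) = few ∣E∣ (V≤1 ¬e)

  dimension-bounded : (E → Rigid) → (¬ E → ∣V∣ ℕ.≤ 1) → DimensionBounded
  dimension-bounded rigid V≤1 = decide em
    where
    decide : Dec (∃ (FeasibleRegion (suc k) B)) → DimensionBounded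
    decide (yes (v , v∈))     = nonempty-bound (rigid (feasible⇒edge v∈)) v∈
    decide (no  region-empty) = empty-bound (λ v v∈ → region-empty (v , v∈)) rigid V≤1

-- Rigidity of the overlap graph of a sum-closed class

module Connectivity (em : ExcludedMiddle 0ℓ) (ℝ-field : CompleteOrderedField) (B : Pred 𝒮 0ℓ)
                    {_∙_ : ∀ {m n} → S m → S n → S (m ℕ.+ n)} (blockSum : BlockSum _∙_)
                    (closed : ∀ {m n} (σ : S (suc m)) (τ : S (suc n)) → Avoids B σ → Avoids B τ → Avoids B (σ ∙ τ)) where
  open Reals ℝ-field
  open Relation.Binary.Reasoning.Setoid setoid

  -- Patterns of length 1. The vertices are empty, so joining two of them yields a walk without
  -- edges and says nothing about `α`; instead every edge is a loop at the single vertex, and its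
  -- potential equation reduces to `α ≈ 0#`.
  module Loops where
    open Inclusions em ℝ-field 0 B
    open Graph G
    open DimensionBound em ℝ-field 0 B

    single-vertex : (u w : V) → u ≡ w
    single-vertex u w = value-injective (value-injective (nil (value (value u)) (value (value w))))
      where
      nil : (xs ys : Vec (Fin 0) 0) → xs ≡ ys
      nil Vec.[] Vec.[] = refl

    rigid : E → Rigid
    rigid e {α} {φ} pot = (begin
      α
        ≈⟨ solve 2 (λ a x → a := a :+ (x :- x)) ≈.refl α (φ (ar e)) ⟩
      α + (φ (ar e) - φ (ar e))
        ≈⟨ +-congˡ (+-congˡ (-‿cong (≈.reflexive (cong φ (single-vertex (ar e) (st e)))))) ⟩
      α + (φ (ar e) - φ (st e))
        ≈⟨ pot e ⟩
      0# ∎) , λ u w → ≈.reflexive (cong φ (single-vertex u w))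

    ∣V∣≤1 : ∣V∣ ℕ.≤ 1
    ∣V∣≤1 = Finₚ.injective⇒≤ {f = λ _ → zero} λ {i} {j} _ →
      trans (sym (Inverse.strictlyInverseʳ V↔ i))
        (trans (cong (Inverse.from V↔) (single-vertex (Inverse.to V↔ i) (Inverse.to V↔ j))) (Inverse.strictlyInverseʳ V↔ j))

    dimension-bound : DimensionBounded
    dimension-bound = dimension-bounded rigid (λ _ → ∣V∣≤1)

  -- The windows of u ∙ w form a walk from u to w.
  module Joined (k′ : ℕ) where
    private k = suc k′
    open Inclusions em ℝ-field k B
    open Graph G
    open DimensionBound em ℝ-field k B

    join-avoids : ∀ u w → Avoids B (value {P = Avoids B} u ∙ value {P = Avoids B} w)
    join-avoids u w = closed (value u) (value w) (vertex-avoids u) (vertex-avoids w)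
      where
      vertex-avoids : ∀ (x : V) → Avoids B (value x)
      vertex-avoids (_ , [ av ]) = recompute em av

    starts : ∀ (u w : V) → Occ (value u) (value u ∙ value w) 0
    starts u w = Equivalence.from (Occ-left blockSum (value u) (value u) (value w) 0 ℕₚ.≤-refl)
      (ℕₚ.≤-refl , pat-full ℕₚ.≤-refl (value u))

    ends : ∀ (u w : V) → Occ (value w) (value u ∙ value w) (k ℕ.+ 0)
    ends u w = Equivalence.from (Occ-right blockSum (value w) (value u) (value w) 0)
      (ℕₚ.≤-refl , pat-full ℕₚ.≤-refl (value w))

    -- The walk inside the join of `u` and `w` has `k` edges, so it lowers `φ` from `φ u` to `φ w`
    -- by `k` times `α`. Taking `u` = `w` forces `α` to vanish because `k` is positive, and then `φ`
    -- is constant.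
    rigid : E → Rigid
    rigid e {α} {φ} pot = α≈0 , λ u w → begin
      φ u                            ≈⟨ joined u w ⟨
      φ w + ι (k ℕ.+ 0) * α          ≈⟨ +-congˡ (≈.trans (*-congˡ α≈0) (zeroʳ _)) ⟩
      φ w + 0#                       ≈⟨ +-identityʳ _ ⟩
      φ w                            ∎
      where
      joined : ∀ u w → φ w + ι (k ℕ.+ 0) * α ≈ φ u
      joined u w = ≈.trans (+-congʳ (≈.reflexive (cong φ (sym (value-injective (proj₂ (ends u w)))))))
        (≈.trans (potential-along {α} {φ} pot (value u ∙ value w) (join-avoids u w) (k ℕ.+ 0) (proj₁ (ends u w)) (proj₁ (starts u w)))
          (≈.reflexive (cong φ (value-injective (proj₂ (starts u w))))))
      α≈0 : α ≈ 0#
      α≈0 = x*y≈0⇒y≈0 (pos⇒≉0 (ι-pos (k′ ℕ.+ 0))) (begin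
        ι (k ℕ.+ 0) * α
          ≈⟨ solve 2 (λ x y → y := (x :+ y) :- x) ≈.refl (φ (st e)) _ ⟩
        φ (st e) + ι (k ℕ.+ 0) * α - φ (st e)
          ≈⟨ +-congʳ (joined (st e) (st e)) ⟩
        φ (st e) - φ (st e)
          ≈⟨ -‿inverseʳ _ ⟩
        0# ∎)

    dimension-bound : DimensionBounded
    dimension-bound = dimension-bounded rigid λ ¬e → Finₚ.injective⇒≤ {f = λ _ → zero} λ {i} {_} _ →
      contradiction (vertex⇒edge (Inverse.to V↔ i)) ¬e
      where
      -- The join of `u` with itself has twice `k` entries, at least `suc k`, so it has a window
      -- that is an edge. Without edges there are thus no vertices at all.
      vertex⇒edge : V → E
      vertex⇒edge u = edgeAt (value u ∙ value u) (join-avoids u u) 0 (ℕ.s≤s (ℕₚ.m≤n+m k k′))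

  dimension-bound : ∀ k → DimensionBound.DimensionBounded em ℝ-field k B
  dimension-bound zero    = Loops.dimension-bound
  dimension-bound (suc k) = Joined.dimension-bound k

-- Convexity and dimension for sum-closed classes

module _ (em : ExcludedMiddle 0ℓ) (ℝ-field : CompleteOrderedField) (k : ℕ) (B : Pred 𝒮 0ℓ) where
  open OverReals ℝ-field
  open Inclusions em ℝ-field k B using (∣E∣; ∣V∣; E↔; V↔)

  ConvexOfBoundedDimension : Set
  ConvexOfBoundedDimension = Convex (FeasibleRegion (suc k) B)
    × ∃ λ d → ∃ λ a → ∃ λ a′ →
        Dimension (FeasibleRegion (suc k) B) d
        × Avₙ B (suc k) HasCardinality a
        × Avₙ B k HasCardinality a′
        × d ℤ.≤ + a ℤ.- + a′

  blockSum-closed : {_∙_ : ∀ {m n} → S m → S n → S (m ℕ.+ n)} → BlockSum _∙_ → Av B Closed-under _∙_ → ConvexOfBoundedDimension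
  blockSum-closed {_∙_} blockSum closed =
    (λ {u} {v} → Mixtures.feasible-convex em ℝ-field k blockSum (λ {m} {n} {τ} {σ} → closed {m} {n} {τ} {σ}) {u} {v}) ,
    let d , dim , d≤ = Connectivity.dimension-bound em ℝ-field B blockSum (λ σ τ → closed {τ = σ} {τ}) k
    in d , ∣E∣ , ∣V∣ , dim , E↔ , V↔ , d≤

  sum-closed : Av B Closed-under _⊕_ ⊎ Av B Closed-under _⊖_ → ConvexOfBoundedDimension
  sum-closed (inj₁ closed) = blockSum-closed {_⊕_} ⊕-blockSum (λ {m} {n} {τ} {σ} → closed {m} {n} {τ} {σ})
  sum-closed (inj₂ closed) = blockSum-closed {_⊖_} ⊖-blockSum (λ {m} {n} {τ} {σ} → closed {m} {n} {τ} {σ})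

open import Data.Integer.Base using (_-_; _≤_) renaming (+_ to fromℕ)

mainTheorem1 : ExcludedMiddle 0ℓ → (ℝ : CompleteOrderedField) → let open OverReals ℝ in
    (k : ℕ) .{{_ : NonZero k}} (B : Pred 𝒮 0ℓ) →
    (FeasibleRegion k B ⊆ UnitCube × Closed (FeasibleRegion k B))
    × (FeasibleRegion k B ⊆ OverlapPolytope k B × OverlapPolytope k B ⊆ FeasibleRegion k ∅)
    × ((Av B) Closed-under _⊕_ ⊎ (Av B) Closed-under _⊖_ →
    Convex (FeasibleRegion k B)
    × ∃ λ d → ∃ λ a → ∃ λ a′ →
    Dimension (FeasibleRegion k B) d
    × Avₙ B k HasCardinality a
    × Avₙ B (pred k) HasCardinality a′
    × d ≤ fromℕ a - fromℕ a′)
    × ((τ : 𝒮) → Convex (FeasibleRegion k ｛ τ ｝))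
mainTheorem1 em ℝ (suc k) B =
  ((λ v∈ → proj₁ v∈) , Regions.feasible-closed em ℝ k B)
  , ( (λ {v} → WindowWalk.feasible⊆overlap em ℝ k B {v})
    , (λ {v} → Inclusions.overlap⊆feasible em ℝ k B {v}))
  , sum-closed em ℝ k B
  , λ τ → proj₁ (sum-closed em ℝ k ｛ τ ｝ (Av-singleton-closed τ))
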